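{- For every constant $w$, Plan Verification is solvable in polynomial time on instances whose initial task network is primitive and has generalized partial order width at most $w$.
   Context: HTN formalism. A domain is $D=(F,A,\mathcal{C},\delta,M)$: $F$ finite set of propositions, $A$ set of actions, $\mathcal{C}$ compound task names ($A\cap\mathcal{C}=\emptyset$), $\delta$ maps each action $a$ to subsets $\mathrm{pre}(a),\mathrm{del}(a),\mathrm{add}(a)$ of $F$, $M$ decomposition methods. Action $a$ is executable in $s\subseteq F$ if $\mathrm{pre}(a)\subseteq s$, yielding $(s\setminus\mathrm{del}(a))\cup\mathrm{add}(a)$; a plan (sequence of actions) is executable in $s$ if executable consecutively from $s$. A task network is $(T,\prec^+,\alpha)$ with finite task set $T$, strict partial order $\prec^+$ and $\alpha:T\to A\cup\mathcal{C}$; primitive if $\alpha(T)\subseteq A$. A linearization of a primitive network is a total order $\bar t$ of $T$ extending $\prec^+$, with action sequence $\alpha(\bar t)$. For a primitive network $tn$, a full solution to $(D,tn,s_0)$ is $tn$ itself provided it has a linearization whose action sequence is executable in $s_0$. Plan Verification: given $tn$ in $D$, $s_0\subseteq F$ and a plan $p$ over $A$, decide whether there is a full solution to $(D,tn,s_0)$ with a linearization $\bar t$ such that $\alpha(\bar t)=p$. The partial order width of a partial order is the size of its largest antichain. An element is isolated if it is incomparable to every other element. The generalized partial order width of $\prec^+$ is the partial order width of $\prec^+$ after removing all isolated elements. -}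

module Defs where

open import Data.Nat using (ℕ; zero; suc; _+_; _*_; _^_; _<_)
open import Data.Bool using (Bool; true; false)
open import Data.Fin using (Fin; toℕ)
open import Data.Fin.Subset using (Subset; _⊆_; _∪_; _─_)
open import Data.List using (List; []; _∷_; _++_; length; replicate; concatMap; map; lookup)
open import Data.List.Relation.Binary.Permutation.Propositional using (_↭_)
open import Data.List.Membership.Propositional using (_∈_)
open import Data.Vec using (toList)
open import Data.Fin.Subset using () renaming (_∈_ to _∈ₛ_)
open import Data.List using (allFin)
open import Data.Sum using (_⊎_; inj₁; inj₂)
open import Data.Product using (Σ; _×_; _,_; ∃)
open import Data.Empty using (⊥)
open import Relation.Nullary using (¬_)
open import Relation.Binary.PropositionalEquality using (_≡_; _≢_)
open import Data.List.Relation.Unary.Unique.Propositional using (Unique)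
open import Data.List.Relation.Unary.All using (All)

-- HTN instances (finite, explicitly represented)
--   propositions F = Fin nF, actions A = Fin nA, compound tasks C = Fin nC
--   (A and C are disjoint as the two summands of A ⊎ C).

-- A task network over nA actions and nC compound task names:
-- tasks T = Fin nT, the order ≺⁺ given as a Boolean matrix, labels α.
record TaskNetwork (nA nC : ℕ) : Set where
  field
    nT  : ℕ
    ord : Fin nT → Fin nT → Bool
    α   : Fin nT → Fin nA ⊎ Fin nC

open TaskNetwork public

Prec : ∀ {nA nC} → (tn : TaskNetwork nA nC) → Fin (nT tn) → Fin (nT tn) → Set
Prec tn t u = ord tn t u ≡ true

syntax Prec tn t u = t ≺⟨ tn ⟩ u

IsStrictPO : ∀ {nA nC} → TaskNetwork nA nC → Set
IsStrictPO tn =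
  (∀ t → ¬ (t ≺⟨ tn ⟩ t)) ×
  (∀ t u v → t ≺⟨ tn ⟩ u → u ≺⟨ tn ⟩ v → t ≺⟨ tn ⟩ v)

record Method (nA nC : ℕ) : Set where
  field
    task : Fin nC
    net  : TaskNetwork nA nC

open Method public

record Domain : Set where
  field
    nF nA nC : ℕ
    pre del add : Fin nA → Subset nF
    methods : List (Method nA nC)

open Domain public

TN : Domain → Set
TN D = TaskNetwork (nA D) (nC D)

WellFormedDomain : Domain → Set
WellFormedDomain D = All (λ m → IsStrictPO (net m)) (methods D)

data Executable (D : Domain) : Subset (nF D) → List (Fin (nA D)) → Set where
  exec-[] : ∀ {s} → Executable D s []
  exec-∷  : ∀ {s a p} → pre D a ⊆ s →
            Executable D ((s ─ del D a) ∪ add D a) p →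
            Executable D s (a ∷ p)

Primitive : ∀ {nA nC} → TaskNetwork nA nC → Set
Primitive tn = ∀ t → Σ (Fin _) λ a → α tn t ≡ inj₁ a

Linearization : ∀ {nA nC} → (tn : TaskNetwork nA nC) → List (Fin (nT tn)) → Set
Linearization tn l =
  (l ↭ allFin (nT tn)) ×
  (∀ t u → t ≺⟨ tn ⟩ u →
     Σ (Fin (length l)) λ i → Σ (Fin (length l)) λ j →
       (toℕ i < toℕ j) × (lookup l i ≡ t) × (lookup l j ≡ u))

record PVInstance : Set where
  field
    dom  : Domain
    tn   : TN dom
    s₀   : Subset (nF dom)
    plan : List (Fin (nA dom))

open PVInstance public

WellFormed : PVInstance → Set
WellFormed I = WellFormedDomain (dom I) × IsStrictPO (tn I)

-- YES-instances of Plan Verification (for primitive tn, the only candidate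
-- full solution is tn itself): tn has a linearization t̄ with α(t̄) = p and
-- p is executable in s₀.
PVYes : PVInstance → Set
PVYes I =
  Σ (List (Fin (nT (tn I)))) λ l →
    Linearization (tn I) l ×
    (map (α (tn I)) l ≡ map inj₁ (plan I)) ×
    Executable (dom I) (s₀ I) (plan I)

Comparable : ∀ {nA nC} → (tn : TaskNetwork nA nC) → Fin (nT tn) → Fin (nT tn) → Set
Comparable tn t u = (t ≺⟨ tn ⟩ u) ⊎ (u ≺⟨ tn ⟩ t)

Isolated : ∀ {nA nC} → (tn : TaskNetwork nA nC) → Fin (nT tn) → Set
Isolated tn t = ∀ u → u ≢ t → ¬ Comparable tn t u

NonIsolatedAntichain : ∀ {nA nC} → (tn : TaskNetwork nA nC) → List (Fin (nT tn)) → Set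
NonIsolatedAntichain tn xs =
  Unique xs ×
  (∀ t → t ∈ xs → ¬ Isolated tn t) ×
  (∀ t u → t ∈ xs → u ∈ xs → ¬ Comparable tn t u)

GenWidth≤ : ∀ {nA nC} → ℕ → TaskNetwork nA nC → Set
GenWidth≤ w tn = ∀ xs → NonIsolatedAntichain tn xs → length xs Data.Nat.≤ w

-- Encoding of instances as bit strings (self-delimiting, unary numbers;
-- polynomially equivalent to any standard encoding since |F|, |A|, |C|,
-- |T| are all part of the input size anyway)

encℕ : ℕ → List Bool
encℕ n = replicate n true ++ (false ∷ [])

encFin : ∀ {n} → Fin n → List Bool
encFin i = encℕ (toℕ i)

encList : ∀ {X : Set} → (X → List Bool) → List X → List Bool
encList f xs = encℕ (length xs) ++ concatMap f xs

encSubset : ∀ {n} → Subset n → List Bool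
encSubset s = toList s

encLabel : ∀ {nA nC} → Fin nA ⊎ Fin nC → List Bool
encLabel (inj₁ a) = false ∷ encFin a
encLabel (inj₂ c) = true ∷ encFin c

encTN : ∀ {nA nC} → TaskNetwork nA nC → List Bool
encTN tn =
  encℕ (nT tn) ++
  concatMap (λ t → map (ord tn t) (allFin (nT tn))) (allFin (nT tn)) ++
  concatMap (λ t → encLabel (α tn t)) (allFin (nT tn))

encDomain : Domain → List Bool
encDomain D =
  encℕ (nF D) ++ encℕ (nA D) ++ encℕ (nC D) ++
  concatMap (λ a → encSubset (pre D a) ++ encSubset (del D a) ++ encSubset (add D a))
            (allFin (nA D)) ++
  encList (λ m → encFin (task m) ++ encTN (net m)) (methods D)

encode : PVInstance → List Bool
encode I = encDomain (dom I) ++ encTN (tn I) ++ encSubset (s₀ I) ++ encList encFin (plan I)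

data Move : Set where
  left right stay : Move

-- tape symbols Fin (3 + g): 0 = blank, 1 = bit false, 2 = bit true, rest work symbols
-- states Fin (3 + q): 0 = start, 1 = accept, 2 = reject (halting)
record TM : Set where
  field
    g q : ℕ
    δ : Fin (3 + q) → Fin (3 + g) → Fin (3 + q) × Fin (3 + g) × Move

open TM public

Sym : TM → Set
Sym M = Fin (3 + g M)

State : TM → Set
State M = Fin (3 + q M)

blank : ∀ {k} → Fin (3 + k)
blank = Fin.zero
  where import Data.Fin as Fin

accept : ∀ {k} → Fin (3 + k)
accept = Fin.suc Fin.zero
  where import Data.Fin as Fin

reject : ∀ {k} → Fin (3 + k)
reject = Fin.suc (Fin.suc Fin.zero)
  where import Data.Fin as Fin

start : ∀ {k} → Fin (3 + k)
start = Fin.zero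
  where import Data.Fin as Fin

bitSym : ∀ {k} → Bool → Fin (3 + k)
bitSym false = Fin.suc Fin.zero
  where import Data.Fin as Fin
bitSym true = Fin.suc (Fin.suc Fin.zero)
  where import Data.Fin as Fin

-- configuration: state, tape left of head (nearest first), head symbol, tape right of head
record Config (M : TM) : Set where
  constructor config
  field
    st    : State M
    lft   : List (Sym M)
    hd    : Sym M
    rgt   : List (Sym M)

open Config public

isHalting : ∀ {k} → Fin (3 + k) → Bool
isHalting (Fin.suc Fin.zero) = true
  where import Data.Fin as Fin
isHalting (Fin.suc (Fin.suc Fin.zero)) = true
  where import Data.Fin as Fin
isHalting _ = false

private
  moveHead : ∀ {M} → State M → List (Sym M) → Sym M → List (Sym M) → Move → Config M
  moveHead s ls x rs stay = config s ls x rs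
  moveHead s [] x rs left = config s [] x rs
  moveHead s (l ∷ ls) x rs left = config s ls l (x ∷ rs)
  moveHead s ls x [] right = config s (x ∷ ls) blank []
  moveHead s ls x (r ∷ rs) right = config s (x ∷ ls) r rs

  stepAux : ∀ {M} → Bool → Config M → Config M
  stepAux true c = c
  stepAux {M} false (config s ls x rs) with δ M s x
  ... | s′ , y , m = moveHead s′ ls y rs m

step : ∀ {M} → Config M → Config M
step c = stepAux (isHalting (st c)) c

run : ∀ {M} → ℕ → Config M → Config M
run zero c = c
run (suc n) c = run n (step c)

initConfig : (M : TM) → List Bool → Config M
initConfig M [] = config start [] blank []
initConfig M (b ∷ bs) = config start [] (bitSym b) (map bitSym bs)

DecidesWithin : (M : TM) → ℕ → Set → List Bool → Set
DecidesWithin M t P x =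
  (P → st (run t (initConfig M x)) ≡ accept) ×
  (¬ P → st (run t (initConfig M x)) ≡ reject)

{-# OPTIONS --safe #-}
module Submission where

-- Since the plan fixes the labels, isolated tasks matter only through their multiset of labels: a linearization with
-- action sequence p exists iff the labels of all tasks form the same multiset as p and the non-isolated tasks can be
-- matched, in an order compatible with ≺, with positions of p carrying their labels; the remaining positions are then
-- filled with the isolated tasks.  Reading p from its end, the non-isolated tasks matched so far always form an
-- up-set.  An up-set is the union of the principal up-sets of its minimal elements, which form an antichain, so width
-- at most w leaves at most (n+1)^w up-sets, and dynamic programming over them decides whether all non-isolated
-- tasks can be matched.
--
-- For the Turing machine, first-order functional programs over pairs and lists are compiled to a machine with three
-- stacks, and these to a one-tape machine with one track per stack.  A fold runs in polynomial time as soon as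
-- its results have polynomial size, which is the only fact about running time to be checked for each function.

open import Defs
open import Data.Bool using (Bool; true; false; if_then_else_; not; _∧_; _∨_)
open import Data.Bool.ListAction using (any; all)
open import Data.Bool.Properties using (T-≡; ∧-zeroʳ; ∧-identityʳ; ∨-identityʳ; ∧-assoc; ∨-assoc)
open import Data.Empty using (⊥; ⊥-elim)
open import Data.Fin using (Fin; toℕ; splitAt; _↑ˡ_; _↑ʳ_) renaming (zero to fzero; suc to fsuc)
open import Data.Fin.Induction using (spo-wellFounded)
open import Data.Fin.Properties using (_≟_; toℕ-injective; splitAt-↑ˡ; splitAt-↑ʳ)
open import Data.Fin.Subset using (Subset; _⊆_; _∪_; _─_)
open import Data.Fin.Subset.Properties using (drop-∷-⊆)
open import Data.List using (List; []; _∷_; _++_; length; map; reverse; _ʳ++_; foldl; foldr; filterᵇ; zip; concatMap; replicate; allFin; tabulate; lookup)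
import Data.List as L
open import Data.List.Membership.Propositional using (_∈_; find; lose)
import Data.List.Membership.DecPropositional as DecMembership
open import Data.List.Membership.Propositional.Properties using (∈-∃++; ∈-filter⁺; ∈-filter⁻; ∈-map⁺; ∈-map⁻; ∈-allFin; ∈-concatMap⁺; ∈-concatMap⁻; ∈-++⁺ˡ; ∈-++⁺ʳ; ∈-lookup)
open import Data.List.Properties using (length-map; length-reverse; length-++; length-replicate; length-tabulate; length-zipWith; ++-assoc; ++-identityʳ; reverse-involutive; reverse-foldl; map-id; map-∘; map-cong; map-++; map-tabulate; tabulate-cong; ∷-injectiveˡ; ∷-injectiveʳ)
import Data.List.Relation.Binary.Permutation.Propositional as Perm
open Perm using (_↭_; prep; ↭-sym; ↭-trans; ↭-refl; ↭-reflexive; ↭⇒↭ₛ)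
open import Data.List.Relation.Binary.Permutation.Propositional.Properties using (shift; ∈-resp-↭; drop-∷; ↭-map-inv; ++⁺ˡ) renaming (map⁺ to ↭-map)
import Data.List.Relation.Binary.Permutation.Setoid.Properties as PermSetoid
open import Data.List.Relation.Ternary.Interleaving.Propositional using (Interleaving; []; consˡ; consʳ; toPermutation)
open import Data.List.Relation.Unary.All as All using (_∷_)
open import Data.List.Relation.Unary.All.Properties using (¬Any⇒All¬)
open import Data.List.Relation.Unary.AllPairs using ([]; _∷_)
open import Data.List.Relation.Unary.Any using (here; there; index)
open import Data.List.Relation.Unary.Any.Properties using (lookup-index)
open import Data.List.Relation.Unary.Unique.Propositional using (Unique)
open import Data.List.Relation.Unary.Unique.Propositional.Properties using (allFin⁺) renaming (filter⁺ to unique-filter; ++⁺ to unique-++)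
open import Data.Maybe using (Maybe; just; nothing; is-nothing)
open import Data.Nat hiding (_≟_)
open import Data.Nat.Properties hiding (_≟_)
open import Data.Nat.Solver using (module +-*-Solver)
open import Data.Product using (Σ; _×_; _,_; proj₁; proj₂)
open import Data.Sum using (_⊎_; inj₁; inj₂)
open import Data.Unit using (⊤; tt)
open import Data.Vec using (toList; here; there) renaming ([] to []ᵥ; _∷_ to _∷ᵥ_)
open import Data.Vec.Properties using (length-toList)
open import Function using (_∘_; id; const; Equivalence)
open import Induction.WellFounded as WF using (Acc)
import Level
open import Relation.Binary.PropositionalEquality using (_≡_; _≢_; refl; sym; trans; cong; cong₂; subst; subst₂; setoid; isEquivalence; module ≡-Reasoning)
open import Relation.Binary.Structures using (IsStrictPartialOrder)
open import Relation.Nullary using (¬_; Dec; yes; no; does)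

-- Finite types

-- Different tasks may share a label, so a greedy matching of the plan can go wrong and the table
-- has to keep all reachable up-sets at once. Isolated tasks must stay out of it, since n of them
-- alone would give 2^n sets; counting suffices for them, because cancelling the labels of the
-- placed tasks from the two equal multisets leaves exactly the labels of the isolated ones.
-- Minimality is never tested: if a task t of an up-set Y is placed in front of Y minus t, its
-- successors lie in Y and therefore come later. The width bound enters at one point, where the sets
-- met along a given linearization are shown to be among the candidates.
--
-- For the machine, the obstacle is composition: the time of a composite depends on the size of the
-- intermediate value. That size comes for free, because one step pushes at most one symbol, so
-- input size plus time bounds the output. Only in a fold does iterating this bound fail to stay
-- polynomial, which is why folds alone carry a size hypothesis.

record Finite (X : Set) : Set where
  field
    card    : ℕ
    to      : X → Fin card
    from    : Fin card → X
    -- One-sided: `Fin card` may contain junk codes, since a machine decodes by `from` only what it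
    -- has encoded by `to`.
    from-to : ∀ x → from (to x) ≡ x

open Finite

retract : ∀ {X Y : Set} (f : X → Y) (g : Y → X) → (∀ x → g (f x) ≡ x) → Finite Y → Finite X
retract f g gf Y = record
  { card = card Y ; to = to Y ∘ f ; from = g ∘ from Y
  ; from-to = λ x → trans (cong g (from-to Y (f x))) (gf x) }

finite-⊤ : Finite ⊤
finite-⊤ = record { card = 1 ; to = λ _ → fzero ; from = λ _ → tt ; from-to = λ _ → refl }

finite-⊎ : ∀ {X Y : Set} → Finite X → Finite Y → Finite (X ⊎ Y)
finite-⊎ {X} {Y} FX FY = record { card = card FX + card FY ; to = to′ ; from = from′ ∘ splitAt (card FX) ; from-to = ft }
  where
  to′ : X ⊎ Y → Fin (card FX + card FY)
  to′ (inj₁ x) = to FX x ↑ˡ card FY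
  to′ (inj₂ y) = card FX ↑ʳ to FY y
  from′ : Fin (card FX) ⊎ Fin (card FY) → X ⊎ Y
  from′ (inj₁ i) = inj₁ (from FX i)
  from′ (inj₂ j) = inj₂ (from FY j)
  ft : ∀ z → from′ (splitAt (card FX) (to′ z)) ≡ z
  ft (inj₁ x) = trans (cong from′ (splitAt-↑ˡ (card FX) (to FX x) (card FY))) (cong inj₁ (from-to FX x))
  ft (inj₂ y) = trans (cong from′ (splitAt-↑ʳ (card FX) (card FY) (to FY y))) (cong inj₂ (from-to FY y))

finite-ΣFin : ∀ {n} {P : Fin n → Set} → (∀ i → Finite (P i)) → Finite (Σ (Fin n) P)
finite-ΣFin {zero} F = record { card = 0 ; to = λ () ; from = λ () ; from-to = λ () }
finite-ΣFin {suc n} {P} F = retract split join join-split (finite-⊎ (F fzero) (finite-ΣFin (F ∘ fsuc)))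
  where
  split : Σ (Fin (suc n)) P → P fzero ⊎ Σ (Fin n) (P ∘ fsuc)
  split (fzero , p) = inj₁ p
  split (fsuc i , p) = inj₂ (i , p)
  join : P fzero ⊎ Σ (Fin n) (P ∘ fsuc) → Σ (Fin (suc n)) P
  join (inj₁ p) = fzero , p
  join (inj₂ (i , p)) = fsuc i , p
  join-split : ∀ x → join (split x) ≡ x
  join-split (fzero , p) = refl
  join-split (fsuc i , p) = refl

finite-Σ : ∀ {X : Set} {P : X → Set} → Finite X → (∀ x → Finite (P x)) → Finite (Σ X P)
finite-Σ {X} {P} FX FP = retract
  (λ (x , p) → to FX x , subst P (sym (from-to FX x)) p)
  (λ (i , p) → from FX i , p)
  (λ (x , p) → transport-pair (from-to FX x) p)
  (finite-ΣFin (FP ∘ from FX))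
  where
  transport-pair : ∀ {x y} (eq : x ≡ y) (p : P y) → (x , subst P (sym eq) p) ≡ (y , p)
  transport-pair refl p = refl

finite-Bool : Finite Bool
finite-Bool = record
  { card = 2
  ; to = λ { false → fzero ; true → fsuc fzero }
  ; from = λ { fzero → false ; (fsuc _) → true }
  ; from-to = λ { false → refl ; true → refl } }

finite-Maybe : ∀ {X : Set} → Finite X → Finite (Maybe X)
finite-Maybe {X} F = retract
  (λ { nothing → inj₁ tt ; (just x) → inj₂ x })
  (λ { (inj₁ _) → nothing ; (inj₂ x) → just x })
  (λ { nothing → refl ; (just x) → refl })
  (finite-⊎ finite-⊤ F)

-- Structured programs: an E-valued program ends with an outcome in E.

data Prog {ℓ} (P : Set → Set ℓ) : Set → Set (Level.suc Level.zero Level.⊔ ℓ) where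
  prim : ∀ {E} → P E → Prog P E
  bind : ∀ {E F} → Finite E → Prog P E → (E → Prog P F) → Prog P F
  -- outcome nothing restarts the body
  loop : ∀ {E} → Prog P (Maybe E) → Prog P E

translate : ∀ {ℓ ℓ′} {P : Set → Set ℓ} {Q : Set → Set ℓ′} → (∀ {E} → P E → Prog Q E) → ∀ {E} → Prog P E → Prog Q E
translate t (prim p) = t p
translate t (bind F p k) = bind F (translate t p) (λ e → translate t (k e))
translate t (loop p) = loop (translate t p)

mv : Move → ℕ → ℕ
mv left = pred
mv right = suc
mv stay = id

upd : ∀ {S : Set} → (ℕ → S) → ℕ → S → ℕ → S
upd f p y i with i Data.Nat.≟ p
... | yes _ = y
... | no _ = f i

upd-same : ∀ {S : Set} (f : ℕ → S) p y → upd f p y p ≡ y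
upd-same f p y with p Data.Nat.≟ p
... | yes _ = refl
... | no p≢p = ⊥-elim (p≢p refl)

upd-id : ∀ {S : Set} (f : ℕ → S) p i → f i ≡ upd f p (f p) i
upd-id f p i with i Data.Nat.≟ p
... | yes refl = refl
... | no _ = refl

-- Turing machines as structured programs whose primitives are single transitions

module Gadgets (S : Set) where

  Act : Set → Set
  Act E = S → E × S × Move

  Gadget : Set → Set₁
  Gadget = Prog Act

  -- A state is a position in the program together with the outcomes of the first halves of `bind`
  -- that led to it. These outcomes are the internal memory of the machine, hence the `Finite`
  -- argument of `bind`.
  Q : ∀ {E} → Gadget E → Set
  Q (prim _) = ⊤
  Q (bind {E} _ g h) = Q g ⊎ Σ E (λ e → Q (h e))
  Q (loop g) = Q g

  entry : ∀ {E} (g : Gadget E) → Q g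
  entry (prim _) = tt
  entry (bind _ g h) = inj₁ (entry g)
  entry (loop g) = entry g

  finite-Q : ∀ {E} (g : Gadget E) → Finite (Q g)
  finite-Q (prim _) = finite-⊤
  finite-Q (bind F g h) = finite-⊎ (finite-Q g) (finite-Σ F (λ e → finite-Q (h e)))
  finite-Q (loop g) = finite-Q g

  next : ∀ {E} (g : Gadget E) → Q g → S → Q g ⊎ E
  output : ∀ {E} (g : Gadget E) → Q g → S → S × Move

  afterFirst : ∀ {E F} (fin : Finite E) (g : Gadget E) (h : E → Gadget F) → Q g ⊎ E → Q (bind fin g h) ⊎ F
  afterFirst fin g h (inj₁ q) = inj₁ (inj₁ q)
  afterFirst fin g h (inj₂ e) = inj₁ (inj₂ (e , entry (h e)))

  afterSecond : ∀ {E F} (fin : Finite E) (g : Gadget E) (h : E → Gadget F) e → Q (h e) ⊎ F → Q (bind fin g h) ⊎ F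
  afterSecond fin g h e (inj₁ q) = inj₁ (inj₂ (e , q))
  afterSecond fin g h e (inj₂ f) = inj₂ f

  afterBody : ∀ {E} (g : Gadget (Maybe E)) → Q g ⊎ Maybe E → Q g ⊎ E
  afterBody g (inj₁ q) = inj₁ q
  afterBody g (inj₂ nothing) = inj₁ (entry g)
  afterBody g (inj₂ (just e)) = inj₂ e

  next (prim k) _ x = inj₂ (proj₁ (k x))
  next (bind fin g h) (inj₁ q) x = afterFirst fin g h (next g q x)
  next (bind fin g h) (inj₂ (e , q)) x = afterSecond fin g h e (next (h e) q x)
  next (loop g) q x = afterBody g (next g q x)

  output (prim k) _ x = proj₂ (k x)
  output (bind _ g h) (inj₁ q) x = output g q x
  output (bind _ g h) (inj₂ (e , q)) x = output (h e) q x
  output (loop g) q x = output g q x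

  -- Steps are closed under pointwise equality of tapes because functions are not extensional.
  data Steps {E} (g : Gadget E) : Q g → ℕ → (ℕ → S) → ℕ → E → ℕ → (ℕ → S) → Set where
    last : ∀ {q p f e f′} → next g q (f p) ≡ inj₂ e →
           (∀ i → f′ i ≡ upd f p (proj₁ (output g q (f p))) i) →
           Steps g q p f 1 e (mv (proj₂ (output g q (f p))) p) f′
    more : ∀ {q q′ p f e f′ n p″ f″} → next g q (f p) ≡ inj₁ q′ →
           (∀ i → f′ i ≡ upd f p (proj₁ (output g q (f p))) i) →
           Steps g q′ (mv (proj₂ (output g q (f p))) p) f′ n e p″ f″ →
           Steps g q p f (suc n) e p″ f″

  steps-second : ∀ {E F} {fin : Finite E} {g : Gadget E} {h : E → Gadget F} {e q p f n r p′ f′} →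
                 Steps (h e) q p f n r p′ f′ → Steps (bind fin g h) (inj₂ (e , q)) p f n r p′ f′
  steps-second {fin = fin} {g} {h} {e} (last eq w) = last (cong (afterSecond fin g h e) eq) w
  steps-second {fin = fin} {g} {h} {e} (more eq w s) = more (cong (afterSecond fin g h e) eq) w (steps-second s)

  -- The transition that leaves `g` already enters the second program, so step counts add without
  -- overhead.
  steps-first : ∀ {E F} {fin : Finite E} {g : Gadget E} {h : E → Gadget F} {e q p f n p′ f′ m r p″ f″} →
                Steps g q p f n e p′ f′ → Steps (h e) (entry (h e)) p′ f′ m r p″ f″ →
                Steps (bind fin g h) (inj₁ q) p f (n + m) r p″ f″
  steps-first {fin = fin} {g} {h} (last eq w) s = more (cong (afterFirst fin g h) eq) w (steps-second s)
  steps-first {fin = fin} {g} {h} (more eq w r) s = more (cong (afterFirst fin g h) eq) w (steps-first r s)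

  steps-exit : ∀ {E} {g : Gadget (Maybe E)} {e q p f n p′ f′} →
               Steps g q p f n (just e) p′ f′ → Steps (loop g) q p f n e p′ f′
  steps-exit {g = g} (last eq w) = last (cong (afterBody g) eq) w
  steps-exit {g = g} (more eq w s) = more (cong (afterBody g) eq) w (steps-exit s)

  steps-again : ∀ {E} {g : Gadget (Maybe E)} {e q p f n p′ f′ m p″ f″} →
                Steps g q p f n nothing p′ f′ → Steps (loop g) (entry g) p′ f′ m e p″ f″ →
                Steps (loop g) q p f (n + m) e p″ f″
  steps-again {g = g} (last eq w) s = more (cong (afterBody g) eq) w s
  steps-again {g = g} (more eq w r) s = more (cong (afterBody g) eq) w (steps-again r s)

-- From structured transition programs to Turing machines

nth : ∀ {X : Set} → X → List X → ℕ → X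
nth d [] _ = d
nth d (x ∷ xs) zero = x
nth d (x ∷ xs) (suc i) = nth d xs i

nth-ʳ++-cong : ∀ {X : Set} {d : X} (ls : List X) {ys zs} → (∀ i → nth d ys i ≡ nth d zs i) →
               ∀ i → nth d (ls ʳ++ ys) i ≡ nth d (ls ʳ++ zs) i
nth-ʳ++-cong [] eq = eq
nth-ʳ++-cong (l ∷ ls) eq = nth-ʳ++-cong ls λ { zero → refl ; (suc i) → eq i }

nth-ʳ++ : ∀ {X : Set} {d : X} (ls : List X) ys i → nth d (ls ʳ++ ys) (length ls + i) ≡ nth d ys i
nth-ʳ++ [] ys i = refl
nth-ʳ++ (l ∷ ls) ys i = trans (cong (nth _ (ls ʳ++ (l ∷ ys))) (sym (+-suc (length ls) i))) (nth-ʳ++ ls (l ∷ ys) (suc i))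

nth-ʳ++-hd : ∀ {X : Set} {d : X} (ls : List X) x ys → nth d (ls ʳ++ (x ∷ ys)) (length ls) ≡ x
nth-ʳ++-hd ls x ys = trans (cong (nth _ (ls ʳ++ (x ∷ ys))) (sym (+-identityʳ _))) (nth-ʳ++ ls (x ∷ ys) 0)

nth-ʳ++-≢ : ∀ {X : Set} {d : X} (ls : List X) x y ys i → i ≢ length ls →
            nth d (ls ʳ++ (x ∷ ys)) i ≡ nth d (ls ʳ++ (y ∷ ys)) i
nth-ʳ++-≢ {d = d} ls x y ys i i≢ = go ls i 0 (i≢ ∘ (λ eq → trans eq (+-identityʳ _))) λ { zero 0≢0 → ⊥-elim (0≢0 refl) ; (suc j) _ → refl }
  where
  go : ∀ ls i k → i ≢ length ls + k → ∀ {ys zs} → (∀ j → j ≢ k → nth d ys j ≡ nth d zs j) →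
       nth d (ls ʳ++ ys) i ≡ nth d (ls ʳ++ zs) i
  go [] i k ne eq = eq i ne
  go (l ∷ ls) i k ne eq = go ls i (suc k) (ne ∘ λ e → trans e (+-suc (length ls) k))
    λ { zero _ → refl ; (suc j) j≢ → eq j (j≢ ∘ cong suc) }

run-halted : ∀ {M} n (c : Config M) → isHalting (st c) ≡ true → run n c ≡ c
run-halted zero c h = refl
run-halted (suc n) c h rewrite h = run-halted n c h

run-+ : ∀ {M} m n (c : Config M) → run (m + n) c ≡ run n (run m c)
run-+ zero n c = refl
run-+ (suc m) n c = run-+ m n (step c)

verdict : ∀ {k} → Bool → Fin (3 + k)
verdict true = accept
verdict false = reject

verdict-halting : ∀ {k} b → isHalting (verdict {k} b) ≡ true
verdict-halting true = refl
verdict-halting false = refl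

-- Restates the head movement inside `step`, which is private there; `step-moveTo` identifies the
-- two by cases.
moveTo : ∀ {M} → State M → List (Sym M) → Sym M → List (Sym M) → Move → Config M
moveTo s ls x rs stay = config s ls x rs
moveTo s [] x rs left = config s [] x rs
moveTo s (l ∷ ls) x rs left = config s ls l (x ∷ rs)
moveTo s ls x [] right = config s (x ∷ ls) blank []
moveTo s ls x (r ∷ rs) right = config s (x ∷ ls) r rs

st-moveTo : ∀ {M} s ls x rs m → st (moveTo {M} s ls x rs m) ≡ s
st-moveTo s ls x rs stay = refl
st-moveTo s [] x rs left = refl
st-moveTo s (l ∷ ls) x rs left = refl
st-moveTo s ls x [] right = refl
st-moveTo s ls x (r ∷ rs) right = refl

step-moveTo : ∀ {M : TM} s ls x rs → isHalting s ≡ false →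
              step {M} (config s ls x rs) ≡
              moveTo (proj₁ (δ M s x)) ls (proj₁ (proj₂ (δ M s x))) rs (proj₂ (proj₂ (δ M s x)))
step-moveTo {M} s ls x rs running rewrite running with δ M s x | ls | rs
... | n , y , stay | _ | _ = refl
... | n , y , left | [] | _ = refl
... | n , y , left | _ ∷ _ | _ = refl
... | n , y , right | _ | [] = refl
... | n , y , right | _ | _ ∷ _ = refl

module Machine {S : Set} (finite-S : Finite S) (blankS : S) (bitS : Bool → S)
               (G : Prog (Gadgets.Act S) Bool) where
  open Gadgets S

  -- The reserved symbols are second codes of `blankS` and of the two `bitS`: the machine reads them
  -- from the initial tape but writes only codes from 3 on.
  decS : Fin (3 + card finite-S) → S
  decS fzero = blankS
  decS (fsuc fzero) = bitS false
  decS (fsuc (fsuc fzero)) = bitS true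
  decS (fsuc (fsuc (fsuc i))) = from finite-S i

  encS : S → Fin (3 + card finite-S)
  encS s = fsuc (fsuc (fsuc (to finite-S s)))

  decQ : Fin (3 + card (finite-Q G)) → Q G
  decQ (fsuc (fsuc (fsuc i))) = from (finite-Q G) i
  -- Code 0 is the start state; the two halting codes get an arbitrary value, as no step is taken
  -- from them.
  decQ _ = entry G

  encNext : Q G ⊎ Bool → Fin (3 + card (finite-Q G))
  encNext (inj₁ q) = fsuc (fsuc (fsuc (to (finite-Q G) q)))
  encNext (inj₂ b) = verdict b

  machine : TM
  machine = record
    { g = card finite-S
    ; q = card (finite-Q G)
    ; δ = λ s x → encNext (next G (decQ s) (decS x)) ,
                  encS (proj₁ (output G (decQ s) (decS x))) ,
                  proj₂ (output G (decQ s) (decS x)) }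

  -- The left part is stored nearest cell first, so reversing it onto the rest gives the tape from
  -- cell 0, and the head stands at `length ls`. A left move at cell 0 does nothing, in agreement
  -- with `pred`.
  cells : List (Sym machine) → Sym machine → List (Sym machine) → ℕ → S
  cells ls x rs i = decS (nth fzero (ls ʳ++ (x ∷ rs)) i)

  Represents : Config machine → ℕ → (ℕ → S) → Set
  Represents (config s ls x rs) p f = length ls ≡ p × (∀ i → cells ls x rs i ≡ f i)

  head-cell : ∀ ls x rs → cells ls x rs (length ls) ≡ decS x
  head-cell ls x rs = cong decS (nth-ʳ++-hd ls x rs)

  written : ∀ ls x rs f y → (∀ i → cells ls x rs i ≡ f i) →
            ∀ i → cells ls (encS y) rs i ≡ upd f (length ls) y i
  written ls x rs f y eq i with i Data.Nat.≟ length ls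
  ... | yes refl = trans (head-cell ls (encS y) rs) (from-to finite-S y)
  ... | no i≢ = trans (cong decS (nth-ʳ++-≢ ls (encS y) x rs i i≢)) (eq i)


  represents-moveTo : ∀ s ls y rs m {f} → (∀ i → cells ls y rs i ≡ f i) →
                      Represents (moveTo s ls y rs m) (mv m (length ls)) f
  represents-moveTo s ls y rs stay eq = refl , eq
  represents-moveTo s [] y rs left eq = refl , eq
  represents-moveTo s (l ∷ ls) y rs left eq = refl , eq
  -- The blank appended to the list is what reading beyond its end yields anyway.
  represents-moveTo s ls y [] right eq = refl , λ i →
    trans (cong decS (nth-ʳ++-cong ls {y ∷ fzero ∷ []} {y ∷ []} (λ { zero → refl ; (suc zero) → refl ; (suc (suc i)) → refl }) i)) (eq i)
  represents-moveTo s ls y (r ∷ rs) right eq = refl , eq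

  step-represents : ∀ (c : Config machine) p f → isHalting (st c) ≡ false → Represents c p f →
    let o = output G (decQ (st c)) (f p) in
    st (step c) ≡ encNext (next G (decQ (st c)) (f p)) ×
    Represents (step c) (mv (proj₂ o) p) (upd f p (proj₁ o))
  step-represents (config s ls x rs) _ f running (refl , eq)
    rewrite step-moveTo {machine} s ls x rs running | sym (eq (length ls)) | head-cell ls x rs =
    st-moveTo _ ls (encS y) rs m ,
    represents-moveTo _ ls (encS y) rs m (written ls x rs f y eq)
    where
    y = proj₁ (output G (decQ s) (decS x))
    m = proj₂ (output G (decQ s) (decS x))

  represents-≗ : ∀ (c : Config machine) {p f f′} → (∀ i → f′ i ≡ f i) → Represents c p f → Represents c p f′
  represents-≗ (config s ls x rs) eq (l , c) = l , λ i → trans (c i) (sym (eq i))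

  encNext-running : ∀ {r q} → r ≡ inj₁ q → isHalting (encNext r) ≡ false × decQ (encNext r) ≡ q
  encNext-running {q = q} refl = refl , from-to (finite-Q G) q

  simulates : ∀ {q p f n b p′ f′} → Steps G q p f n b p′ f′ → ∀ (c : Config machine) →
              isHalting (st c) ≡ false → decQ (st c) ≡ q → Represents c p f →
              st (run n c) ≡ verdict b
  simulates {p = p} {f} (last eq w) c running refl rep =
    trans (proj₁ (step-represents c p f running rep)) (cong encNext eq)
  simulates {p = p} {f} (more eq w s) c running refl rep
    with step-represents c p f running rep
  ... | st≡ , rep′ =
    simulates s (step c)
      (trans (cong isHalting st≡) (proj₁ (encNext-running eq)))
      (trans (cong decQ st≡) (proj₂ (encNext-running eq)))
      (represents-≗ (step c) w rep′)

  inputTape : List Bool → ℕ → S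
  inputTape bs = nth blankS (map bitS bs)

  decS-bit : ∀ b → decS (bitSym b) ≡ bitS b
  decS-bit false = refl
  decS-bit true = refl

  cells-bits : ∀ bs i → decS (nth fzero (map bitSym bs) i) ≡ inputTape bs i
  cells-bits [] i = refl
  cells-bits (b ∷ bs) zero = decS-bit b
  cells-bits (b ∷ bs) (suc i) = cells-bits bs i

  init-represents : ∀ bs → Represents (initConfig machine bs) 0 (inputTape bs)
  init-represents [] = refl , λ { zero → refl ; (suc i) → refl }
  init-represents (b ∷ bs) = refl , cells-bits (b ∷ bs)

  init-start : ∀ bs → st (initConfig machine bs) ≡ fzero
  init-start [] = refl
  init-start (b ∷ bs) = refl

  machine-correct : ∀ bs {n b p′ f′ t} → Steps G (entry G) 0 (inputTape bs) n b p′ f′ → n ≤ t →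
                    st (run t (initConfig machine bs)) ≡ verdict b
  machine-correct bs {n} {b} {t = t} s n≤t = begin
    st (run t c)                  ≡⟨ cong (λ k → st (run k c)) (sym (m+[n∸m]≡n n≤t)) ⟩
    st (run (n + (t ∸ n)) c)      ≡⟨ cong st (run-+ n (t ∸ n) c) ⟩
    st (run (t ∸ n) (run n c))    ≡⟨ cong st (run-halted (t ∸ n) (run n c) (trans (cong isHalting halt) (verdict-halting b))) ⟩
    st (run n c)                  ≡⟨ halt ⟩
    verdict b                     ∎
    where
    open ≡-Reasoning
    c = initConfig machine bs
    halt : st (run n c) ≡ verdict b
    halt = simulates s c (cong isHalting (init-start bs)) (cong decQ (init-start bs)) (init-represents bs)

-- Stack machines with three stacks

data Γ : Set where
  bit : Bool → Γ
  sep : Γ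

finite-Γ : Finite Γ
finite-Γ = retract
  (λ { (bit b) → just b ; sep → nothing })
  (λ { (just b) → bit b ; nothing → sep })
  (λ { (bit b) → refl ; sep → refl })
  (finite-Maybe finite-Bool)

data Reg : Set where
  A B C : Reg

_≟ʳ_ : (r s : Reg) → Dec (r ≡ s)
A ≟ʳ A = yes refl
B ≟ʳ B = yes refl
C ≟ʳ C = yes refl
A ≟ʳ B = no λ ()
A ≟ʳ C = no λ ()
B ≟ʳ A = no λ ()
B ≟ʳ C = no λ ()
C ≟ʳ A = no λ ()
C ≟ʳ B = no λ ()

Triple : Set → Set
Triple X = X × X × X

get : ∀ {X : Set} → Reg → Triple X → X
get A (a , b , c) = a
get B (a , b , c) = b
get C (a , b , c) = c

set : ∀ {X : Set} → Reg → X → Triple X → Triple X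
set A x (a , b , c) = x , b , c
set B x (a , b , c) = a , x , c
set C x (a , b , c) = a , b , x

get-set : ∀ {X : Set} r (x : X) t → get r (set r x t) ≡ x
get-set A x t = refl
get-set B x t = refl
get-set C x t = refl

get-set-≢ : ∀ {X : Set} {r s} (x : X) t → s ≢ r → get s (set r x t) ≡ get s t
get-set-≢ {r = A} {A} x t ne = ⊥-elim (ne refl)
get-set-≢ {r = A} {B} x t ne = refl
get-set-≢ {r = A} {C} x t ne = refl
get-set-≢ {r = B} {A} x t ne = refl
get-set-≢ {r = B} {B} x t ne = ⊥-elim (ne refl)
get-set-≢ {r = B} {C} x t ne = refl
get-set-≢ {r = C} {A} x t ne = refl
get-set-≢ {r = C} {B} x t ne = refl
get-set-≢ {r = C} {C} x t ne = ⊥-elim (ne refl)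

Stacks : Set
Stacks = Triple (List Γ)

height : Stacks → ℕ
height (a , b , c) = length a + (length b + length c)

length-get : ∀ r σ → length (get r σ) ≤ height σ
length-get A (a , b , c) = m≤m+n _ _
length-get B (a , b , c) = ≤-trans (m≤m+n _ _) (m≤n+m _ (length a))
length-get C (a , b , c) = ≤-trans (m≤n+m _ (length b)) (m≤n+m _ (length a))

data Op : Set → Set₁ where
  push : Reg → Γ → Op ⊤
  pop  : Reg → Op (Maybe Γ)
  ret  : ∀ {E} → E → Op E

SP : Set → Set₁
SP = Prog Op

data Run : ∀ {E} → SP E → Stacks → E → Stacks → ℕ → Set₁ where
  run-push  : ∀ {r γ σ} → Run (prim (push r γ)) σ tt (set r (γ ∷ get r σ) σ) 1
  run-pop   : ∀ {r γ xs σ} → get r σ ≡ γ ∷ xs → Run (prim (pop r)) σ (just γ) (set r xs σ) 1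
  run-empty : ∀ {r σ} → get r σ ≡ [] → Run (prim (pop r)) σ nothing σ 1
  run-ret   : ∀ {E} {e : E} {σ} → Run (prim (ret e)) σ e σ 1
  run-bind  : ∀ {E F} {fin : Finite E} {p : SP E} {k : E → SP F} {σ e σ′ f σ″ t u} →
              Run p σ e σ′ t → Run (k e) σ′ f σ″ u → Run (bind fin p k) σ f σ″ (t + u)
  run-exit  : ∀ {E} {p : SP (Maybe E)} {σ e σ′ t} → Run p σ (just e) σ′ t → Run (loop p) σ e σ′ t
  run-again : ∀ {E} {p : SP (Maybe E)} {σ σ′ e σ″ t u} →
              Run p σ nothing σ′ t → Run (loop p) σ′ e σ″ u → Run (loop p) σ e σ″ (t + u)
  run-≤     : ∀ {E} {p : SP E} {σ e σ′ t u} → t ≤ u → Run p σ e σ′ t → Run p σ e σ′ u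

-- Stacks as tracks of a tape: all bottoms are at cell 0, which carries a mark so that the head can return to it.

Cell : Set
Cell = Bool × Triple (Maybe Γ)

finite-Cell : Finite Cell
finite-Cell = finite-Σ finite-Bool λ _ → finite-Σ F λ _ → finite-Σ F λ _ → F
  where F = finite-Maybe finite-Γ

mark : Cell → Bool
mark = proj₁

track : Reg → Cell → Maybe Γ
track r (_ , t) = get r t

setTrack : Reg → Maybe Γ → Cell → Cell
setTrack r x (m , t) = m , set r x t

open Gadgets Cell

sweep : (Cell → Bool) → Move → Gadget ⊤
sweep stop m = loop (prim λ c → if stop c then (just tt , c , stay) else (nothing , c , m))

toTop : Reg → Gadget ⊤
toTop r = sweep (λ c → is-nothing (track r c)) right

toBottom : Gadget ⊤
toBottom = sweep mark left

pushG : Reg → Γ → Gadget ⊤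
pushG r γ = bind finite-⊤ (toTop r) λ _ →
            bind finite-⊤ (prim λ c → tt , setTrack r (just γ) c , stay) λ _ → toBottom

retG : ∀ {E} → E → Gadget E
retG e = prim λ c → e , c , stay

popTop : Reg → Gadget (Maybe Γ)
popTop r = bind (finite-Maybe finite-Γ) (prim λ c → track r c , setTrack r nothing c , stay) λ x →
           bind finite-⊤ toBottom λ _ → retG x

popG : Reg → Gadget (Maybe Γ)
popG r = bind finite-⊤ (toTop r) λ _ →
         -- The head is on the lowest empty cell of the track. It carries the mark exactly when the
         -- stack is empty; otherwise the top symbol is one cell to the left.
         bind finite-Bool (prim λ c → if mark c then (true , c , stay) else (false , c , left)) λ
           { true → retG nothing ; false → popTop r }

opG : ∀ {E} → Op E → Gadget E
opG (push r γ) = pushG r γ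
opG (pop r) = popG r
opG (ret e) = retG e

steps-prim : ∀ {E} {k : Act E} {p f e y m f′} → k (f p) ≡ (e , y , m) → (∀ i → f′ i ≡ upd f p y i) →
             Steps (prim k) tt p f 1 e (mv m p) f′
steps-prim {k = k} {p} {f} {m = m} {f′} eq w =
  subst (λ z → Steps (prim k) tt p f 1 (proj₁ z) (mv (proj₂ (proj₂ z)) p) f′) eq
    (last refl (λ i → trans (w i) (cong (λ z → upd f p (proj₁ (proj₂ z)) i) (sym eq))))

steps-still : ∀ {E} {k : Act E} {p f e m} → k (f p) ≡ (e , f p , m) → Steps (prim k) tt p f 1 e (mv m p) f
steps-still {p = p} {f} eq = steps-prim eq (upd-id f p)

sweep-stops : ∀ {stop m p f} → stop (f p) ≡ true → Steps (sweep stop m) tt p f 1 tt p f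
sweep-stops {stop} {m} {p} {f} eq = steps-exit (steps-still {e = just tt} {stay} (cong (λ b → if b then (just tt , f p , stay) else (nothing , f p , m)) eq))

sweep-goes : ∀ {stop m p f n p′ f′} → stop (f p) ≡ false → Steps (sweep stop m) tt (mv m p) f n tt p′ f′ →
             Steps (sweep stop m) tt p f (suc n) tt p′ f′
sweep-goes {stop} {m} {p} {f} eq s =
  steps-again (steps-still {e = nothing} {m} (cong (λ b → if b then (just tt , f p , stay) else (nothing , f p , m)) eq)) s

sweep-right : ∀ {stop} k p f → (∀ i → i < k → stop (f (i + p)) ≡ false) → stop (f (k + p)) ≡ true →
              Steps (sweep stop right) tt p f (suc k) tt (k + p) f
sweep-right zero p f go halt = sweep-stops {m = right} halt
sweep-right {stop} (suc k) p f go halt =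
  sweep-goes {m = right} (go 0 z<s) (subst (λ n → Steps (sweep stop right) tt (suc p) f (suc k) tt n f) (+-suc k p)
    (sweep-right k (suc p) f (λ i i<k → trans (cong (stop ∘ f) (+-suc i p)) (go (suc i) (s≤s i<k)))
      (trans (cong (stop ∘ f) (+-suc k p)) halt)))

sweep-left : ∀ {stop} k f → (∀ i → stop (f (suc i)) ≡ false) → stop (f 0) ≡ true →
             Steps (sweep stop left) tt k f (suc k) tt 0 f
sweep-left zero f go halt = sweep-stops {m = left} halt
sweep-left (suc k) f go halt = sweep-goes {m = left} (go k) (sweep-left k f go halt)

-- contents of the track of a stack whose top is the head of the list
slot : List Γ → ℕ → Maybe Γ
slot [] i = nothing
slot (x ∷ xs) = upd (slot xs) (length xs) (just x)

slot-above : ∀ xs i → length xs ≤ i → slot xs i ≡ nothing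
slot-above [] i _ = refl
slot-above (x ∷ xs) i le with i Data.Nat.≟ length xs
... | yes refl = ⊥-elim (<-irrefl refl le)
... | no _ = slot-above xs i (<⇒≤ le)

slot-below : ∀ xs i → i < length xs → is-nothing (slot xs i) ≡ false
slot-below (x ∷ xs) i lt with i Data.Nat.≟ length xs
... | yes _ = refl
... | no i≢ = slot-below xs i (≤∧≢⇒< (s≤s⁻¹ lt) i≢)

slot-tail : ∀ x xs i → slot xs i ≡ upd (slot (x ∷ xs)) (length xs) nothing i
slot-tail x xs i with i Data.Nat.≟ length xs
... | yes refl = slot-above xs _ ≤-refl
... | no i≢ with i Data.Nat.≟ length xs
...   | yes eq = ⊥-elim (i≢ eq)
...   | no _ = refl

Holds : Stacks → (ℕ → Cell) → Set
Holds σ f = mark (f 0) ≡ true × (∀ i → mark (f (suc i)) ≡ false) × (∀ r i → track r (f i) ≡ slot (get r σ) i)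

upd-∘ : ∀ {S T : Set} (h : S → T) f p y i → h (upd f p y i) ≡ upd (h ∘ f) p (h y) i
upd-∘ h f p y i with i Data.Nat.≟ p
... | yes _ = refl
... | no _ = refl

upd-cong : ∀ {S : Set} {f g : ℕ → S} p {y z} → (∀ i → f i ≡ g i) → y ≡ z → ∀ i → upd f p y i ≡ upd g p z i
upd-cong p eq refl i with i Data.Nat.≟ p
... | yes _ = refl
... | no _ = eq i

holds-set : ∀ {σ f} r p x xs → Holds σ f → (∀ i → slot xs i ≡ upd (slot (get r σ)) p x i) →
            Holds (set r xs σ) (upd f p (setTrack r x (f p)))
holds-set {σ} {f} r p x xs (m0 , ms , tr) eq = trans (mk 0) m0 , (λ i → trans (mk (suc i)) (ms i)) , tr′
  where
  mk : ∀ i → mark (upd f p (setTrack r x (f p)) i) ≡ mark (f i)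
  mk i = trans (upd-∘ mark f p (setTrack r x (f p)) i) (sym (upd-id (mark ∘ f) p i))
  tr′ : ∀ s i → track s (upd f p (setTrack r x (f p)) i) ≡ slot (get s (set r xs σ)) i
  tr′ s i with s ≟ʳ r
  ... | yes refl = begin
    track s (upd f p (setTrack s x (f p)) i)       ≡⟨ upd-∘ (track s) f p (setTrack s x (f p)) i ⟩
    upd (track s ∘ f) p (track s (setTrack s x (f p))) i ≡⟨ upd-cong p (tr s) (get-set s x (proj₂ (f p))) i ⟩
    upd (slot (get s σ)) p x i                     ≡⟨ eq i ⟨
    slot xs i                                      ≡⟨ cong (λ z → slot z i) (get-set s xs σ) ⟨
    slot (get s (set s xs σ)) i                    ∎
    where open ≡-Reasoning
  ... | no s≢r = begin
    track s (upd f p (setTrack r x (f p)) i)       ≡⟨ upd-∘ (track s) f p (setTrack r x (f p)) i ⟩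
    upd (track s ∘ f) p (track s (setTrack r x (f p))) i ≡⟨ upd-cong p (λ _ → refl) (get-set-≢ x (proj₂ (f p)) s≢r) i ⟩
    upd (track s ∘ f) p (track s (f p)) i          ≡⟨ upd-id (track s ∘ f) p i ⟨
    track s (f i)                                  ≡⟨ tr s i ⟩
    slot (get s σ) i                               ≡⟨ cong (λ z → slot z i) (get-set-≢ xs σ s≢r) ⟨
    slot (get s (set r xs σ)) i                    ∎
    where open ≡-Reasoning

steps-toTop : ∀ {σ f} r → Holds σ f → let k = length (get r σ) in Steps (toTop r) tt 0 f (suc k) tt k f
steps-toTop {σ} {f} r (_ , _ , tr) =
  subst (λ n → Steps (toTop r) tt 0 f (suc k) tt n f) (+-identityʳ k)
    (sweep-right k 0 f
      (λ i i<k → trans (cong is-nothing (trans (cong (track r ∘ f) (+-identityʳ i)) (tr r i))) (slot-below (get r σ) i i<k))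
      (cong is-nothing (trans (cong (track r ∘ f) (+-identityʳ k)) (trans (tr r k) (slot-above (get r σ) k ≤-refl)))))
  where k = length (get r σ)

steps-toBottom : ∀ {σ f} k → Holds σ f → Steps toBottom tt k f (suc k) tt 0 f
steps-toBottom k (m0 , ms , _) = sweep-left k _ ms m0

Executes : ∀ {E} → Gadget E → Stacks → E → Stacks → ℕ → Set
Executes g σ e σ′ t = ∀ {f} → Holds σ f → Σ (ℕ → Cell) λ f′ → Σ ℕ λ n → Steps g (entry g) 0 f n e 0 f′ × Holds σ′ f′ × n ≤ t

-- An instruction costs one sweep to the top of a track and one back. The bound `2 * height σ + 6`
-- is chosen to serve all instructions alike, so that the cost of a run is a plain product.
executes-push : ∀ r γ σ → Executes (pushG r γ) σ tt (set r (γ ∷ get r σ) σ) (2 * height σ + 6)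
executes-push r γ σ {f} h = _ , _ ,
  steps-first (steps-toTop r h) (steps-first (steps-prim refl (λ _ → refl)) (steps-toBottom k h′)) , h′ , bound
  where
  k = length (get r σ)
  h′ : Holds (set r (γ ∷ get r σ) σ) (upd f k (setTrack r (just γ) (f k)))
  h′ = holds-set r k (just γ) (γ ∷ get r σ) h (λ _ → refl)
  bound : suc k + (1 + suc k) ≤ 2 * height σ + 6
  bound = begin
    suc k + (1 + suc k) ≡⟨ solve 1 (λ k → con 1 :+ k :+ (con 1 :+ (con 1 :+ k)) := con 2 :* k :+ con 3) refl k ⟩
    2 * k + 3 ≤⟨ +-mono-≤ (*-monoʳ-≤ 2 (length-get r σ)) (m≤m+n 3 3) ⟩
    2 * height σ + 6 ∎
    where open ≤-Reasoning
          open import Data.Nat.Solver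
          open +-*-Solver

executes-empty : ∀ r σ → get r σ ≡ [] → Executes (popG r) σ nothing σ (2 * height σ + 6)
executes-empty r σ eq {f} h@(m0 , _ , _) = _ , _ ,
  steps-first (subst (λ k → Steps (toTop r) tt 0 f (suc k) tt k f) (cong length eq) (steps-toTop r h))
    (steps-first (steps-still {m = stay} (cong (λ b → if b then (true , f 0 , stay) else (false , f 0 , left)) m0)) (steps-still {m = stay} refl)) , h ,
  ≤-trans (m≤m+n 3 3) (m≤n+m 6 (2 * height σ))

executes-pop : ∀ r γ xs σ → get r σ ≡ γ ∷ xs → Executes (popG r) σ (just γ) (set r xs σ) (2 * height σ + 6)
executes-pop r γ xs σ eq {f} h@(m0 , ms , tr) = _ , _ ,
  steps-first (subst (λ k → Steps (toTop r) tt 0 f (suc k) tt k f) (cong length eq) (steps-toTop r h))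
    (steps-first (steps-still {m = left} (cong (λ b → if b then (true , f (suc k) , stay) else (false , f (suc k) , left)) (ms k)))
      (steps-first (steps-prim (cong (_, setTrack r nothing (f k) , stay) top) (λ _ → refl))
        (steps-first (steps-toBottom k h′) (steps-still {m = stay} refl)))) , h′ , bound
  where
  k = length xs
  top : track r (f k) ≡ just γ
  top = trans (tr r k) (trans (cong (λ z → slot z k) eq) (upd-same (slot xs) k (just γ)))
  h′ : Holds (set r xs σ) (upd f k (setTrack r nothing (f k)))
  h′ = holds-set r k nothing xs h (λ i → trans (slot-tail γ xs i) (upd-cong k (λ j → cong (λ z → slot z j) (sym eq)) refl i))
  bound : suc (suc k) + (1 + (1 + (suc k + 1))) ≤ 2 * height σ + 6
  bound = begin
    suc (suc k) + (1 + (1 + (suc k + 1))) ≡⟨ solve 1 (λ k → con 2 :+ k :+ (con 1 :+ (con 1 :+ (con 1 :+ k :+ con 1))) := con 2 :* (con 1 :+ k) :+ con 4) refl k ⟩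
    2 * suc k + 4 ≤⟨ +-mono-≤ (*-monoʳ-≤ 2 (subst (_≤ height σ) (cong length eq) (length-get r σ))) (m≤m+n 4 2) ⟩
    2 * height σ + 6 ∎
    where open ≤-Reasoning
          open import Data.Nat.Solver
          open +-*-Solver

height-push : ∀ r γ σ → height (set r (γ ∷ get r σ) σ) ≡ suc (height σ)
height-push A γ σ = refl
height-push B γ (a , b , c) = +-suc (length a) (length b + length c)
height-push C γ (a , b , c) = trans (cong (length a +_) (+-suc (length b) (length c))) (+-suc (length a) (length b + length c))

height-pop : ∀ r γ xs σ → get r σ ≡ γ ∷ xs → height (set r xs σ) ≤ height σ
height-pop A γ xs (a , b , c) refl = n≤1+n _
height-pop B γ xs (a , b , c) refl = +-monoʳ-≤ (length a) (n≤1+n _)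
height-pop C γ xs (a , b , c) refl = +-monoʳ-≤ (length a) (+-monoʳ-≤ (length b) (n≤1+n _))

-- Each instruction pushes at most one symbol, so time bounds space. The same fact later bounds the
-- size of computed values.
height-run : ∀ {E} {p : SP E} {σ e σ′ t} → Run p σ e σ′ t → height σ′ ≤ height σ + t
height-run (run-push {r} {γ} {σ}) = ≤-reflexive (trans (height-push r γ σ) (+-comm 1 _))
height-run (run-pop {r} {γ} {xs} {σ} eq) = ≤-trans (height-pop r γ xs σ eq) (m≤m+n _ 1)
height-run (run-empty eq) = m≤m+n _ 1
height-run run-ret = m≤m+n _ 1
height-run (run-bind {σ = σ} {t = t} {u} r s) =
  ≤-trans (height-run s) (≤-trans (+-monoˡ-≤ u (height-run r)) (≤-reflexive (+-assoc (height σ) t u)))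
height-run (run-exit r) = height-run r
height-run (run-again {σ = σ} {t = t} {u} r s) =
  ≤-trans (height-run s) (≤-trans (+-monoˡ-≤ u (height-run r)) (≤-reflexive (+-assoc (height σ) t u)))
height-run (run-≤ {σ = σ} le r) = ≤-trans (height-run r) (+-monoʳ-≤ (height σ) le)

compile : ∀ {E} → SP E → Gadget E
compile = translate opG

-- `H` bounds every stack height met during the run, so each of the `t` instructions costs at most
-- `2 * H + 6` transitions; the simulation is quadratic.
executes-run : ∀ {E} {p : SP E} {σ e σ′ t} → Run p σ e σ′ t → ∀ {H} → height σ + t ≤ H →
               Executes (compile p) σ e σ′ (t * (2 * H + 6))
executes-run r {H} le h = go r le h
  where
  prim-bound : ∀ {E} {g : Gadget E} {σ e σ′} → Executes g σ e σ′ (2 * height σ + 6) → height σ + 1 ≤ H →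
               Executes g σ e σ′ (1 * (2 * H + 6))
  prim-bound {σ = σ} ex le h with ex h
  ... | f , n , s , h′ , b = f , n , s , h′ , ≤-trans b (≤-trans (+-monoˡ-≤ 6 (*-monoʳ-≤ 2 (≤-trans (m≤m+n _ 1) le))) (≤-reflexive (sym (*-identityˡ _))))

  later : ∀ {E} {p : SP E} {σ e σ′ t u} → Run p σ e σ′ t → height σ + (t + u) ≤ H → height σ′ + u ≤ H
  later {σ = σ} {t = t} {u} r le = ≤-trans (+-monoˡ-≤ u (height-run r)) (≤-trans (≤-reflexive (+-assoc (height σ) t u)) le)

  sum-bound : ∀ {n m} t u → n ≤ t * (2 * H + 6) → m ≤ u * (2 * H + 6) → n + m ≤ (t + u) * (2 * H + 6)
  sum-bound t u a b = ≤-trans (+-mono-≤ a b) (≤-reflexive (sym (*-distribʳ-+ (2 * H + 6) t u)))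

  go : ∀ {E} {p : SP E} {σ e σ′ t} → Run p σ e σ′ t → height σ + t ≤ H → Executes (compile p) σ e σ′ (t * (2 * H + 6))
  go (run-push {r} {γ} {σ}) le = prim-bound (executes-push r γ σ) le
  go (run-pop {r} {γ} {xs} {σ} eq) le = prim-bound (executes-pop r γ xs σ eq) le
  go (run-empty {r} {σ} eq) le = prim-bound (executes-empty r σ eq) le
  go (run-ret {σ = σ}) le = prim-bound {σ = σ} (λ h → _ , _ , steps-still {m = stay} refl , h , ≤-trans (m≤m+n 1 5) (m≤n+m 6 _)) le
  go (run-bind {σ = σ} {t = t} {u} r s) le h with go r (≤-trans (+-monoʳ-≤ (height σ) (m≤m+n t u)) le) h
  ... | f , n , st , h′ , b with go s (later r le) h′
  ...   | f′ , n′ , st′ , h″ , b′ = f′ , n + n′ , steps-first st st′ , h″ , sum-bound t u b b′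
  go (run-exit r) le h with go r le h
  ... | f , n , st , h′ , b = f , n , steps-exit st , h′ , b
  go (run-again {σ = σ} {t = t} {u} r s) le h with go r (≤-trans (+-monoʳ-≤ (height σ) (m≤m+n t u)) le) h
  ... | f , n , st , h′ , b with go s (later r le) h′
  ...   | f′ , n′ , st′ , h″ , b′ = f′ , n + n′ , steps-again st st′ , h″ , sum-bound t u b b′
  go (run-≤ {σ = σ} le′ r) le h with go r (≤-trans (+-monoʳ-≤ (height σ) le′) le) h
  ... | f , n , st , h′ , b = f , n , st , h′ , ≤-trans b (*-monoˡ-≤ (2 * H + 6) le′)

-- Stack programs started on the input tape

blankCell : Cell
blankCell = false , nothing , nothing , nothing

bitCell : Bool → Cell
bitCell b = false , nothing , just (bit b) , nothing

withMark : Cell → Cell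
withMark (_ , t) = true , t

-- The input tape carries no mark, so one extra transition puts it on cell 0 before the compiled
-- program starts.
program : SP Bool → Gadget Bool
program p = bind finite-⊤ (prim λ c → tt , withMark c , stay) λ _ → compile p

slot-ʳ++-< : ∀ xs ys i → i < length ys → slot (xs ʳ++ ys) i ≡ slot ys i
slot-ʳ++-< [] ys i lt = refl
slot-ʳ++-< (x ∷ xs) ys i lt = trans (slot-ʳ++-< xs (x ∷ ys) i (m≤n⇒m≤1+n lt)) skip
  where
  skip : upd (slot ys) (length ys) (just x) i ≡ slot ys i
  skip with i Data.Nat.≟ length ys
  ... | yes refl = ⊥-elim (<-irrefl refl lt)
  ... | no _ = refl

slot-ʳ++ : ∀ xs ys i → slot (xs ʳ++ ys) (length ys + i) ≡ nth nothing (map just xs) i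
slot-ʳ++ [] ys i = slot-above ys _ (m≤m+n _ i)
slot-ʳ++ (x ∷ xs) ys zero = trans (cong (slot (xs ʳ++ (x ∷ ys))) (+-identityʳ _))
  (trans (slot-ʳ++-< xs (x ∷ ys) (length ys) ≤-refl) (upd-same (slot ys) (length ys) (just x)))
slot-ʳ++ (x ∷ xs) ys (suc i) = trans (cong (slot (xs ʳ++ (x ∷ ys))) (+-suc (length ys) i)) (slot-ʳ++ xs (x ∷ ys) i)

-- Input bits count as symbols of track B; the first one sits in cell 0, the bottom, so the last one
-- is on top.
initial : List Bool → Stacks
initial bs = [] , reverse (map bit bs) , []

module _ (p : SP Bool) where
  open Machine finite-Cell blankCell bitCell (program p)

  stackMachine : TM
  stackMachine = machine

  initial-holds : ∀ bs → Holds (initial bs) (upd (inputTape bs) 0 (withMark (inputTape bs 0)))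
  initial-holds bs = refl , unmarked bs , tracks
    where
    f = inputTape bs
    unmarked : ∀ bs i → mark (inputTape bs (suc i)) ≡ false
    unmarked [] i = refl
    unmarked (b ∷ []) i = refl
    unmarked (b ∷ c ∷ bs) zero = refl
    unmarked (b ∷ c ∷ bs) (suc i) = unmarked (c ∷ bs) i
    same : ∀ r i → track r (upd f 0 (withMark (f 0)) i) ≡ track r (f i)
    same r i = trans (upd-∘ (track r) f 0 (withMark (f 0)) i) (sym (upd-id (track r ∘ f) 0 i))
    empty : ∀ bs i → track A (inputTape bs i) ≡ nothing × track C (inputTape bs i) ≡ nothing
    empty [] i = refl , refl
    empty (b ∷ bs) zero = refl , refl
    empty (b ∷ bs) (suc i) = empty bs i
    bits : ∀ bs i → track B (inputTape bs i) ≡ nth nothing (map just (map bit bs)) i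
    bits [] i = refl
    bits (b ∷ bs) zero = refl
    bits (b ∷ bs) (suc i) = bits bs i
    tracks : ∀ r i → track r (upd f 0 (withMark (f 0)) i) ≡ slot (get r (initial bs)) i
    tracks A i = trans (same A i) (proj₁ (empty bs i))
    tracks B i = trans (same B i) (trans (bits bs i) (sym (slot-ʳ++ (map bit bs) [] i)))
    tracks C i = trans (same C i) (proj₂ (empty bs i))

  stackMachine-correct : ∀ bs {b σ t u} → Run p (initial bs) b σ t → 1 + t * (2 * (length bs + t) + 6) ≤ u →
                         st (run u (initConfig stackMachine bs)) ≡ verdict b
  stackMachine-correct bs {b} {σ} {t} {u} r le =
    conclude (executes-run r (≤-reflexive (cong (_+ t) hgt)) (initial-holds bs))
    where
    hgt : height (initial bs) ≡ length bs
    hgt = trans (+-identityʳ _) (trans (length-reverse (map bit bs)) (length-map bit bs))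
    f₀ = upd (inputTape bs) 0 (withMark (inputTape bs 0))
    conclude : (Σ (ℕ → Cell) λ f → Σ ℕ λ n → Steps (compile p) (entry (compile p)) 0 f₀ n b 0 f ×
                Holds σ f × n ≤ t * (2 * (length bs + t) + 6)) →
               st (run u (initConfig stackMachine bs)) ≡ verdict b
    conclude (f , n , s , _ , n≤) = machine-correct bs (steps-first (steps-prim refl (λ _ → refl)) s) (≤-trans (s≤s n≤) le)

-- Polynomials

infixl 6 _⊕_
infixl 7 _⊛_

-- Syntax rather than functions, so that monotonicity and the bound by a power follow by induction.
-- Composition is a constructor because running times are evaluated at output sizes.
data Poly : Set where
  con : ℕ → Poly
  X : Poly
  _⊕_ _⊛_ _⊚_ : Poly → Poly → Poly

ev : Poly → ℕ → ℕ
ev (con k) n = k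
ev X n = n
ev (p ⊕ q) n = ev p n + ev q n
ev (p ⊛ q) n = ev p n * ev q n
ev (p ⊚ q) n = ev p (ev q n)

ev-mono : ∀ p {m n} → m ≤ n → ev p m ≤ ev p n
ev-mono (con k) le = ≤-refl
ev-mono X le = le
ev-mono (p ⊕ q) le = +-mono-≤ (ev-mono p le) (ev-mono q le)
ev-mono (p ⊛ q) le = *-mono-≤ (ev-mono p le) (ev-mono q le)
ev-mono (p ⊚ q) le = ev-mono p (ev-mono q le)

pow-mono : ∀ n {k l} → k ≤ l → suc n ^ k ≤ suc n ^ l
pow-mono n le = ^-monoʳ-≤ (suc n) le

one≤pow : ∀ n k → 1 ≤ suc n ^ k
one≤pow n k = pow-mono n {0} {k} z≤n

*-distrib-^ : ∀ k a b → (a * b) ^ k ≡ a ^ k * b ^ k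
*-distrib-^ zero a b = refl
*-distrib-^ (suc k) a b = trans (cong (a * b *_) (*-distrib-^ k a b)) ([m*n]*[o*p]≡[m*o]*[n*p] a b (a ^ k) (b ^ k))

-- The base `suc n` is at least 1, so its powers increase with the exponent and different degrees
-- can be merged; in a composition the extra 1 is absorbed into `suc d`.
ev-bound : ∀ p → Σ ℕ λ c → Σ ℕ λ k → ∀ n → ev p n ≤ c * suc n ^ k
ev-bound (con c) = c , 0 , λ n → ≤-reflexive (sym (*-identityʳ c))
ev-bound X = 1 , 1 , λ n → ≤-trans (n≤1+n n) (≤-reflexive (sym (trans (*-identityˡ _) (*-identityʳ _))))
ev-bound (p ⊕ q) with ev-bound p | ev-bound q
... | c , k , f | d , l , g = c + d , k + l , λ n → ≤-trans
  (+-mono-≤ (≤-trans (f n) (*-monoʳ-≤ c (pow-mono n (m≤m+n k l)))) (≤-trans (g n) (*-monoʳ-≤ d (pow-mono n (m≤n+m l k)))))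
  (≤-reflexive (sym (*-distribʳ-+ (suc n ^ (k + l)) c d)))
ev-bound (p ⊛ q) with ev-bound p | ev-bound q
... | c , k , f | d , l , g = c * d , k + l , λ n → ≤-trans (*-mono-≤ (f n) (g n)) (≤-reflexive (begin
    (c * suc n ^ k) * (d * suc n ^ l) ≡⟨ [m*n]*[o*p]≡[m*o]*[n*p] c (suc n ^ k) d (suc n ^ l) ⟩
    (c * d) * (suc n ^ k * suc n ^ l) ≡⟨ cong (c * d *_) (^-distribˡ-+-* (suc n) k l) ⟨
    (c * d) * suc n ^ (k + l) ∎))
  where open ≡-Reasoning
ev-bound (p ⊚ q) with ev-bound p | ev-bound q
... | c , k , f | d , l , g = c * suc d ^ k , l * k , λ n → begin
    ev p (ev q n)                        ≤⟨ f (ev q n) ⟩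
    c * suc (ev q n) ^ k                 ≤⟨ *-monoʳ-≤ c (^-monoˡ-≤ k (+-mono-≤ (one≤pow n l) (g n))) ⟩
    c * (suc d * suc n ^ l) ^ k          ≡⟨ cong (c *_) (trans (*-distrib-^ k (suc d) (suc n ^ l)) (cong (suc d ^ k *_) (^-*-assoc (suc n) l k))) ⟩
    c * (suc d ^ k * suc n ^ (l * k))    ≡⟨ *-assoc c _ _ ⟨
    c * suc d ^ k * suc n ^ (l * k)      ∎
  where
  open ≤-Reasoning

-- For positive `n`, `suc n` is at most `2 * n`, whence the factor `2 ^ k`; the additive constant
-- pays for `n = 0`.
poly-bound : ∀ p → Σ ℕ λ k → Σ ℕ λ c → ∀ n → ev p n ≤ c * n ^ k + c
poly-bound p with ev-bound p
... | c , k , f = k , c * 2 ^ k , λ n → ≤-trans (f n) (go n)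
  where
  open ≤-Reasoning
  go : ∀ n → c * suc n ^ k ≤ c * 2 ^ k * n ^ k + c * 2 ^ k
  go zero = ≤-trans (*-monoʳ-≤ c (≤-trans (≤-reflexive (^-zeroˡ k)) (one≤pow 1 k))) (m≤n+m _ _)
  go (suc n) = begin
    c * suc (suc n) ^ k             ≤⟨ *-monoʳ-≤ c (^-monoˡ-≤ k (s≤s (≤-trans (≤-reflexive (sym (+-identityʳ (suc n)))) (m≤n+m _ n)))) ⟩
    c * (2 * suc n) ^ k             ≡⟨ cong (c *_) (*-distrib-^ k 2 (suc n)) ⟩
    c * (2 ^ k * suc n ^ k)         ≡⟨ *-assoc c _ _ ⟨
    c * 2 ^ k * suc n ^ k           ≤⟨ m≤m+n _ _ ⟩
    c * 2 ^ k * suc n ^ k + c * 2 ^ k ∎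

-- Data types and their prefix-free binary encodings

infixr 4 _⊗_

data Ty : Set where
  unit bool : Ty
  _⊗_ : Ty → Ty → Ty
  list : Ty → Ty

⟦_⟧ : Ty → Set
⟦ unit ⟧ = ⊤
⟦ bool ⟧ = Bool
⟦ σ ⊗ τ ⟧ = ⟦ σ ⟧ × ⟦ τ ⟧
⟦ list τ ⟧ = List ⟦ τ ⟧

code : ∀ τ → ⟦ τ ⟧ → List Bool
codes : ∀ τ → List ⟦ τ ⟧ → List Bool
code unit _ = []
code bool b = b ∷ []
code (σ ⊗ τ) (x , y) = code σ x ++ code τ y
code (list τ) xs = codes τ xs
codes τ [] = false ∷ []
codes τ (x ∷ xs) = true ∷ code τ x ++ codes τ xs

sz : ∀ τ → ⟦ τ ⟧ → ℕ
szs : ∀ τ → List ⟦ τ ⟧ → ℕ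
sz unit _ = 0
sz bool _ = 1
sz (σ ⊗ τ) (x , y) = sz σ x + sz τ y
sz (list τ) xs = szs τ xs
szs τ [] = 1
szs τ (x ∷ xs) = suc (sz τ x + szs τ xs)

length-code : ∀ τ x → length (code τ x) ≡ sz τ x
length-codes : ∀ τ xs → length (codes τ xs) ≡ szs τ xs
length-code unit x = refl
length-code bool x = refl
length-code (σ ⊗ τ) (x , y) = trans (length-++ (code σ x)) (cong₂ _+_ (length-code σ x) (length-code τ y))
length-code (list τ) xs = length-codes τ xs
length-codes τ [] = refl
length-codes τ (x ∷ xs) = cong suc (trans (length-++ (code τ x)) (cong₂ _+_ (length-code τ x) (length-codes τ xs)))

-- bits placed on a stack with the first bit on top, and pushed one by one (last bit on top)
_▹_ _◃_ : List Bool → List Γ → List Γ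
[] ▹ a = a
(x ∷ xs) ▹ a = bit x ∷ (xs ▹ a)
[] ◃ a = a
(x ∷ xs) ◃ a = xs ◃ (bit x ∷ a)

▹-++ : ∀ xs ys a → (xs ++ ys) ▹ a ≡ xs ▹ (ys ▹ a)
▹-++ [] ys a = refl
▹-++ (x ∷ xs) ys a = cong (bit x ∷_) (▹-++ xs ys a)

◃-++ : ∀ xs ys a → (xs ++ ys) ◃ a ≡ ys ◃ (xs ◃ a)
◃-++ [] ys a = refl
◃-++ (x ∷ xs) ys a = ◃-++ xs ys (bit x ∷ a)

◃-ʳ++ : ∀ xs ys a → (xs ʳ++ ys) ◃ a ≡ ys ◃ (xs ▹ a)
◃-ʳ++ [] ys a = refl
◃-ʳ++ (x ∷ xs) ys a = ◃-ʳ++ xs (x ∷ ys) a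

▹-ʳ++ : ∀ xs ys a → (xs ʳ++ ys) ▹ a ≡ xs ◃ (ys ▹ a)
▹-ʳ++ [] ys a = refl
▹-ʳ++ (x ∷ xs) ys a = ▹-ʳ++ xs (x ∷ ys) a

length-▹ : ∀ xs a → length (xs ▹ a) ≡ length xs + length a
length-▹ [] a = refl
length-▹ (x ∷ xs) a = cong suc (length-▹ xs a)

-- These are `code τ x ▹ a` and `code τ x ◃ a` in a form that unfolds along the type, so that runs
-- of type-directed programs check by computation. `up` is the readable orientation, `down` the one
-- left by popping a value off one stack and pushing it on another.
up down : ∀ τ → ⟦ τ ⟧ → List Γ → List Γ
ups downs : ∀ τ → List ⟦ τ ⟧ → List Γ → List Γ
up unit _ a = a
up bool b a = bit b ∷ a
up (σ ⊗ τ) (x , y) a = up σ x (up τ y a)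
up (list τ) xs a = ups τ xs a
ups τ [] a = bit false ∷ a
ups τ (x ∷ xs) a = bit true ∷ up τ x (ups τ xs a)
down unit _ a = a
down bool b a = bit b ∷ a
down (σ ⊗ τ) (x , y) a = down τ y (down σ x a)
down (list τ) xs a = downs τ xs a
downs τ [] a = bit false ∷ a
downs τ (x ∷ xs) a = downs τ xs (down τ x (bit true ∷ a))

up-code : ∀ τ x a → code τ x ▹ a ≡ up τ x a
ups-codes : ∀ τ xs a → codes τ xs ▹ a ≡ ups τ xs a
up-code unit x a = refl
up-code bool x a = refl
up-code (σ ⊗ τ) (x , y) a = trans (▹-++ (code σ x) (code τ y) a) (trans (up-code σ x _) (cong (up σ x) (up-code τ y a)))
up-code (list τ) xs a = ups-codes τ xs a
ups-codes τ [] a = refl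
ups-codes τ (x ∷ xs) a = cong (bit true ∷_) (trans (▹-++ (code τ x) (codes τ xs) a) (trans (up-code τ x _) (cong (up τ x) (ups-codes τ xs a))))

down-code : ∀ τ x a → code τ x ◃ a ≡ down τ x a
downs-codes : ∀ τ xs a → codes τ xs ◃ a ≡ downs τ xs a
down-code unit x a = refl
down-code bool x a = refl
down-code (σ ⊗ τ) (x , y) a = trans (◃-++ (code σ x) (code τ y) a) (trans (down-code τ y _) (cong (down τ y) (down-code σ x a)))
down-code (list τ) xs a = downs-codes τ xs a
downs-codes τ [] a = refl
downs-codes τ (x ∷ xs) a = trans (◃-++ (code τ x) (codes τ xs) _) (trans (downs-codes τ xs _) (cong (downs τ xs) (down-code τ x _)))

-- Stack programs on encoded values

infixr 5 _>>_

_>>_ : ∀ {E} → SP ⊤ → SP E → SP E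
p >> q = bind finite-⊤ p λ _ → q

popThen : ∀ {E} → Reg → (Maybe Γ → SP E) → SP E
popThen r k = bind (finite-Maybe finite-Γ) (prim (pop r)) k

again stop : SP (Maybe ⊤)
again = prim (ret nothing)
stop = prim (ret (just tt))

unloadBit : Maybe Γ → SP ⊤
unloadBit (just γ) = prim (push B γ)
unloadBit nothing = prim (ret tt)

unloadCell : SP ⊤ → Maybe Γ → SP (Maybe ⊤)
unloadCell p (just (bit true)) = prim (push B (bit true)) >> p >> again
unloadCell p (just (bit false)) = prim (push B (bit false)) >> stop
unloadCell p _ = stop

-- Since codes are prefix-free, the type alone tells where the value on top of A ends. Once it lies
-- on B above a separator, untyped loops that run down to the separator can do the rest.
unload : Ty → SP ⊤
unload unit = prim (ret tt)
unload bool = popThen A unloadBit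
unload (σ ⊗ τ) = unload σ >> unload τ
unload (list τ) = loop (popThen A (unloadCell (unload τ)))

rate : Ty → ℕ
rate unit = 1
rate bool = 1
rate (σ ⊗ τ) = rate σ + rate τ
-- The 3 pays for the pop, the push and the return at each list cell.
rate (list τ) = rate τ + 3

unloadTime : Ty → Poly
unloadTime τ = con (rate τ) ⊛ (con 1 ⊕ X)

run-unload : ∀ τ x {a b c} → Run (unload τ) (up τ x a , b , c) tt (a , down τ x b , c) (ev (unloadTime τ) (sz τ x))
run-unload-list : ∀ τ xs {a b c} → Run (unload (list τ)) (ups τ xs a , b , c) tt (a , downs τ xs b , c) ((rate τ + 3) * (1 + szs τ xs))
run-unload unit x = run-≤ (s≤s z≤n) run-ret
run-unload bool x = run-bind (run-pop refl) run-push
run-unload (σ ⊗ τ) (x , y) = run-≤ bound (run-bind (run-unload σ x) (run-unload τ y))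
  where
  bound : rate σ * (1 + sz σ x) + rate τ * (1 + sz τ y) ≤ (rate σ + rate τ) * (1 + (sz σ x + sz τ y))
  bound = ≤-trans (+-mono-≤ (*-monoʳ-≤ (rate σ) (s≤s (m≤m+n _ _))) (*-monoʳ-≤ (rate τ) (s≤s (m≤n+m _ (sz σ x)))))
                  (≤-reflexive (sym (*-distribʳ-+ (1 + (sz σ x + sz τ y)) (rate σ) (rate τ))))
run-unload (list τ) xs = run-unload-list τ xs
run-unload-list τ [] = run-≤ bound (run-exit (run-bind (run-pop refl) (run-bind run-push run-ret)))
  where
  bound : 3 ≤ (rate τ + 3) * 2
  bound = ≤-trans (m≤n+m 3 (rate τ)) (m≤m*n (rate τ + 3) 2)
run-unload-list τ (x ∷ xs) =
  run-≤ bound (run-again (run-bind (run-pop refl) (run-bind run-push (run-bind (run-unload τ x) run-ret))) (run-unload-list τ xs))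
  where
  open ≤-Reasoning
  open +-*-Solver
  k = rate τ
  s = sz τ x
  u = szs τ xs
  bound : 1 + (1 + (k * (1 + s) + 1)) + (k + 3) * (1 + u) ≤ (k + 3) * (1 + suc (s + u))
  bound = begin
    1 + (1 + (k * (1 + s) + 1)) + (k + 3) * (1 + u) ≤⟨ m≤m+n _ (3 * s) ⟩
    1 + (1 + (k * (1 + s) + 1)) + (k + 3) * (1 + u) + 3 * s
      ≡⟨ solve 3 (λ k s u → con 1 :+ (con 1 :+ (k :* (con 1 :+ s) :+ con 1)) :+ (k :+ con 3) :* (con 1 :+ u) :+ con 3 :* s
                  := (k :+ con 3) :* (con 1 :+ (con 1 :+ (s :+ u)))) refl k s u ⟩
    (k + 3) * (1 + suc (s + u)) ∎

transferCell : Reg → Maybe Γ → SP (Maybe ⊤)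
transferCell r (just (bit b)) = prim (push r (bit b)) >> again
transferCell r _ = stop

transfer : Reg → Reg → SP ⊤
transfer r s = loop (popThen r (transferCell s))

transferTime : Poly
transferTime = X ⊛ con 3 ⊕ con 2

run-transfer-BA : ∀ ys {a b c} → Run (transfer B A) (a , ys ▹ (sep ∷ b) , c) tt (ys ◃ a , b , c) (ev transferTime (length ys))
run-transfer-BA [] = run-exit (run-bind (run-pop refl) run-ret)
run-transfer-BA (y ∷ ys) = run-again (run-bind (run-pop refl) (run-bind run-push run-ret)) (run-transfer-BA ys)

run-transfer-BC : ∀ ys {a b c} → Run (transfer B C) (a , ys ▹ (sep ∷ b) , c) tt (a , b , ys ◃ c) (ev transferTime (length ys))
run-transfer-BC [] = run-exit (run-bind (run-pop refl) run-ret)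
run-transfer-BC (y ∷ ys) = run-again (run-bind (run-pop refl) (run-bind run-push run-ret)) (run-transfer-BC ys)

run-transfer-CB : ∀ ys {a b c} → Run (transfer C B) (a , b , ys ▹ (sep ∷ c)) tt (a , ys ◃ b , c) (ev transferTime (length ys))
run-transfer-CB [] = run-exit (run-bind (run-pop refl) run-ret)
run-transfer-CB (y ∷ ys) = run-again (run-bind (run-pop refl) (run-bind run-push run-ret)) (run-transfer-CB ys)

copyCell : Maybe Γ → SP (Maybe ⊤)
copyCell (just (bit b)) = prim (push A (bit b)) >> prim (push C (bit b)) >> again
copyCell _ = stop

copy : SP ⊤
copy = loop (popThen B copyCell)

run-copy : ∀ ys {a b c} → Run copy (a , ys ▹ (sep ∷ b) , c) tt (ys ◃ a , b , ys ◃ c) (length ys * 4 + 2)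
run-copy [] = run-exit (run-bind (run-pop refl) run-ret)
run-copy (y ∷ ys) = run-again (run-bind (run-pop refl) (run-bind run-push (run-bind run-push run-ret))) (run-copy ys)

clearCell : Maybe Γ → SP (Maybe ⊤)
clearCell (just (bit b)) = again
clearCell _ = stop

clear : SP ⊤
clear = loop (popThen B clearCell)

run-clear : ∀ ys {a b c} → Run clear (a , ys ▹ (sep ∷ b) , c) tt (a , b , c) (length ys * 2 + 2)
run-clear [] = run-exit (run-bind (run-pop refl) run-ret)
run-clear (y ∷ ys) = run-again (run-bind (run-pop refl) run-ret) (run-clear ys)

down-▹ : ∀ τ x b → reverse (code τ x) ▹ b ≡ down τ x b
down-▹ τ x b = trans (▹-ʳ++ (code τ x) [] b) (down-code τ x b)

reverse-◃ : ∀ τ x a → reverse (code τ x) ◃ a ≡ up τ x a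
reverse-◃ τ x a = trans (◃-ʳ++ (code τ x) [] a) (up-code τ x a)

length-reverse-code : ∀ τ x → length (reverse (code τ x)) ≡ sz τ x
length-reverse-code τ x = trans (length-reverse (code τ x)) (length-code τ x)

run-load : ∀ τ x {a b c} → Run (transfer B A) (a , down τ x (sep ∷ b) , c) tt (up τ x a , b , c) (ev transferTime (sz τ x))
run-load τ x {a} {b} {c} = subst₂ (λ (z , w) n → Run (transfer B A) (a , z , c) tt (w , b , c) (ev transferTime n))
  (cong₂ _,_ (down-▹ τ x (sep ∷ b)) (reverse-◃ τ x a)) (length-reverse-code τ x) (run-transfer-BA (reverse (code τ x)))

run-stash : ∀ τ x {a b c} → Run (transfer B C) (a , down τ x (sep ∷ b) , c) tt (a , b , up τ x c) (ev transferTime (sz τ x))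
run-stash τ x {a} {b} {c} = subst₂ (λ (z , w) n → Run (transfer B C) (a , z , c) tt (a , b , w) (ev transferTime n))
  (cong₂ _,_ (down-▹ τ x (sep ∷ b)) (reverse-◃ τ x c)) (length-reverse-code τ x) (run-transfer-BC (reverse (code τ x)))

run-unstash : ∀ τ x {a b c} → Run (transfer C B) (a , b , up τ x (sep ∷ c)) tt (a , down τ x b , c) (ev transferTime (sz τ x))
run-unstash τ x {a} {b} {c} = subst₂ (λ (z , w) n → Run (transfer C B) (a , b , z) tt (a , w , c) (ev transferTime n))
  (cong₂ _,_ (up-code τ x (sep ∷ c)) (down-code τ x b)) (length-code τ x) (run-transfer-CB (code τ x))

run-copied : ∀ τ x {a b c} → Run copy (a , down τ x (sep ∷ b) , c) tt (up τ x a , b , up τ x c) (sz τ x * 4 + 2)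
run-copied τ x {a} {b} {c} = subst₂ (λ (z , w , v) n → Run copy (a , z , c) tt (w , b , v) (n * 4 + 2))
  (cong₂ _,_ (down-▹ τ x (sep ∷ b)) (cong₂ _,_ (reverse-◃ τ x a) (reverse-◃ τ x c))) (length-reverse-code τ x) (run-copy (reverse (code τ x)))

run-cleared : ∀ τ x {a b c} → Run clear (a , down τ x (sep ∷ b) , c) tt (a , b , c) (sz τ x * 2 + 2)
run-cleared τ x {a} {b} {c} = subst₂ (λ z n → Run clear (a , z , c) tt (a , b , c) (n * 2 + 2))
  (down-▹ τ x (sep ∷ b)) (length-reverse-code τ x) (run-clear (reverse (code τ x)))

pushSep : Reg → SP ⊤
pushSep r = prim (push r sep)

-- Each passage between stacks reverses the word. From A to B and back by `copy` the orientation is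
-- restored, on A as well as on C; the copy on C reaches A through B, again by two reversals.
dup : Ty → SP ⊤
dup τ = pushSep B >> unload τ >> pushSep C >> copy >> pushSep B >> transfer C B >> transfer B A

dupTime : Ty → Poly
dupTime τ = con 1 ⊕ (unloadTime τ ⊕ (con 1 ⊕ ((X ⊛ con 4 ⊕ con 2) ⊕ (con 1 ⊕ (transferTime ⊕ transferTime)))))

run-dup : ∀ τ x {a b c} → Run (dup τ) (up τ x a , b , c) tt (up τ x (up τ x a) , b , c) (ev (dupTime τ) (sz τ x))
run-dup τ x = run-bind run-push (run-bind (run-unload τ x) (run-bind run-push (run-bind (run-copied τ x)
  (run-bind run-push (run-bind (run-unstash τ x) (run-load τ x))))))

drop : Ty → SP ⊤
drop τ = pushSep B >> unload τ >> clear

dropTime : Ty → Poly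
dropTime τ = con 1 ⊕ (unloadTime τ ⊕ (X ⊛ con 2 ⊕ con 2))

run-drop : ∀ τ x {a b c} → Run (drop τ) (up τ x a , b , c) tt (a , b , c) (ev (dropTime τ) (sz τ x))
run-drop τ x = run-bind run-push (run-bind (run-unload τ x) (run-cleared τ x))

-- Polynomial-time functions

-- Quantifying over the contents `a`, `b`, `c` below the argument is a frame property: it lets a
-- program serve as a subroutine while other values are parked on the stacks.
record Computes (σ τ : Ty) (f : ⟦ σ ⟧ → ⟦ τ ⟧) : Set₁ where
  field
    prog : SP ⊤
    time : Poly
    runs : ∀ x {a b c} → Run prog (up σ x a , b , c) tt (up τ (f x) a , b , c) (ev time (sz σ x))

record Fn (σ τ : Ty) : Set₁ where
  constructor fn
  field
    fun : ⟦ σ ⟧ → ⟦ τ ⟧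
    computes : Computes σ τ fun
  open Computes computes public

open Fn public

length-up : ∀ τ x → length (up τ x []) ≡ sz τ x
length-up τ x = begin
  length (up τ x []) ≡⟨ cong length (up-code τ x []) ⟨
  length (code τ x ▹ []) ≡⟨ trans (length-▹ (code τ x) []) (+-identityʳ _) ⟩
  length (code τ x) ≡⟨ length-code τ x ⟩
  sz τ x ∎
  where open ≡-Reasoning

outSize : ∀ {σ τ} → Fn σ τ → Poly
outSize f = X ⊕ time f

-- Run the program on otherwise empty stacks and compare heights: at most `time f` symbols have been
-- added.
sz-fun : ∀ {σ τ} (f : Fn σ τ) x → sz τ (fun f x) ≤ ev (outSize f) (sz σ x)
sz-fun {σ} {τ} f x = subst₂ (λ m n → m ≤ n + ev (time f) (sz σ x))
  (trans (+-identityʳ _) (length-up τ (fun f x))) (trans (+-identityʳ _) (length-up σ x))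
  (height-run (runs f x {[]} {[]} {[]}))

opaque

  computes-≗ : ∀ {σ τ} (f : Fn σ τ) (g : ⟦ σ ⟧ → ⟦ τ ⟧) → (∀ x → fun f x ≡ g x) → Computes σ τ g
  computes-≗ {σ} {τ} f g eq = record
    { prog = prog f ; time = time f
    ; runs = λ x {a} {b} {c} → subst (λ y → Run (prog f) (up σ x a , b , c) tt (up τ y a , b , c) (ev (time f) (sz σ x))) (eq x) (runs f x) }

  computes-id : ∀ {σ} → Computes σ σ id
  computes-id = record { prog = prim (ret tt) ; time = con 1 ; runs = λ x → run-ret }

  computes-∘ : ∀ {ρ σ τ} (g : Fn σ τ) (f : Fn ρ σ) → Computes ρ τ (λ x → fun g (fun f x))
  computes-∘ g f = record
    { prog = prog f >> prog g
    ; time = time f ⊕ (time g ⊚ outSize f)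
    ; runs = λ x → run-bind (runs f x) (run-≤ (ev-mono (time g) (sz-fun f x)) (runs g (fun f x))) }

  -- The result of `f` waits on B above a separator while `g` consumes the second copy of the
  -- argument, and is then put on top of the result of `g`.
  computes-pair : ∀ {ρ σ τ} (f : Fn ρ σ) (g : Fn ρ τ) → Computes ρ (σ ⊗ τ) (λ x → fun f x , fun g x)
  computes-pair {ρ} {σ} {τ} f g = record
    { prog = dup ρ >> prog f >> pushSep B >> unload σ >> prog g >> transfer B A
    ; time = dupTime ρ ⊕ (time f ⊕ (con 1 ⊕ ((unloadTime σ ⊚ outSize f) ⊕ (time g ⊕ (transferTime ⊚ outSize f)))))
    ; runs = λ x → run-bind (run-dup ρ x) (run-bind (runs f x) (run-bind run-push
        (run-bind (run-≤ (ev-mono (unloadTime σ) (sz-fun f x)) (run-unload σ (fun f x)))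
        (run-bind (runs g x) (run-≤ (ev-mono transferTime (sz-fun f x)) (run-load σ (fun f x))))))) }

  computes-fst : ∀ {σ τ} → Computes (σ ⊗ τ) σ proj₁
  computes-fst {σ} {τ} = record
    { prog = pushSep B >> unload σ >> drop τ >> transfer B A
    ; time = con 1 ⊕ (unloadTime σ ⊕ (dropTime τ ⊕ transferTime))
    ; runs = λ (x , y) → run-bind run-push
        (run-bind (run-≤ (ev-mono (unloadTime σ) (m≤m+n _ _)) (run-unload σ x))
        (run-bind (run-≤ (ev-mono (dropTime τ) (m≤n+m _ (sz σ x))) (run-drop τ y))
                  (run-≤ (ev-mono transferTime (m≤m+n (sz σ x) (sz τ y))) (run-load σ x)))) }

  computes-snd : ∀ {σ τ} → Computes (σ ⊗ τ) τ proj₂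
  computes-snd {σ} {τ} = record
    { prog = drop σ ; time = dropTime σ
    ; runs = λ (x , y) → run-≤ (ev-mono (dropTime σ) (m≤m+n _ _)) (run-drop σ x) }

  computes-tt : ∀ {σ} → Computes σ unit (λ _ → tt)
  computes-tt {σ} = record { prog = drop σ ; time = dropTime σ ; runs = λ x → run-drop σ x }

  computes-bool : ∀ {σ} b → Computes σ bool (λ _ → b)
  computes-bool {σ} b = record
    { prog = drop σ >> prim (push A (bit b)) ; time = dropTime σ ⊕ con 1
    ; runs = λ x → run-bind (run-drop σ x) run-push }

  computes-nil : ∀ {σ τ} → Computes σ (list τ) (λ _ → [])
  computes-nil {σ} = record
    { prog = drop σ >> prim (push A (bit false)) ; time = dropTime σ ⊕ con 1
    ; runs = λ x → run-bind (run-drop σ x) run-push }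

  computes-cons : ∀ {τ} → Computes (τ ⊗ list τ) (list τ) (λ (x , xs) → x ∷ xs)
  computes-cons = record { prog = prim (push A (bit true)) ; time = con 1 ; runs = λ x → run-push }

-- Keeps the program and its time bound but replaces the function assembled by the combinators with
-- a readable one, so that later proofs never meet the plumbing.
recast : ∀ {σ τ} (f : Fn σ τ) (g : ⟦ σ ⟧ → ⟦ τ ⟧) → (∀ x → fun f x ≡ g x) → Fn σ τ
recast f g eq = fn g (computes-≗ f g eq)

idF : ∀ {σ} → Fn σ σ
idF = fn id computes-id

infixr 9 _∙_
_∙_ : ∀ {ρ σ τ} → Fn σ τ → Fn ρ σ → Fn ρ τ
g ∙ f = fn (λ x → fun g (fun f x)) (computes-∘ g f)

infixr 4 _,ᶠ_
_,ᶠ_ : ∀ {ρ σ τ} → Fn ρ σ → Fn ρ τ → Fn ρ (σ ⊗ τ)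
f ,ᶠ g = fn (λ x → fun f x , fun g x) (computes-pair f g)

fstF : ∀ {σ τ} → Fn (σ ⊗ τ) σ
fstF = fn proj₁ computes-fst

sndF : ∀ {σ τ} → Fn (σ ⊗ τ) τ
sndF = fn proj₂ computes-snd

bangF : ∀ {σ} → Fn σ unit
bangF = fn (λ _ → tt) computes-tt

boolF : ∀ {σ} (b : Bool) → Fn σ bool
boolF b = fn (λ _ → b) (computes-bool b)

nilF : ∀ {σ τ} → Fn σ (list τ)
nilF = fn (λ _ → []) computes-nil

consF : ∀ {τ} → Fn (τ ⊗ list τ) (list τ)
consF = fn (λ (x , xs) → x ∷ xs) computes-cons

-- Case distinction and iteration

branch : SP ⊤ → SP ⊤ → Maybe Γ → SP ⊤
branch p q (just (bit true)) = p
branch p q _ = q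

caseList : ∀ {S T Z : Set} → (Z → T) → (S × List S × Z → T) → List S × Z → T
caseList f g ([] , z) = f z
caseList f g (x ∷ xs , z) = g (x , xs , z)

opaque

  computes-if : ∀ {σ τ} (f g : Fn σ τ) → Computes (bool ⊗ σ) τ (λ (b , x) → if b then fun f x else fun g x)
  computes-if {σ} {τ} f g = record
    { prog = popThen A (branch (prog f) (prog g))
    ; time = con 1 ⊕ (time f ⊕ time g)
    ; runs = λ { (true , x) → run-bind (run-pop refl) (run-≤ (≤-trans (ev-mono (time f) (n≤1+n _)) (m≤m+n _ _)) (runs f x))
               ; (false , x) → run-bind (run-pop refl) (run-≤ (≤-trans (ev-mono (time g) (n≤1+n _)) (m≤n+m _ (ev (time f) (suc (sz σ x))))) (runs g x)) } }

  computes-case : ∀ {σ ρ τ} (f : Fn ρ τ) (g : Fn (σ ⊗ list σ ⊗ ρ) τ) → Computes (list σ ⊗ ρ) τ (caseList (fun f) (fun g))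
  computes-case {σ} {ρ} {τ} f g = record
    { prog = popThen A (branch (prog g) (prog f))
    ; time = con 1 ⊕ (time f ⊕ time g)
    ; runs = λ { ([] , z) → run-bind (run-pop refl) (run-≤ (≤-trans (ev-mono (time f) (n≤1+n _)) (m≤m+n _ _)) (runs f z))
               ; (x ∷ xs , z) → run-bind (run-pop refl) (run-≤ (≤-trans (ev-mono (time g)
                     (≤-trans (≤-reflexive (sym (+-assoc (sz σ x) (szs σ xs) (sz ρ z)))) (n≤1+n _)))
                     (m≤n+m _ (ev (time f) _))) (runs g (x , xs , z))) } }

condF : ∀ {σ τ} → Fn σ τ → Fn σ τ → Fn (bool ⊗ σ) τ
condF f g = fn (λ (b , x) → if b then fun f x else fun g x) (computes-if f g)

caseF : ∀ {σ ρ τ} → Fn ρ τ → Fn (σ ⊗ list σ ⊗ ρ) τ → Fn (list σ ⊗ ρ) τ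
caseF f g = fn (caseList (fun f) (fun g)) (computes-case f g)

szs-++ˡ : ∀ τ xs ys → szs τ xs ≤ szs τ (xs ++ ys)
szs-++ˡ τ [] [] = ≤-refl
szs-++ˡ τ [] (y ∷ ys) = s≤s z≤n
szs-++ˡ τ (x ∷ xs) ys = s≤s (+-monoʳ-≤ (sz τ x) (szs-++ˡ τ xs ys))

length≤szs : ∀ τ xs → length xs ≤ szs τ xs
length≤szs τ [] = z≤n
length≤szs τ (x ∷ xs) = s≤s (≤-trans (length≤szs τ xs) (m≤n+m _ (sz τ x)))

module _ {σ α : Ty} (f : Fn (σ ⊗ α) α) (q : Poly) where
  private
    step′ : ⟦ α ⟧ → ⟦ σ ⟧ → ⟦ α ⟧
    step′ a x = fun f (x , a)

    -- When `f` runs, its argument must be contiguous on A, but the tail lies between the head and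
    -- the accumulator. The tail is therefore moved to C and brought back afterwards.
    iterate : SP ⊤
    iterate = pushSep B >> unload σ >> pushSep B >> unload (list σ) >> pushSep C >> transfer B C >> transfer B A >>
              prog f >> pushSep B >> transfer C B >> transfer B A

    foldCell : Maybe Γ → SP (Maybe ⊤)
    foldCell (just (bit true)) = iterate >> again
    foldCell _ = stop

    iterateTime : Poly
    iterateTime = con 1 ⊕ (unloadTime σ ⊕ (con 1 ⊕ (unloadTime (list σ) ⊕ (con 1 ⊕ (transferTime ⊕ (transferTime ⊕
                  (time f ⊕ (con 1 ⊕ (transferTime ⊕ transferTime)))))))))

    run-iterate : ∀ x xs a n → szs σ (x ∷ xs) + sz α a ≤ n → ∀ {a′ b c} →
                  Run iterate (up σ x (ups σ xs (up α a a′)) , b , c) tt (ups σ xs (up α (step′ a x) a′) , b , c) (ev iterateTime n)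
    run-iterate x xs a n le =
      run-bind run-push (run-bind (run-≤ (ev-mono (unloadTime σ) x≤) (run-unload σ x))
      (run-bind run-push (run-bind (run-≤ (ev-mono (unloadTime (list σ)) xs≤) (run-unload (list σ) xs))
      (run-bind run-push (run-bind (run-≤ (ev-mono transferTime xs≤) (run-stash (list σ) xs))
      (run-bind (run-≤ (ev-mono transferTime x≤) (run-load σ x))
      (run-bind (run-≤ (ev-mono (time f) xa≤) (runs f (x , a)))
      (run-bind run-push (run-bind (run-≤ (ev-mono transferTime xs≤) (run-unstash (list σ) xs))
      (run-≤ (ev-mono transferTime xs≤) (run-load (list σ) xs)))))))))))
      where
      x≤ : sz σ x ≤ n
      x≤ = ≤-trans (≤-trans (m≤m+n _ (szs σ xs)) (n≤1+n _)) (≤-trans (m≤m+n _ (sz α a)) le)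
      xs≤ : szs σ xs ≤ n
      xs≤ = ≤-trans (≤-trans (m≤n+m _ (sz σ x)) (n≤1+n _)) (≤-trans (m≤m+n _ (sz α a)) le)
      xa≤ : sz σ x + sz α a ≤ n
      xa≤ = ≤-trans (+-monoˡ-≤ (sz α a) (≤-trans (m≤m+n _ (szs σ xs)) (n≤1+n _))) le

    -- The accumulators met on the way are the folds over prefixes; with `M` bounding all of them,
    -- every iteration costs at most `ev iterateTime (N + M) + 2`.
    run-fold : ∀ xs a N M → szs σ xs ≤ N → (∀ ys zs → xs ≡ ys ++ zs → sz α (foldl step′ a ys) ≤ M) → ∀ {a′ b c} →
               Run (loop (popThen A foldCell)) (ups σ xs (up α a a′) , b , c) tt (up α (foldl step′ a xs) a′ , b , c)
                   (length xs * (ev iterateTime (N + M) + 2) + 2)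
    run-fold [] a N M le bd = run-exit (run-bind (run-pop refl) run-ret)
    run-fold (x ∷ xs) a N M le bd =
      run-≤ (≤-reflexive (trans (cong (_+ (length xs * (T + 2) + 2)) (cong suc (+-comm T 1))) (trans (cong (_+ (length xs * (T + 2) + 2)) (+-comm 2 T)) (sym (+-assoc (T + 2) (length xs * (T + 2)) 2)))))
        (run-again (run-bind (run-pop refl) (run-bind (run-iterate x xs a (N + M) (+-mono-≤ le (bd [] (x ∷ xs) refl))) run-ret))
          (run-fold xs (step′ a x) N M (≤-trans (≤-trans (m≤n+m _ (sz σ x)) (n≤1+n _)) le) (λ ys zs eq → bd (x ∷ ys) zs (cong (x ∷_) eq))))
      where T = ev iterateTime (N + M)

  module _ (bound : ∀ xs a → sz α (foldl (λ a x → fun f (x , a)) a xs) ≤ ev q (szs σ xs + sz α a)) where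
    opaque
      computes-foldl : Computes (list σ ⊗ α) α (λ (xs , a) → foldl (λ a x → fun f (x , a)) a xs)
      computes-foldl = record
        { prog = loop (popThen A foldCell)
        ; time = X ⊛ ((iterateTime ⊚ (X ⊕ q)) ⊕ con 2) ⊕ con 2
        ; runs = λ (xs , a) → run-≤ (+-monoˡ-≤ 2 (*-monoˡ-≤ _ (≤-trans (length≤szs σ xs) (m≤m+n _ _))))
            (run-fold xs a (szs σ xs + sz α a) (ev q (szs σ xs + sz α a)) (m≤m+n _ _)
              -- A prefix is no larger than the whole list, so the monotone `q` bounds its fold too.
              λ { ys zs refl → ≤-trans (bound ys a) (ev-mono q (+-monoˡ-≤ (sz α a) (szs-++ˡ σ ys zs))) }) }

    -- A fold takes polynomial time as soon as its values (hence its partial results) have polynomial size.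
    foldlF : Fn (list σ ⊗ α) α
    foldlF = fn (λ (xs , a) → foldl (λ a x → fun f (x , a)) a xs) computes-foldl

-- Deciders

readCell : Maybe Γ → SP (Maybe ⊤)
readCell (just (bit b)) = prim (push A (bit b)) >> prim (push A (bit true)) >> again
readCell _ = stop

-- The last input bit is on top of B, so consing the popped bits rebuilds the input in its original
-- order.
readInput : SP ⊤
readInput = prim (push A (bit false)) >> loop (popThen B readCell)

run-readCell : ∀ ys xs → Run (loop (popThen B readCell)) (up (list bool) xs [] , map bit ys , []) tt (up (list bool) (ys ʳ++ xs) [] , [] , []) (length ys * 4 + 2)
run-readCell [] xs = run-exit (run-bind (run-empty refl) run-ret)
run-readCell (y ∷ ys) xs = run-again (run-bind (run-pop refl) (run-bind run-push (run-bind run-push run-ret))) (run-readCell ys (y ∷ xs))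

outcome : Maybe Γ → SP Bool
outcome (just (bit b)) = prim (ret b)
outcome _ = prim (ret false)

decider : Fn (list bool) bool → SP Bool
decider f = readInput >> prog f >> popThen A outcome

szs-bool : ∀ bs → szs bool bs ≡ length bs * 2 + 1
szs-bool [] = refl
szs-bool (b ∷ bs) = cong (suc ∘ suc) (szs-bool bs)

deciderTime : Fn (list bool) bool → Poly
deciderTime f = (con 1 ⊕ (X ⊛ con 4 ⊕ con 2)) ⊕ ((time f ⊚ (X ⊛ con 2 ⊕ con 1)) ⊕ con 2)

map-reverse : ∀ {S T : Set} (h : S → T) xs ys → map h xs ʳ++ map h ys ≡ map h (xs ʳ++ ys)
map-reverse h [] ys = refl
map-reverse h (x ∷ xs) ys = map-reverse h xs (x ∷ ys)

run-decider : ∀ f bs → Run (decider f) ([] , reverse (map bit bs) , []) (fun f bs) ([] , [] , []) (ev (deciderTime f) (length bs))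
run-decider f bs =
  subst (λ z → Run (decider f) ([] , z , []) (fun f bs) ([] , [] , []) (ev (deciderTime f) (length bs))) (sym (map-reverse bit bs []))
    (run-bind (run-bind run-push (subst₂ (λ z n → Run (loop (popThen B readCell)) (bit false ∷ [] , map bit (reverse bs) , []) tt (up (list bool) z [] , [] , []) (n * 4 + 2))
        (reverse-involutive bs) (length-reverse bs) (run-readCell (reverse bs) [])))
      (run-bind (run-≤ (≤-reflexive (cong (ev (time f)) (szs-bool bs))) (runs f bs))
        (run-bind (run-pop refl) run-ret)))

decides : (f : Fn (list bool) bool) → Σ TM λ M → Σ ℕ λ k → Σ ℕ λ c →
          ∀ bs → st (run (c * length bs ^ k + c) (initConfig M bs)) ≡ verdict (fun f bs)
decides f = stackMachine (decider f) , proj₁ pb , proj₁ (proj₂ pb) ,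
            λ bs → stackMachine-correct (decider f) bs (run-decider f bs) (proj₂ (proj₂ pb) (length bs))
  where
  T = deciderTime f
  -- The bound of `stackMachine-correct` with `T` stack steps: heights stay below `X ⊕ T`, and the
  -- leading 1 is the transition that sets the mark.
  pb = poly-bound (con 1 ⊕ T ⊛ (con 2 ⊛ (X ⊕ T) ⊕ con 6))

-- Variables and Boolean connectives

v0 : ∀ {σ γ} → Fn (σ ⊗ γ) σ
v0 = fstF

v1 : ∀ {σ τ γ} → Fn (σ ⊗ τ ⊗ γ) τ
v1 = fstF ∙ sndF

v2 : ∀ {σ₀ σ₁ σ₂ γ} → Fn (σ₀ ⊗ σ₁ ⊗ σ₂ ⊗ γ) σ₂
v2 = v1 ∙ sndF

v3 : ∀ {σ₀ σ₁ σ₂ σ₃ γ} → Fn (σ₀ ⊗ σ₁ ⊗ σ₂ ⊗ σ₃ ⊗ γ) σ₃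
v3 = v2 ∙ sndF

v4 : ∀ {σ₀ σ₁ σ₂ σ₃ σ₄ γ} → Fn (σ₀ ⊗ σ₁ ⊗ σ₂ ⊗ σ₃ ⊗ σ₄ ⊗ γ) σ₄
v4 = v3 ∙ sndF

ifF : ∀ {γ τ} → Fn γ bool → Fn γ τ → Fn γ τ → Fn γ τ
ifF c t e = condF t e ∙ (c ,ᶠ idF)

infixr 5 _∷ᶠ_
_∷ᶠ_ : ∀ {γ τ} → Fn γ τ → Fn γ (list τ) → Fn γ (list τ)
x ∷ᶠ xs = consF ∙ (x ,ᶠ xs)

infixr 6 _∧ᶠ_
infixr 5 _∨ᶠ_
_∧ᶠ_ _∨ᶠ_ : ∀ {γ} → Fn γ bool → Fn γ bool → Fn γ bool
f ∧ᶠ g = recast (ifF f g (boolF false)) (λ x → fun f x ∧ fun g x) λ x → lemma (fun f x)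
  where
  lemma : ∀ b {c} → (if b then c else false) ≡ b ∧ c
  lemma true = refl
  lemma false = refl
f ∨ᶠ g = recast (ifF f (boolF true) g) (λ x → fun f x ∨ fun g x) λ x → lemma (fun f x)
  where
  lemma : ∀ b {c} → (if b then true else c) ≡ b ∨ c
  lemma true = refl
  lemma false = refl

notF : ∀ {γ} → Fn γ bool → Fn γ bool
notF f = recast (ifF f (boolF false) (boolF true)) (λ x → not (fun f x)) λ x → lemma (fun f x)
  where
  lemma : ∀ b → (if b then false else true) ≡ not b
  lemma true = refl
  lemma false = refl

-- Folds over lists

-- The language has no closures, so a read-only parameter travels inside the accumulator; its size
-- is the extra `X` in the bound.
foldF : ∀ {σ α γ} (f : Fn (σ ⊗ α ⊗ γ) α) (q : Poly) →
        (∀ xs a g → sz α (foldl (λ a x → fun f (x , a , g)) a xs) ≤ ev q (szs σ xs + (sz α a + sz γ g))) →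
        Fn (list σ ⊗ α ⊗ γ) α
foldF {σ} {α} {γ} f q bound =
  recast (fstF ∙ foldlF (f ,ᶠ sndF ∙ sndF) (q ⊕ X) bound′) (λ (xs , a , g) → foldl (λ a x → fun f (x , a , g)) a xs)
    (λ (xs , a , g) → cong proj₁ (fold-pair xs a g))
  where
  fold-pair : ∀ xs a g → foldl (λ a x → fun f (x , a) , proj₂ a) (a , g) xs ≡ (foldl (λ a x → fun f (x , a , g)) a xs , g)
  fold-pair [] a g = refl
  fold-pair (x ∷ xs) a g = fold-pair xs (fun f (x , a , g)) g
  bound′ : ∀ xs a → sz (α ⊗ γ) (foldl (λ a x → fun f (x , a) , proj₂ a) a xs) ≤ ev (q ⊕ X) (szs σ xs + sz (α ⊗ γ) a)
  bound′ xs (a , g) rewrite fold-pair xs a g = +-mono-≤ (bound xs a g) (≤-trans (m≤n+m (sz γ g) (sz α a)) (m≤n+m _ (szs σ xs)))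

additive-fold : ∀ {σ} {T : Set} (h : T → ⟦ σ ⟧ → T) (size : T → ℕ) (N k : ℕ) →
                (∀ a x → sz σ x ≤ N → size (h a x) ≤ size a + k) →
                ∀ xs a → szs σ xs ≤ N → size (foldl h a xs) ≤ size a + length xs * k
additive-fold h size N k hyp [] a le = m≤m+n _ _
additive-fold {σ} h size N k hyp (x ∷ xs) a le = begin
  size (foldl h (h a x) xs)         ≤⟨ additive-fold h size N k hyp xs (h a x) (≤-trans (≤-trans (m≤n+m _ (sz σ x)) (n≤1+n _)) le) ⟩
  size (h a x) + length xs * k      ≤⟨ +-monoˡ-≤ _ (hyp a x (≤-trans (≤-trans (m≤m+n _ (szs σ xs)) (n≤1+n _)) le)) ⟩
  size a + k + length xs * k        ≡⟨ +-assoc (size a) k _ ⟩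
  size a + (k + length xs * k)      ∎
  where open ≤-Reasoning

-- The increment `r` may depend on the element and the parameter but not on the accumulator. This
-- excludes repeated doubling, and the total growth is at most the length of the list times `r`.
foldAddF : ∀ {σ α γ} (f : Fn (σ ⊗ α ⊗ γ) α) (r : Poly) →
           (∀ x a g → sz α (fun f (x , a , g)) ≤ sz α a + ev r (sz σ x + sz γ g)) →
           Fn (list σ ⊗ α ⊗ γ) α
foldAddF {σ} {α} {γ} f r hyp = foldF f (X ⊕ X ⊛ r) λ xs a g →
  let n = szs σ xs + (sz α a + sz γ g) in
  ≤-trans
    (additive-fold (λ a x → fun f (x , a , g)) (sz α) (szs σ xs) (ev r n)
      (λ a′ x le → ≤-trans (hyp x a′ g) (+-monoʳ-≤ (sz α a′) (ev-mono r (+-mono-≤ le (m≤n+m _ (sz α a)))))) xs a ≤-refl)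
    (+-mono-≤ (≤-trans (m≤m+n _ (sz γ g)) (m≤n+m _ (szs σ xs))) (*-monoˡ-≤ (ev r n) (≤-trans (length≤szs σ xs) (m≤m+n _ _))))

revAppF : ∀ {σ} → Fn (list σ ⊗ list σ) (list σ)
revAppF {σ} = recast (foldAddF {γ = unit} (v0 ∷ᶠ v1) (con 1 ⊕ X) bound ∙ (fstF ,ᶠ sndF ,ᶠ bangF)) (λ (xs , ys) → xs ʳ++ ys) (λ _ → refl)
  where
  bound : ∀ x a (g : ⊤) → suc (sz σ x + szs σ a) ≤ szs σ a + suc (sz σ x + 0)
  bound x a g = ≤-reflexive (trans (+-comm (suc (sz σ x)) (szs σ a)) (cong (szs σ a +_) (cong suc (sym (+-identityʳ _)))))

reverseF : ∀ {σ} → Fn (list σ) (list σ)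
reverseF = recast (revAppF ∙ (idF ,ᶠ nilF)) reverse (λ _ → refl)

mapF : ∀ {σ τ γ} → Fn (σ ⊗ γ) τ → Fn (list σ ⊗ γ) (list τ)
mapF {σ} {τ} {γ} f = recast
  (reverseF ∙ foldAddF (f ∙ (v0 ,ᶠ sndF ∙ sndF) ∷ᶠ v1) (con 1 ⊕ outSize f) bound ∙ (v0 ,ᶠ nilF ,ᶠ sndF))
  (λ (xs , g) → map (λ x → fun f (x , g)) xs)
  (λ (xs , g) → trans (cong reverse (rev-map (λ x → fun f (x , g)) xs [])) (reverse-involutive _))
  where
  rev-map : ∀ {S T : Set} (h : S → T) xs ys → foldl (λ a x → h x ∷ a) ys xs ≡ map h xs ʳ++ ys
  rev-map h [] ys = refl
  rev-map h (x ∷ xs) ys = rev-map h xs (h x ∷ ys)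
  bound : ∀ x a g → suc (sz τ (fun f (x , g)) + szs τ a) ≤ szs τ a + suc (ev (outSize f) (sz σ x + sz γ g))
  bound x a g = ≤-trans (≤-reflexive (+-comm (suc (sz τ (fun f (x , g)))) (szs τ a))) (+-monoʳ-≤ (szs τ a) (s≤s (sz-fun f (x , g))))

concatMapF : ∀ {σ τ γ} → Fn (σ ⊗ γ) (list τ) → Fn (list σ ⊗ γ) (list τ)
concatMapF {σ} {τ} {γ} f = recast
  (reverseF ∙ foldAddF (revAppF ∙ (f ∙ (v0 ,ᶠ sndF ∙ sndF) ,ᶠ v1)) (outSize f) bound ∙ (v0 ,ᶠ nilF ,ᶠ sndF))
  (λ (xs , g) → concatMap (λ x → fun f (x , g)) xs)
  (λ (xs , g) → trans (cong reverse (rev-concat (λ x → fun f (x , g)) xs [])) (reverse-involutive _))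
  where
  ʳ++-assoc : ∀ {T : Set} (xs ys zs : List T) → ys ʳ++ (xs ʳ++ zs) ≡ (xs ++ ys) ʳ++ zs
  ʳ++-assoc [] ys zs = refl
  ʳ++-assoc (x ∷ xs) ys zs = ʳ++-assoc xs ys (x ∷ zs)
  rev-concat : ∀ {S T : Set} (h : S → List T) xs ys → foldl (λ a x → h x ʳ++ a) ys xs ≡ concatMap h xs ʳ++ ys
  rev-concat h [] ys = refl
  rev-concat h (x ∷ xs) ys = trans (rev-concat h xs (h x ʳ++ ys)) (ʳ++-assoc (h x) (concatMap h xs) ys)
  szs-ʳ++ : ∀ xs ys → szs τ (xs ʳ++ ys) ≤ szs τ ys + szs τ xs
  szs-ʳ++ [] ys = m≤m+n _ _
  szs-ʳ++ (x ∷ xs) ys = ≤-trans (szs-ʳ++ xs (x ∷ ys))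
    (≤-reflexive (solve 3 (λ s u v → con 1 :+ (s :+ u) :+ v := u :+ (con 1 :+ (s :+ v))) refl (sz τ x) (szs τ ys) (szs τ xs)))
    where open +-*-Solver
  bound : ∀ x a g → szs τ (fun f (x , g) ʳ++ a) ≤ szs τ a + ev (outSize f) (sz σ x + sz γ g)
  bound x a g = ≤-trans (szs-ʳ++ (fun f (x , g)) a) (+-monoʳ-≤ (szs τ a) (sz-fun f (x , g)))

filterF : ∀ {σ γ} → Fn (σ ⊗ γ) bool → Fn (list σ ⊗ γ) (list σ)
filterF {σ} {γ} f = recast
  (concatMapF (ifF f (v0 ∷ᶠ nilF) nilF))
  (λ (xs , g) → filterᵇ (λ x → fun f (x , g)) xs)
  (λ (xs , g) → lemma (λ x → fun f (x , g)) xs)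
  where
  lemma : ∀ {S : Set} (p : S → Bool) xs → concatMap (λ x → if p x then x ∷ [] else []) xs ≡ filterᵇ p xs
  lemma p [] = refl
  lemma p (x ∷ xs) with p x
  ... | true = cong (x ∷_) (lemma p xs)
  ... | false = lemma p xs

anyF : ∀ {σ γ} → Fn (σ ⊗ γ) bool → Fn (list σ ⊗ γ) bool
anyF {σ} {γ} f = recast
  (foldAddF (v1 ∨ᶠ f ∙ (v0 ,ᶠ sndF ∙ sndF)) (con 0) (λ _ _ _ → ≤-refl) ∙ (v0 ,ᶠ boolF false ,ᶠ sndF))
  (λ (xs , g) → any (λ x → fun f (x , g)) xs)
  (λ (xs , g) → lemma (λ x → fun f (x , g)) xs false)
  where
  lemma : ∀ {S : Set} (p : S → Bool) xs b → foldl (λ a x → a ∨ p x) b xs ≡ b ∨ any p xs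
  lemma p [] b = sym (∨-identityʳ b)
  lemma p (x ∷ xs) b = trans (lemma p xs (b ∨ p x)) (∨-assoc b (p x) (any p xs))

allF : ∀ {σ γ} → Fn (σ ⊗ γ) bool → Fn (list σ ⊗ γ) bool
allF {σ} {γ} f = recast
  (foldAddF (v1 ∧ᶠ f ∙ (v0 ,ᶠ sndF ∙ sndF)) (con 0) (λ _ _ _ → ≤-refl) ∙ (v0 ,ᶠ boolF true ,ᶠ sndF))
  (λ (xs , g) → all (λ x → fun f (x , g)) xs)
  (λ (xs , g) → lemma (λ x → fun f (x , g)) xs true)
  where
  lemma : ∀ {S : Set} (p : S → Bool) xs b → foldl (λ a x → a ∧ p x) b xs ≡ b ∧ all p xs
  lemma p [] b = sym (∧-identityʳ b)
  lemma p (x ∷ xs) b = trans (lemma p xs (b ∧ p x)) (∧-assoc b (p x) (all p xs))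

zipF : ∀ {σ τ} → Fn (list σ ⊗ list τ) (list (σ ⊗ τ))
zipF {σ} {τ} = recast
  (reverseF ∙ sndF ∙ foldAddF {γ = unit} stepF (con 0 ⊕ X) bound ∙ (fstF ,ᶠ (sndF ,ᶠ nilF) ,ᶠ bangF))
  (λ (xs , ys) → zip xs ys)
  (λ (xs , ys) → trans (cong reverse (lemma xs ys [])) (reverse-involutive _))
  where
  stepF : Fn (σ ⊗ (list τ ⊗ list (σ ⊗ τ)) ⊗ unit) (list τ ⊗ list (σ ⊗ τ))
  stepF = caseF (nilF ,ᶠ v1) (v1 ,ᶠ (v2 ,ᶠ v0) ∷ᶠ v3) ∙ (fstF ∙ v1 ,ᶠ v0 ,ᶠ sndF ∙ v1 ,ᶠ bangF)
  next′ : ⟦ list τ ⊗ list (σ ⊗ τ) ⟧ → ⟦ σ ⟧ → ⟦ list τ ⊗ list (σ ⊗ τ) ⟧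
  next′ a x = fun stepF (x , a , tt)
  exhausted : ∀ xs zs → proj₂ (foldl next′ ([] , zs) xs) ≡ zs
  exhausted [] zs = refl
  exhausted (x ∷ xs) zs = exhausted xs zs
  lemma : ∀ xs ys zs → proj₂ (foldl next′ (ys , zs) xs) ≡ zip xs ys ʳ++ zs
  lemma [] ys zs = refl
  lemma (x ∷ xs) [] zs = exhausted xs zs
  lemma (x ∷ xs) (y ∷ ys) zs = lemma xs ys ((x , y) ∷ zs)
  bound : ∀ x a (g : ⊤) → sz (list τ ⊗ list (σ ⊗ τ)) (fun stepF (x , a , g)) ≤ sz (list τ ⊗ list (σ ⊗ τ)) a + (0 + (sz σ x + 0))
  bound x ([] , zs) g = m≤m+n _ _
  bound x (y ∷ ys , zs) g = ≤-reflexive (solve 4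
    (λ s t u v → u :+ (con 1 :+ (s :+ t :+ v)) := con 1 :+ (t :+ u :+ v) :+ (con 0 :+ (s :+ con 0))) refl
    (sz σ x) (sz τ y) (szs τ ys) (szs (σ ⊗ τ) zs))
    where open +-*-Solver

eqList : ∀ {S : Set} → (S → S → Bool) → List S → List S → Bool
eqList e [] [] = true
eqList e [] (_ ∷ _) = false
eqList e (_ ∷ _) [] = false
eqList e (x ∷ xs) (y ∷ ys) = e x y ∧ eqList e xs ys

eqListF : ∀ {τ} (e : Fn (τ ⊗ τ) bool) → Fn (list τ ⊗ list τ) bool
eqListF {τ} e = recast
  (sndF ∙ finishF ∙ foldAddF {γ = unit} stepF (con 0) bound ∙ (fstF ,ᶠ (sndF ,ᶠ boolF true) ,ᶠ bangF))
  (λ (xs , ys) → eqList (λ x y → fun e (x , y)) xs ys)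
  (λ (xs , ys) → lemma xs ys true)
  where
  stepF : Fn (τ ⊗ (list τ ⊗ bool) ⊗ unit) (list τ ⊗ bool)
  stepF = caseF (nilF ,ᶠ boolF false) (v1 ,ᶠ v3 ∧ᶠ e ∙ (v2 ,ᶠ v0)) ∙ (fstF ∙ v1 ,ᶠ v0 ,ᶠ sndF ∙ v1 ,ᶠ bangF)
  finishF : Fn (list τ ⊗ bool) (unit ⊗ bool)
  finishF = caseF (bangF ,ᶠ idF) (bangF ,ᶠ boolF false)
  next′ : ⟦ list τ ⊗ bool ⟧ → ⟦ τ ⟧ → ⟦ list τ ⊗ bool ⟧
  next′ a x = fun stepF (x , a , tt)
  failed : ∀ xs ys → proj₂ (fun finishF (foldl next′ (ys , false) xs)) ≡ false
  failed [] [] = refl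
  failed [] (y ∷ ys) = refl
  failed (x ∷ xs) [] = failed xs []
  failed (x ∷ xs) (y ∷ ys) = failed xs ys
  lemma : ∀ xs ys b → proj₂ (fun finishF (foldl next′ (ys , b) xs)) ≡ b ∧ eqList (λ x y → fun e (x , y)) xs ys
  lemma [] [] b = sym (∧-identityʳ b)
  lemma [] (y ∷ ys) b = sym (∧-zeroʳ b)
  lemma (x ∷ xs) [] b = trans (failed xs []) (sym (∧-zeroʳ b))
  lemma (x ∷ xs) (y ∷ ys) b = trans (lemma xs ys (b ∧ fun e (x , y))) (∧-assoc b _ _)
  bound : ∀ x a (g : ⊤) → sz (list τ ⊗ bool) (fun stepF (x , a , g)) ≤ sz (list τ ⊗ bool) a + 0
  bound x ([] , b) g = ≤-refl
  bound x (y ∷ ys , b) g = ≤-trans (≤-trans (+-monoˡ-≤ 1 (m≤n+m (szs τ ys) (sz τ y))) (n≤1+n _)) (m≤m+n _ 0)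

tl : ∀ {S : Set} → List S → List S
tl [] = []
tl (_ ∷ xs) = xs

tlF : ∀ {σ} → Fn (list σ) (list σ)
tlF {σ} = recast (caseF {ρ = unit} nilF v1 ∙ (idF ,ᶠ bangF)) tl λ { [] → refl ; (_ ∷ _) → refl }

dropF : ∀ {σ τ} → Fn (list σ ⊗ list τ) (list τ)
dropF {σ} {τ} = recast (foldAddF {γ = unit} (tlF ∙ v1) (con 0) (λ _ a _ → ≤-trans (szs-tl a) (m≤m+n _ 0)) ∙ (fstF ,ᶠ sndF ,ᶠ bangF))
  (λ (k , xs) → Data.List.drop (length k) xs) (λ (k , xs) → lemma k xs)
  where
  szs-tl : ∀ xs → szs τ (tl xs) ≤ szs τ xs
  szs-tl [] = ≤-refl
  szs-tl (x ∷ xs) = ≤-trans (m≤n+m _ (sz τ x)) (n≤1+n _)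
  drop-[] : ∀ (k : List ⟦ σ ⟧) → Data.List.drop (length k) [] ≡ [] {A = ⟦ τ ⟧}
  drop-[] [] = refl
  drop-[] (_ ∷ k) = refl
  lemma : ∀ k xs → foldl (λ a _ → tl a) xs k ≡ Data.List.drop (length k) xs
  lemma [] xs = refl
  lemma (_ ∷ k) [] = trans (lemma k []) (drop-[] k)
  lemma (_ ∷ k) (x ∷ xs) = lemma k xs

-- Unary numbers are lists over the unit type.

Num Bits : Ty
Num = list unit
Bits = list bool

un : ℕ → List ⊤
un n = replicate n tt

upFrom : List ⊤ → List ⊤ → List (List ⊤)
upFrom k [] = []
upFrom k (_ ∷ m) = k ∷ upFrom (tt ∷ k) m

-- Each step copies the counter, which is part of the accumulator, so `foldAddF` does not apply. The
-- counter never exceeds its start plus the number of steps, which gives a quadratic bound directly.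
iotaF : Fn Num (list Num)
iotaF = recast (reverseF ∙ sndF ∙ foldF {γ = unit} stepF (X ⊕ X ⊛ (con 2 ⊕ X)) (λ xs a g → bound xs a) ∙ (idF ,ᶠ (nilF ,ᶠ nilF) ,ᶠ bangF))
  (upFrom []) (λ m → trans (cong reverse (lemma m [] [])) (reverse-involutive _))
  where
  stepF : Fn (unit ⊗ (Num ⊗ list Num) ⊗ unit) (Num ⊗ list Num)
  stepF = (bangF ∷ᶠ fstF ∙ v1) ,ᶠ (fstF ∙ v1 ∷ᶠ sndF ∙ v1)
  next′ : ⟦ Num ⊗ list Num ⟧ → ⊤ → ⟦ Num ⊗ list Num ⟧
  next′ a x = fun stepF (x , a , tt)
  lemma : ∀ m k acc → proj₂ (foldl next′ (k , acc) m) ≡ upFrom k m ʳ++ acc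
  lemma [] k acc = refl
  lemma (_ ∷ m) k acc = lemma m (tt ∷ k) (k ∷ acc)
  exact : ∀ m k acc → sz (Num ⊗ list Num) (foldl next′ (k , acc) m) ≤ szs unit k + szs Num acc + length m * (2 + (length m + szs unit k))
  exact [] k acc = m≤m+n _ _
  exact (_ ∷ m) k acc = ≤-trans (exact m (tt ∷ k) (k ∷ acc)) (≤-trans (m≤m+n _ 1) (≤-trans (m≤m+n _ l) (≤-reflexive
    (solve 3 (λ l k a → con 1 :+ k :+ (con 1 :+ (k :+ a)) :+ l :* (con 2 :+ (l :+ (con 1 :+ k))) :+ con 1 :+ l
               := k :+ a :+ (con 1 :+ l) :* (con 2 :+ ((con 1 :+ l) :+ k))) refl l (szs unit k) (szs Num acc)))))
    where open +-*-Solver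
          l = length m
  bound : ∀ xs a → sz (Num ⊗ list Num) (foldl next′ a xs) ≤ ev (X ⊕ X ⊛ (con 2 ⊕ X)) (szs unit xs + (sz (Num ⊗ list Num) a + 0))
  bound xs (k , acc) = ≤-trans (exact xs k acc) (+-mono-≤ (≤-trans (m≤m+n _ 0) (m≤n+m _ (szs unit xs)))
    (*-mono-≤ (≤-trans (length≤szs unit xs) (m≤m+n _ _))
      (s≤s (s≤s (+-mono-≤ (length≤szs unit xs) (≤-trans (m≤m+n _ (szs Num acc)) (m≤m+n _ 0)))))))

-- Parsers

-- `shrink` is what keeps repetition polynomial: every call within a repetition sees an input no
-- larger than the first one, so the parsed values have a common size bound.
record Parser (γ τ : Ty) : Set₁ where
  field
    parse  : Fn (Bits ⊗ γ) (τ ⊗ Bits)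
    shrink : ∀ bs g → szs bool (proj₂ (fun parse (bs , g))) ≤ szs bool bs

open Parser public

-- Correctness in front of an arbitrary remainder is the form that composes along concatenated
-- encodings.
record Parses {γ τ} (p : Parser γ τ) (g : ⟦ γ ⟧) (bs : List Bool) (x : ⟦ τ ⟧) : Set where
  constructor parses
  field
    parsed : ∀ rest → fun (parse p) (bs ++ rest , g) ≡ (x , rest)

readNum : List ⊤ → List Bool → List ⊤ × List Bool
readNum n [] = n , []
readNum n (true ∷ bs) = readNum (tt ∷ n) bs
readNum n (false ∷ bs) = n , bs

rep : ∀ {T : Set} → (List Bool → T × List Bool) → List ⊤ → List Bool → List T × List Bool
rep p [] bs = [] , bs
rep p (_ ∷ k) bs = (proj₁ (p bs) ∷ proj₁ (rep p k (proj₂ (p bs)))) , proj₂ (rep p k (proj₂ (p bs)))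

infixr 1 _>>=ᴾ_

opaque

  pureP : ∀ {γ τ} → Fn γ τ → Parser γ τ
  pureP f = record { parse = f ∙ sndF ,ᶠ fstF ; shrink = λ bs g → ≤-refl }

  _>>=ᴾ_ : ∀ {γ σ τ} → Parser γ σ → Parser (σ ⊗ γ) τ → Parser γ τ
  p >>=ᴾ q = record
    { parse = parse q ∙ (sndF ∙ fstF ,ᶠ fstF ∙ fstF ,ᶠ sndF) ∙ (parse p ,ᶠ sndF)
    ; shrink = λ bs g → ≤-trans (shrink q _ _) (shrink p bs g) }

  bitP : ∀ {γ} → Parser γ bool
  bitP {γ} = record
    { parse = caseF (boolF false ,ᶠ nilF) (v0 ,ᶠ v1)
    ; shrink = λ { [] g → ≤-refl ; (b ∷ bs) g → ≤-trans (m≤n+m _ 1) (n≤1+n _) } }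

  -- A fold cannot stop early. At the first `false` a flag is raised, and from then on the bits are
  -- only collected, in reverse; `fixF` turns them round.
  numP : ∀ {γ} → Parser γ Num
  numP {γ} = record
    { parse = recast (fixF ∙ foldAddF {γ = unit} stepF (con 2) bound ∙ (fstF ,ᶠ (boolF false ,ᶠ nilF ,ᶠ nilF) ,ᶠ bangF))
        (λ (bs , g) → readNum [] bs) (λ (bs , g) → lemma bs [])
    ; shrink = λ bs g → shrunk bs [] }
    where
    stepF : Fn (bool ⊗ (bool ⊗ Num ⊗ Bits) ⊗ unit) (bool ⊗ Num ⊗ Bits)
    stepF = ifF (fstF ∙ v1) (boolF true ,ᶠ fstF ∙ sndF ∙ v1 ,ᶠ v0 ∷ᶠ sndF ∙ sndF ∙ v1)
                (ifF v0 (boolF false ,ᶠ bangF ∷ᶠ fstF ∙ sndF ∙ v1 ,ᶠ sndF ∙ sndF ∙ v1)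
                        (boolF true ,ᶠ sndF ∙ v1))
    fixF : Fn (bool ⊗ Num ⊗ Bits) (Num ⊗ Bits)
    fixF = v1 ,ᶠ reverseF ∙ sndF ∙ sndF
    next′ : ⟦ bool ⊗ Num ⊗ Bits ⟧ → Bool → ⟦ bool ⊗ Num ⊗ Bits ⟧
    next′ a x = fun stepF (x , a , tt)
    bound : ∀ x a (g : ⊤) → sz (bool ⊗ Num ⊗ Bits) (fun stepF (x , a , g)) ≤ sz (bool ⊗ Num ⊗ Bits) a + 2
    bound x (true , n , r) g = ≤-reflexive (solve 2 (λ n r → con 1 :+ (n :+ (con 2 :+ r)) := con 1 :+ (n :+ r) :+ con 2) refl (szs unit n) (szs bool r))
      where open +-*-Solver
    bound true (false , n , r) g = ≤-trans (≤-reflexive (+-comm 1 _)) (+-monoʳ-≤ (suc (szs unit n + szs bool r)) (s≤s {n = 1} z≤n))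
    bound false (false , n , r) g = m≤m+n _ 2
    done : ∀ bs n r → foldl next′ (true , n , r) bs ≡ (true , n , bs ʳ++ r)
    done [] n r = refl
    done (b ∷ bs) n r = done bs n (b ∷ r)
    lemma : ∀ bs n → fun fixF (foldl next′ (false , n , []) bs) ≡ readNum n bs
    lemma [] n = refl
    lemma (true ∷ bs) n = lemma bs (tt ∷ n)
    lemma (false ∷ bs) n = trans (cong (fun fixF) (done bs n [])) (cong (n ,_) (reverse-involutive bs))
    shrunk : ∀ bs n → szs bool (proj₂ (readNum n bs)) ≤ szs bool bs
    shrunk [] n = ≤-refl
    shrunk (true ∷ bs) n = ≤-trans (shrunk bs (tt ∷ n)) (≤-trans (n≤1+n _) (n≤1+n _))
    shrunk (false ∷ bs) n = ≤-trans (n≤1+n _) (n≤1+n _)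

  repP : ∀ {γ τ} → Fn γ Num → Parser γ τ → Parser γ (list τ)
  repP {γ} {τ} n p = record
    { parse = recast (fixF ∙ foldF stepF sizeBound bound ∙ (n ∙ sndF ,ᶠ (nilF ,ᶠ fstF) ,ᶠ sndF))
        (λ (bs , g) → rep (λ bs → fun (parse p) (bs , g)) (fun n g) bs)
        (λ (bs , g) → lemma g (fun n g) [] bs)
    ; shrink = λ bs g → shrunk g (fun n g) bs }
    where
    sizeBound : Poly
    sizeBound = X ⊕ X ⊛ (con 1 ⊕ outSize (parse p))
    state : Ty
    state = list τ ⊗ Bits
    stepF : Fn (unit ⊗ state ⊗ γ) state
    stepF = (fstF ∙ fstF ∷ᶠ sndF ,ᶠ sndF ∙ fstF) ∙ (parse p ∙ (sndF ∙ v1 ,ᶠ sndF ∙ sndF) ,ᶠ fstF ∙ v1)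
    fixF : Fn state state
    fixF = reverseF ∙ fstF ,ᶠ sndF
    next′ : ⟦ γ ⟧ → ⟦ state ⟧ → ⊤ → ⟦ state ⟧
    next′ g a x = fun stepF (x , a , g)
    pg : ⟦ γ ⟧ → List Bool → ⟦ τ ⟧ × List Bool
    pg g bs = fun (parse p) (bs , g)
    lemma : ∀ g k acc bs → fun fixF (foldl (next′ g) (acc , bs) k) ≡ (acc ʳ++ proj₁ (rep (pg g) k bs) , proj₂ (rep (pg g) k bs))
    lemma g [] acc bs = refl
    lemma g (_ ∷ k) acc bs = lemma g k (proj₁ (pg g bs) ∷ acc) (proj₂ (pg g bs))
    shrunk : ∀ g k bs → szs bool (proj₂ (rep (pg g) k bs)) ≤ szs bool bs
    shrunk g [] bs = ≤-refl
    shrunk g (_ ∷ k) bs = ≤-trans (shrunk g k _) (shrink p bs g)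
    exact : ∀ N g k acc bs → szs bool bs ≤ N →
            sz state (foldl (next′ g) (acc , bs) k) ≤ szs τ acc + N + length k * (1 + ev (outSize (parse p)) (N + sz γ g))
    exact N g [] acc bs le = ≤-trans (+-monoʳ-≤ (szs τ acc) le) (m≤m+n _ _)
    exact N g (_ ∷ k) acc bs le = ≤-trans (exact N g k (proj₁ (pg g bs) ∷ acc) (proj₂ (pg g bs)) (≤-trans (shrink p bs g) le))
      (≤-trans (+-monoˡ-≤ _ (+-monoˡ-≤ N (s≤s (+-monoˡ-≤ (szs τ acc)
          (≤-trans (≤-trans (m≤m+n _ _) (sz-fun (parse p) (bs , g))) (ev-mono (outSize (parse p)) (+-monoˡ-≤ (sz γ g) le)))))))
        (≤-reflexive (solve 4 (λ o a n l → con 1 :+ (o :+ a) :+ n :+ l := a :+ n :+ (con 1 :+ o :+ l)) refl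
          (ev (outSize (parse p)) (N + sz γ g)) (szs τ acc) N (length k * (1 + ev (outSize (parse p)) (N + sz γ g))))))
      where open +-*-Solver
    bound : ∀ xs a g → sz state (foldl (next′ g) a xs) ≤ ev sizeBound (szs unit xs + (sz state a + sz γ g))
    bound xs (acc , bs) g = ≤-trans (exact (szs bool bs) g xs acc bs ≤-refl)
      (+-mono-≤ (≤-trans (m≤m+n _ (sz γ g)) (m≤n+m _ (szs unit xs)))
        (*-mono-≤ (≤-trans (length≤szs unit xs) (m≤m+n _ _))
          (s≤s (ev-mono (outSize (parse p)) (≤-trans (+-monoˡ-≤ (sz γ g) (m≤n+m (szs bool bs) (szs τ acc))) (m≤n+m _ (szs unit xs)))))))

  parses-bind : ∀ {γ σ τ} {p : Parser γ σ} {q : Parser (σ ⊗ γ) τ} {g bs cs x y} →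
                Parses p g bs x → Parses q (x , g) cs y → Parses (p >>=ᴾ q) g (bs ++ cs) y
  parses-bind {p = p} {q} {g} {bs} {cs} {x} {y} (parses hp) (parses hq) = parses go
    where
    go : ∀ rest → fun (parse (p >>=ᴾ q)) ((bs ++ cs) ++ rest , g) ≡ (y , rest)
    go rest rewrite ++-assoc bs cs rest | hp (cs ++ rest) = hq rest

  parses-map : ∀ {γ σ τ} {p : Parser γ σ} {f : Fn (σ ⊗ γ) τ} {g bs x} →
               Parses p g bs x → Parses (p >>=ᴾ pureP f) g bs (fun f (x , g))
  parses-map {f = f} {g} (parses hp) = parses λ rest → cong (λ r → fun f (proj₁ r , g) , proj₂ r) (hp rest)

  parses-num : ∀ {γ} {g : ⟦ γ ⟧} n → Parses (numP {γ}) g (encℕ n) (un n)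
  parses-num n = parses λ rest → trans (go n 0 rest) (cong (λ m → un m , rest) (+-identityʳ n))
    where
    go : ∀ n m rest → readNum (un m) ((replicate n true ++ false ∷ []) ++ rest) ≡ (un (n + m) , rest)
    go zero m rest = refl
    go (suc n) m rest = trans (go n (suc m) rest) (cong (λ k → un k , rest) (+-suc n m))

  parses-rep : ∀ {γ τ} {n : Fn γ Num} {p : Parser γ τ} {g} {T : Set} (enc : T → List Bool) (val : T → ⟦ τ ⟧) xs →
               fun n g ≡ un (length xs) → (∀ x → Parses p g (enc x) (val x)) →
               Parses (repP n p) g (concatMap enc xs) (map val xs)
  parses-rep {n = n} {p} {g} enc val xs len hp = parses λ rest →
      trans (cong (λ k → rep (λ bs → fun (parse p) (bs , g)) k (concatMap enc xs ++ rest)) len) (go xs rest)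
    where
    go : ∀ xs rest → rep (λ bs → fun (parse p) (bs , g)) (un (length xs)) (concatMap enc xs ++ rest) ≡ (map val xs , rest)
    go [] rest = refl
    go (x ∷ xs) rest rewrite ++-assoc (enc x) (concatMap enc xs) rest | Parses.parsed (hp x) (concatMap enc xs ++ rest) | go xs rest = refl

  parses-bit : ∀ {γ} {g : ⟦ γ ⟧} b → Parses (bitP {γ}) g (b ∷ []) b
  parses-bit b = parses λ rest → refl

-- Plan verification as a polynomial-time function

bitsP : ∀ {γ} → Fn γ Num → Parser γ Bits
bitsP n = repP n bitP

Entry Net : Ty
Entry = Bits ⊗ Bits ⊗ Bits
Net = list Num ⊗ list Bits ⊗ Num

entryP : ∀ {γ} → Fn γ Num → Parser γ Entry
entryP n = bitsP n >>=ᴾ bitsP (n ∙ sndF) >>=ᴾ bitsP (n ∙ sndF ∙ sndF) >>=ᴾ pureP (v2 ,ᶠ v1 ,ᶠ v0)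

labelP : ∀ {γ} → Parser γ Num
labelP = bitP >>=ᴾ numP

netP : ∀ {γ} → Parser γ Net
netP = numP >>=ᴾ repP v0 (bitsP v0) >>=ᴾ repP v1 labelP >>=ᴾ pureP (v0 ,ᶠ v1 ,ᶠ v2)

methodP : ∀ {γ} → Parser γ unit
methodP = numP >>=ᴾ netP >>=ᴾ pureP bangF

listP : ∀ {γ τ} → (∀ {γ} → Parser γ τ) → Parser γ (list τ)
listP p = numP >>=ᴾ repP v0 p

Inst : Ty
Inst = list Num ⊗ Bits ⊗ Net ⊗ list Entry

instanceP : Parser unit Inst
instanceP =
  numP >>=ᴾ numP >>=ᴾ numP >>=ᴾ repP v1 (entryP v2) >>=ᴾ listP methodP >>=ᴾ
  netP >>=ᴾ bitsP (v4 ∙ sndF) >>=ᴾ listP numP >>=ᴾ pureP (v0 ,ᶠ v1 ,ᶠ v2 ,ᶠ v4)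

eqNum : List ⊤ → List ⊤ → Bool
eqNum = eqList λ _ _ → true

eqNumF : Fn (Num ⊗ Num) bool
eqNumF = recast (eqListF (boolF true)) (λ (m , n) → eqNum m n) λ _ → refl

eqNums : List (List ⊤) → List (List ⊤) → Bool
eqNums = eqList eqNum

eqNumsF : Fn (list Num ⊗ list Num) bool
eqNumsF = recast (eqListF eqNumF) (λ (m , n) → eqNums m n) λ _ → refl

eqBit : Bool → Bool → Bool
eqBit x y = if x then y else not y

eqBits : List Bool → List Bool → Bool
eqBits = eqList eqBit

eqBitsF : Fn (Bits ⊗ Bits) bool
eqBitsF = recast (eqListF (ifF fstF sndF (notF sndF))) (λ (m , n) → eqBits m n) λ _ → refl

member : List Bool → List (List Bool) → Bool
member Y S = any (λ Z → eqBits Y Z) S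

memberF : Fn (Bits ⊗ list Bits) bool
memberF = recast (anyF (eqBitsF ∙ (sndF ,ᶠ fstF)) ∙ (sndF ,ᶠ fstF)) (λ (Y , S) → member Y S) λ _ → refl

unionV minusV : List Bool → List Bool → List Bool
unionV Y Z = map (λ (y , z) → y ∨ z) (zip Y Z)
minusV Y Z = map (λ (y , z) → y ∧ not z) (zip Y Z)

meets : List Bool → List Bool → Bool
meets Y Z = any (λ (y , z) → y ∧ z) (zip Y Z)

includes : List Bool → List Bool → Bool
includes Y Z = all (λ (y , z) → not y ∨ z) (zip Y Z)

unionF minusF : Fn (Bits ⊗ Bits) Bits
unionF = recast (mapF {γ = unit} (fstF ∙ fstF ∨ᶠ sndF ∙ fstF) ∙ (zipF ,ᶠ bangF)) (λ (Y , Z) → unionV Y Z) λ _ → refl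
minusF = recast (mapF {γ = unit} (fstF ∙ fstF ∧ᶠ notF (sndF ∙ fstF)) ∙ (zipF ,ᶠ bangF)) (λ (Y , Z) → minusV Y Z) λ _ → refl

meetsF includesF : Fn (Bits ⊗ Bits) bool
meetsF = recast (anyF {γ = unit} (fstF ∙ fstF ∧ᶠ sndF ∙ fstF) ∙ (zipF ,ᶠ bangF)) (λ (Y , Z) → meets Y Z) λ _ → refl
includesF = recast (allF {γ = unit} (notF (fstF ∙ fstF) ∨ᶠ sndF ∙ fstF) ∙ (zipF ,ᶠ bangF)) (λ (Y , Z) → includes Y Z) λ _ → refl

apply : List Bool → List Bool → List Bool → List Bool
apply s del add = map (λ (x , d , a) → x ∧ not d ∨ a) (zip s (zip del add))

applyF : Fn (Bits ⊗ Bits ⊗ Bits) Bits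
applyF = recast (mapF {γ = unit} ((fstF ∙ fstF ∧ᶠ notF (v1 ∙ fstF)) ∨ᶠ sndF ∙ sndF ∙ fstF) ∙ (zipF ∙ (fstF ,ᶠ zipF ∙ sndF) ,ᶠ bangF))
  (λ (s , d , a) → apply s d a) λ _ → refl

-- The list is the action table from the current action on, so its head is the relevant entry; an
-- index beyond the table counts as failure.
execStep : List ⟦ Entry ⟧ → Bool × List Bool → Bool × List Bool
execStep [] (ok , s) = false , s
execStep ((pre , del , add) ∷ _) (ok , s) = ok ∧ includes pre s , apply s del add

execute : List (List ⊤) → List Bool → List ⟦ Entry ⟧ → Bool
execute plan s table = proj₁ (foldl (λ st a → execStep (L.drop (length a) table) st) (true , s) plan)

execStepF : Fn (list Entry ⊗ bool ⊗ Bits) (bool ⊗ Bits)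
execStepF = recast
  (caseF (boolF false ,ᶠ sndF) (v2 ∧ᶠ includesF ∙ (fstF ∙ fstF ,ᶠ sndF ∙ sndF ∙ sndF) ,ᶠ
      applyF ∙ (sndF ∙ sndF ∙ sndF ,ᶠ v1 ∙ fstF ,ᶠ sndF ∙ sndF ∙ fstF)))
  (λ (t , st) → execStep t st) λ { ([] , _) → refl ; (_ ∷ _ , _) → refl }

executeF : Fn (list Num ⊗ Bits ⊗ list Entry) bool
executeF = recast
  (fstF ∙ foldAddF (execStepF ∙ (dropF ∙ (fstF ,ᶠ sndF ∙ sndF) ,ᶠ v1)) (con 0) (λ a st t → bound (L.drop (length a) t) st) ∙
    (v0 ,ᶠ (boolF true ,ᶠ v1) ,ᶠ sndF ∙ sndF))
  (λ (p , s , t) → execute p s t) λ _ → refl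
  where
  bound : ∀ t st → sz (bool ⊗ Bits) (execStep t st) ≤ sz (bool ⊗ Bits) st + 0
  bound [] (ok , s) = m≤m+n _ 0
  bound ((p , d , a) ∷ _) (ok , s) = ≤-trans (s≤s shorter) (m≤m+n _ 0)
    where
    open ≤-Reasoning
    shorter : szs bool (apply s d a) ≤ szs bool s
    shorter = begin
      szs bool (apply s d a)                ≡⟨ szs-bool (apply s d a) ⟩
      length (apply s d a) * 2 + 1          ≡⟨ cong (λ n → n * 2 + 1) (trans (length-map _ (zip s (zip d a))) (length-zipWith _,_ s (zip d a))) ⟩
      (length s ⊓ length (zip d a)) * 2 + 1 ≤⟨ +-monoˡ-≤ 1 (*-monoˡ-≤ 2 (m⊓n≤m (length s) (length (zip d a)))) ⟩
      length s * 2 + 1                      ≡⟨ szs-bool s ⟨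
      szs bool s                            ∎

-- Both filtered lists consist of copies of `a`, so comparing them compares multiplicities.
sameCount : List (List ⊤) → List (List ⊤) → List ⊤ → Bool
sameCount xs ys a = eqNums (filterᵇ (λ x → eqNum x a) xs) (filterᵇ (λ y → eqNum y a) ys)

sameLabels : List (List ⊤) → List (List ⊤) → Bool
sameLabels xs ys = all (sameCount xs ys) xs ∧ all (sameCount xs ys) ys

sameLabelsF : Fn (list Num ⊗ list Num) bool
sameLabelsF = recast (allF countF ∙ (fstF ,ᶠ idF) ∧ᶠ allF countF ∙ (sndF ,ᶠ idF)) (λ (xs , ys) → sameLabels xs ys) λ _ → refl
  where
  countF : Fn (Num ⊗ list Num ⊗ list Num) bool
  countF = eqNumsF ∙ (filterF eqNumF ∙ (v1 ,ᶠ fstF) ,ᶠ filterF eqNumF ∙ (sndF ∙ sndF ,ᶠ fstF))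

unitVectors : List ⊤ → List (List Bool)
unitVectors n = map (λ t → map (λ u → eqNum u t) (upFrom [] n)) (upFrom [] n)

unitVectorsF : Fn Num (list Bits)
unitVectorsF = recast (mapF (mapF eqNumF ∙ (sndF ,ᶠ fstF)) ∙ (iotaF ,ᶠ iotaF)) unitVectors λ _ → refl

Task : Ty
Task = Bits ⊗ Bits ⊗ Num

tasks : ⟦ Net ⟧ → List ⟦ Task ⟧
tasks (labels , rows , n) = zip (unitVectors n) (zip rows labels)

tasksF : Fn Net (list Task)
tasksF = recast (zipF ∙ (unitVectorsF ∙ sndF ∙ sndF ,ᶠ zipF ∙ (v1 ,ᶠ fstF))) tasks λ _ → refl

-- the set of non-isolated tasks
target : ⟦ Net ⟧ → List Bool
target (labels , rows , n) = map (λ (e , row) → any id row ∨ any (λ row′ → meets row′ e) rows) (zip (unitVectors n) rows)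

targetF : Fn Net Bits
targetF = recast
  (mapF (anyF {γ = unit} fstF ∙ (sndF ∙ fstF ,ᶠ bangF) ∨ᶠ anyF meetsF ∙ (sndF ,ᶠ fstF ∙ fstF)) ∙ (zipF ∙ (unitVectorsF ∙ sndF ∙ sndF ,ᶠ v1) ,ᶠ v1))
  target λ _ → refl

-- unions of at most w principal up-sets
candidates : ℕ → List (List Bool) → List Bool → List (List Bool)
candidates zero ups ∅ = ∅ ∷ []
candidates (suc w) ups ∅ = concatMap (λ Y → Y ∷ map (λ u → unionV u Y) ups) (candidates w ups ∅)

-- The recursion on `w` takes place outside the language: each constant `w` gets its own program,
-- and the degree of its time bound may grow with `w`.
candidatesF : (w : ℕ) → Fn (list Bits ⊗ Bits) (list Bits)
candidatesF w = recast (go w) (λ (ups , ∅) → candidates w ups ∅) (correct w)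
  where
  go : ℕ → Fn (list Bits ⊗ Bits) (list Bits)
  go zero = sndF ∷ᶠ nilF
  go (suc w) = concatMapF (fstF ∷ᶠ mapF unionF ∙ (v1 ,ᶠ fstF)) ∙ (go w ,ᶠ idF)
  correct : ∀ w x → fun (go w) x ≡ candidates w (proj₁ x) (proj₂ x)
  correct zero x = refl
  correct (suc w) x = cong (concatMap λ Y → Y ∷ map (λ u → unionV u Y) (proj₁ x)) (correct w x)

reachable : List ⟦ Task ⟧ → List (List Bool) → List ⊤ → List Bool → Bool
reachable ts S a Y = member Y S ∨ any (λ (e , row , l) → eqNum l a ∧ member (minusV Y e) S) ts

-- The plan is consumed from its end, so the sets of placed tasks are up-sets; Y is reached at an action either
-- because the action is left to an isolated task or because it is matched with a task t of Y placed first.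
advance : List ⟦ Task ⟧ → List (List Bool) → List (List Bool) → List ⊤ → List (List Bool)
advance ts cand S a = filterᵇ (reachable ts S a) cand

reachableF : Fn (Bits ⊗ Num ⊗ list Bits ⊗ list Task ⊗ list Bits) bool
reachableF = recast
  (memberF ∙ (v0 ,ᶠ v2) ∨ᶠ
   anyF (eqNumF ∙ (sndF ∙ sndF ∙ fstF ,ᶠ v2) ∧ᶠ memberF ∙ (minusF ∙ (v1 ,ᶠ fstF ∙ fstF) ,ᶠ v3)) ∙ (v3 ,ᶠ idF))
  (λ (Y , a , S , ts , _) → reachable ts S a Y) λ _ → refl

advanceF : Fn (Num ⊗ list Bits ⊗ list Task ⊗ list Bits) (list Bits)
advanceF = recast (filterF reachableF ∙ (sndF ∙ sndF ∙ sndF ,ᶠ idF)) (λ (a , S , ts , cand) → advance ts cand S a) λ _ → refl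

szs-filter : ∀ τ (p : ⟦ τ ⟧ → Bool) xs → szs τ (filterᵇ p xs) ≤ szs τ xs
szs-filter τ p [] = ≤-refl
szs-filter τ p (x ∷ xs) with p x
... | true = s≤s (+-monoʳ-≤ (sz τ x) (szs-filter τ p xs))
... | false = ≤-trans (szs-filter τ p xs) (≤-trans (m≤n+m _ (sz τ x)) (n≤1+n _))

sweepPlan : List ⟦ Task ⟧ → List (List Bool) → List (List Bool) → List (List ⊤) → List (List Bool)
sweepPlan ts cand S plan = foldl (advance ts cand) S (reverse plan)

-- Every new table is a sublist of `cand`, which belongs to the parameter; hence the linear
-- increment `X`.
sweepPlanF : Fn (list Num ⊗ list Bits ⊗ list Task ⊗ list Bits) (list Bits)
sweepPlanF = recast
  (foldAddF advanceF X (λ a S (ts , cand) → ≤-trans (szs-filter Bits (reachable ts S a) cand)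
      (≤-trans (≤-trans (m≤n+m _ (szs Task ts)) (m≤n+m _ (szs unit a))) (m≤n+m _ (szs Bits S)))) ∙ (reverseF ∙ fstF ,ᶠ sndF))
  (λ (plan , S , ts , cand) → sweepPlan ts cand S plan) λ _ → refl

upSets : List ⟦ Task ⟧ → List (List Bool)
upSets = map λ (e , row , _) → unionV e row

upSetsF : Fn (list Task) (list Bits)
upSetsF = recast (mapF {γ = unit} (unionF ∙ (fstF ∙ fstF ,ᶠ v1 ∙ fstF)) ∙ (idF ,ᶠ bangF)) upSets λ _ → refl

zeros : List ⊤ → List Bool
zeros = map λ _ → false

zerosF : Fn Num Bits
zerosF = recast (mapF {γ = unit} (boolF false) ∙ (idF ,ᶠ bangF)) zeros λ _ → refl

embeds : ℕ → ⟦ Net ⟧ → List (List ⊤) → Bool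
embeds w net plan =
  member (target net) (sweepPlan (tasks net) (candidates w (upSets (tasks net)) (zeros (proj₂ (proj₂ net)))) (zeros (proj₂ (proj₂ net)) ∷ []) plan)

embedsF : ∀ w → Fn (Net ⊗ list Num) bool
embedsF w = recast
  (memberF ∙ (targetF ∙ fstF ,ᶠ sweepPlanF ∙ (sndF ,ᶠ (∅ ∷ᶠ nilF) ,ᶠ ts ,ᶠ candidatesF w ∙ (upSetsF ∙ ts ,ᶠ ∅))))
  (λ (net , plan) → embeds w net plan) λ _ → refl
  where
  ∅ : Fn (Net ⊗ list Num) Bits
  ∅ = zerosF ∙ sndF ∙ sndF ∙ fstF
  ts : Fn (Net ⊗ list Num) (list Task)
  ts = tasksF ∙ fstF

verify : ℕ → ⟦ Inst ⟧ → Bool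
verify w (plan , s , net@(labels , _) , table) = execute plan s table ∧ sameLabels labels plan ∧ embeds w net plan

verifyF : ∀ w → Fn Inst bool
verifyF w = recast
  (executeF ∙ (v0 ,ᶠ v1 ,ᶠ sndF ∙ sndF ∙ sndF) ∧ᶠ sameLabelsF ∙ (fstF ∙ v2 ,ᶠ v0) ∧ᶠ embedsF w ∙ (v2 ,ᶠ v0))
  (verify w) λ _ → refl

planVerificationF : ∀ w → Fn Bits bool
planVerificationF w = verifyF w ∙ fstF ∙ parse instanceP ∙ (idF ,ᶠ bangF)

-- Parsing encoded instances

parses-list : ∀ {γ τ} {p : ∀ {γ} → Parser γ τ} {g : ⟦ γ ⟧} {T : Set} (enc : T → List Bool) (val : T → ⟦ τ ⟧) xs →
              (∀ x → Parses p (un (length xs) , g) (enc x) (val x)) →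
              Parses (listP p) g (encList enc xs) (map val xs)
parses-list enc val xs hp = parses-bind (parses-num (length xs)) (parses-rep enc val xs refl hp)

parses-bits : ∀ {γ} {n : Fn γ Num} {g} bs → fun n g ≡ un (length bs) → Parses (bitsP n) g bs bs
parses-bits {n = n} {g} bs len = subst₂ (Parses (bitsP n) g) (singles bs) (map-id bs)
  (parses-rep (λ b → b ∷ []) id bs len parses-bit)
  where
  singles : ∀ (bs : List Bool) → concatMap (λ b → b ∷ []) bs ≡ bs
  singles [] = refl
  singles (b ∷ bs) = cong (b ∷_) (singles bs)

parses-subset : ∀ {γ} {n : Fn γ Num} {g m} (s : Subset m) → fun n g ≡ un m → Parses (bitsP n) g (encSubset s) (toList s)
parses-subset s len = parses-bits (toList s) (trans len (cong un (sym (length-toList s))))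

length-allFin : ∀ n → length (allFin n) ≡ n
length-allFin n = length-tabulate id

labelNum : ∀ {nA nC} → Fin nA ⊎ Fin nC → List ⊤
labelNum (inj₁ a) = un (toℕ a)
labelNum (inj₂ c) = un (toℕ c)

parses-label : ∀ {γ} {g : ⟦ γ ⟧} {nA nC} (l : Fin nA ⊎ Fin nC) → Parses (labelP {γ}) g (encLabel l) (labelNum l)
parses-label (inj₁ a) = parses-bind (parses-bit false) (parses-num (toℕ a))
parses-label (inj₂ c) = parses-bind (parses-bit true) (parses-num (toℕ c))

netVal : ∀ {nA nC} → TaskNetwork nA nC → ⟦ Net ⟧
netVal tn = map (λ t → labelNum (α tn t)) (allFin (nT tn)) ,
            map (λ t → map (ord tn t) (allFin (nT tn))) (allFin (nT tn)) ,
            un (nT tn)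

parses-net : ∀ {γ} {g : ⟦ γ ⟧} {nA nC} (tn : TaskNetwork nA nC) → Parses (netP {γ}) g (encTN tn) (netVal tn)
parses-net tn =
  parses-bind (parses-num (nT tn))
    (parses-bind
      (parses-rep (λ t → map (ord tn t) (allFin (nT tn))) (λ t → map (ord tn t) (allFin (nT tn))) (allFin (nT tn))
        (cong un (sym (length-allFin (nT tn))))
        (λ t → parses-bits (map (ord tn t) (allFin (nT tn))) (cong un (sym (trans (length-map (ord tn t) (allFin (nT tn))) (length-allFin (nT tn)))))))
      (parses-map
        (parses-rep (λ t → encLabel (α tn t)) (λ t → labelNum (α tn t)) (allFin (nT tn))
          (cong un (sym (length-allFin (nT tn)))) (λ t → parses-label (α tn t)))))

entryVal : (D : Domain) → Fin (nA D) → ⟦ Entry ⟧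
entryVal D a = toList (pre D a) , toList (del D a) , toList (add D a)

encEntry : (D : Domain) → Fin (nA D) → List Bool
encEntry D a = encSubset (pre D a) ++ encSubset (del D a) ++ encSubset (add D a)

parses-entry : ∀ {γ} {n : Fn γ Num} {g} (D : Domain) a → fun n g ≡ un (nF D) →
               Parses (entryP n) g (encEntry D a) (entryVal D a)
parses-entry D a len =
  parses-bind (parses-subset (pre D a) len) (parses-bind (parses-subset (del D a) len) (parses-map (parses-subset (add D a) len)))

encMethod : ∀ {nA nC} → Method nA nC → List Bool
encMethod m = encFin (task m) ++ encTN (net m)

parses-method : ∀ {γ} {g : ⟦ γ ⟧} {nA nC} (m : Method nA nC) → Parses (methodP {γ}) g (encMethod m) tt
parses-method m = parses-bind (parses-num (toℕ (task m))) (parses-map (parses-net (net m)))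

instVal : PVInstance → ⟦ Inst ⟧
instVal I = map (un ∘ toℕ) (plan I) , toList (s₀ I) , netVal (tn I) , map (entryVal (dom I)) (allFin (nA (dom I)))

parses-instance : ∀ I → fun (parse instanceP) (encode I , tt) ≡ (instVal I , [])
parses-instance I = trans (cong (λ bs → fun (parse instanceP) (bs , tt)) flat) (Parses.parsed whole [])
  where
  D = dom I
  entries = concatMap (encEntry D) (allFin (nA D))
  meths = encList encMethod (methods D)
  tail = encTN (tn I) ++ encSubset (s₀ I) ++ encList encFin (plan I)
  flattened = encℕ (nF D) ++ encℕ (nA D) ++ encℕ (nC D) ++ entries ++ meths ++ tail
  -- The encoding groups the domain as one block, whereas the sequenced parsers consume a
  -- concatenation nested to the right.
  flat : encode I ≡ flattened ++ []
  flat = sym (begin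
    flattened ++ []   ≡⟨ ++-identityʳ flattened ⟩
    flattened         ≡⟨ cong (λ z → encℕ (nF D) ++ encℕ (nA D) ++ encℕ (nC D) ++ z) (++-assoc entries meths tail) ⟨
    encℕ (nF D) ++ encℕ (nA D) ++ encℕ (nC D) ++ (entries ++ meths) ++ tail
                      ≡⟨ cong (λ z → encℕ (nF D) ++ encℕ (nA D) ++ z) (++-assoc (encℕ (nC D)) (entries ++ meths) tail) ⟨
    encℕ (nF D) ++ encℕ (nA D) ++ (encℕ (nC D) ++ entries ++ meths) ++ tail
                      ≡⟨ cong (encℕ (nF D) ++_) (++-assoc (encℕ (nA D)) (encℕ (nC D) ++ entries ++ meths) tail) ⟨
    encℕ (nF D) ++ (encℕ (nA D) ++ encℕ (nC D) ++ entries ++ meths) ++ tail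
                      ≡⟨ ++-assoc (encℕ (nF D)) (encℕ (nA D) ++ encℕ (nC D) ++ entries ++ meths) tail ⟨
    encode I          ∎)
    where open ≡-Reasoning
  whole : Parses instanceP tt flattened (instVal I)
  whole =
    parses-bind (parses-num (nF D)) (parses-bind (parses-num (nA D)) (parses-bind (parses-num (nC D))
    (parses-bind
      (parses-rep (encEntry D) (entryVal D) (allFin (nA D)) (cong un (sym (length-allFin (nA D)))) (λ a → parses-entry D a refl))
    (parses-bind (parses-list {p = methodP} encMethod (λ _ → tt) (methods D) parses-method)
    (parses-bind (parses-net (tn I))
    (parses-bind (parses-subset (s₀ I) refl)
    (parses-map (parses-list {p = numP} encFin (un ∘ toℕ) (plan I) (λ a → parses-num (toℕ a))))))))))

-- Boolean reflection

∧-true : ∀ {x y} → x ∧ y ≡ true → x ≡ true × y ≡ true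
∧-true {true} {true} refl = refl , refl

∧-intro : ∀ {x y} → x ≡ true → y ≡ true → x ∧ y ≡ true
∧-intro refl refl = refl

∨-true : ∀ {x y} → x ∨ y ≡ true → x ≡ true ⊎ y ≡ true
∨-true {true} _ = inj₁ refl
∨-true {false} h = inj₂ h

∨-introˡ : ∀ {x y} → x ≡ true → x ∨ y ≡ true
∨-introˡ refl = refl

∨-introʳ : ∀ x {y} → y ≡ true → x ∨ y ≡ true
∨-introʳ true _ = refl
∨-introʳ false h = h

true≢false : ∀ {x} → x ≡ true → x ≡ false → ⊥
true≢false refl ()

bool-ext : ∀ {x y} → (x ≡ true → y ≡ true) → (y ≡ true → x ≡ true) → x ≡ y
bool-ext {true} f g = sym (f refl)
bool-ext {false} {true} f g = g refl
bool-ext {false} {false} f g = refl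

¬true : ∀ {x} → ¬ (x ≡ true) → x ≡ false
¬true {true} h = ⊥-elim (h refl)
¬true {false} h = refl

any-true : ∀ {X : Set} (p : X → Bool) xs → any p xs ≡ true → Σ X λ x → x ∈ xs × p x ≡ true
any-true p (x ∷ xs) h with ∨-true {p x} h
... | inj₁ px = x , here refl , px
... | inj₂ h′ with any-true p xs h′
...   | y , y∈ , py = y , there y∈ , py

any-intro : ∀ {X : Set} (p : X → Bool) {x xs} → x ∈ xs → p x ≡ true → any p xs ≡ true
any-intro p (here refl) px = ∨-introˡ px
any-intro p {xs = y ∷ _} (there x∈) px = ∨-introʳ (p y) (any-intro p x∈ px)

all-true : ∀ {X : Set} (p : X → Bool) xs → all p xs ≡ true → ∀ {x} → x ∈ xs → p x ≡ true
all-true p (x ∷ xs) h (here refl) = proj₁ (∧-true h)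
all-true p (x ∷ xs) h (there x∈) = all-true p xs (proj₂ (∧-true {p x} h)) x∈

all-intro : ∀ {X : Set} (p : X → Bool) xs → (∀ {x} → x ∈ xs → p x ≡ true) → all p xs ≡ true
all-intro p [] h = refl
all-intro p (x ∷ xs) h = ∧-intro (h (here refl)) (all-intro p xs (h ∘ there))

filterᵇ-∈⁺ : ∀ {X : Set} (p : X → Bool) {x xs} → x ∈ xs → p x ≡ true → x ∈ filterᵇ p xs
filterᵇ-∈⁺ p x∈ px = ∈-filter⁺ _ x∈ (subst Data.Bool.T (sym px) tt)

filterᵇ-∈⁻ : ∀ {X : Set} (p : X → Bool) {x xs} → x ∈ filterᵇ p xs → x ∈ xs × p x ≡ true
filterᵇ-∈⁻ p x∈ with ∈-filter⁻ _ x∈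
... | x∈xs , px = x∈xs , Equivalence.to T-≡ px

eqList-sound : ∀ {X : Set} (e : X → X → Bool) → (∀ {x y} → e x y ≡ true → x ≡ y) → ∀ xs ys → eqList e xs ys ≡ true → xs ≡ ys
eqList-sound e h [] [] _ = refl
eqList-sound e h (x ∷ xs) (y ∷ ys) eq with ∧-true {e x y} eq
... | exy , rest = cong₂ _∷_ (h exy) (eqList-sound e h xs ys rest)

eqList-refl : ∀ {X : Set} (e : X → X → Bool) → (∀ x → e x x ≡ true) → ∀ xs → eqList e xs xs ≡ true
eqList-refl e h [] = refl
eqList-refl e h (x ∷ xs) = ∧-intro (h x) (eqList-refl e h xs)

eqNum-sound : ∀ {m n} → eqNum m n ≡ true → m ≡ n
eqNum-sound {m} {n} = eqList-sound _ (λ _ → refl) m n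

eqNum-refl : ∀ n → eqNum n n ≡ true
eqNum-refl = eqList-refl _ (λ _ → refl)

eqNums-sound : ∀ {m n} → eqNums m n ≡ true → m ≡ n
eqNums-sound {m} {n} = eqList-sound _ eqNum-sound m n

eqNums-refl : ∀ n → eqNums n n ≡ true
eqNums-refl = eqList-refl _ eqNum-refl

eqBits-sound : ∀ {Y Z} → eqBits Y Z ≡ true → Y ≡ Z
eqBits-sound {Y} {Z} = eqList-sound eqBit eqBit-sound Y Z
  where
  eqBit-sound : ∀ {x y} → eqBit x y ≡ true → x ≡ y
  eqBit-sound {true} h = sym h
  eqBit-sound {false} {false} h = refl

eqBits-refl : ∀ Y → eqBits Y Y ≡ true
eqBits-refl = eqList-refl eqBit λ { true → refl ; false → refl }

member-sound : ∀ Y S → member Y S ≡ true → Y ∈ S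
member-sound Y S h with any-true (λ Z → eqBits Y Z) S h
... | Z , Z∈ , eq = subst (_∈ S) (sym (eqBits-sound eq)) Z∈

member-intro : ∀ {Y S} → Y ∈ S → member Y S ≡ true
member-intro {Y} Y∈ = any-intro (λ Z → eqBits Y Z) Y∈ (eqBits-refl Y)

un-injective : ∀ {m n} → un m ≡ un n → m ≡ n
un-injective {m} {n} eq = trans (sym (length-replicate m)) (trans (cong length eq) (length-replicate n))

num-injective : ∀ {n} {a b : Fin n} → un (toℕ a) ≡ un (toℕ b) → a ≡ b
num-injective eq = toℕ-injective (un-injective eq)

-- Executability

includes-sound : ∀ {n} (p s : Subset n) → includes (toList p) (toList s) ≡ true → p ⊆ s
includes-sound (true ∷ᵥ p) (true ∷ᵥ s) h here = here
includes-sound (x ∷ᵥ p) (y ∷ᵥ s) h (there i) = there (includes-sound p s (proj₂ (∧-true {not x ∨ y} h)) i)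

includes-intro : ∀ {n} (p s : Subset n) → p ⊆ s → includes (toList p) (toList s) ≡ true
includes-intro []ᵥ []ᵥ _ = refl
includes-intro (x ∷ᵥ p) (y ∷ᵥ s) sub = ∧-intro (head x y sub) (includes-intro p s (drop-∷-⊆ sub))
  where
  head : ∀ x y → (x ∷ᵥ p) ⊆ (y ∷ᵥ s) → not x ∨ y ≡ true
  head false y sub = refl
  head true y sub with sub here
  ... | here = refl

apply-toList : ∀ {n} (s d a : Subset n) → apply (toList s) (toList d) (toList a) ≡ toList ((s ─ d) ∪ a)
apply-toList []ᵥ []ᵥ []ᵥ = refl
apply-toList (true ∷ᵥ s) (true ∷ᵥ d) (z ∷ᵥ a) = cong (z ∷_) (apply-toList s d a)
apply-toList (false ∷ᵥ s) (true ∷ᵥ d) (z ∷ᵥ a) = cong (z ∷_) (apply-toList s d a)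
apply-toList (true ∷ᵥ s) (false ∷ᵥ d) (z ∷ᵥ a) = cong (true ∷_) (apply-toList s d a)
apply-toList (false ∷ᵥ s) (false ∷ᵥ d) (z ∷ᵥ a) = cong (z ∷_) (apply-toList s d a)

drop-tabulate : ∀ {X : Set} {n} (f : Fin n → X) a → Σ (List X) λ r → L.drop (toℕ a) (tabulate f) ≡ f a ∷ r
drop-tabulate f fzero = tabulate (f ∘ fsuc) , refl
drop-tabulate f (fsuc a) = drop-tabulate (f ∘ fsuc) a

drop-entry : ∀ {X : Set} {n} (f : Fin n → X) a → Σ (List X) λ r → L.drop (length (un (toℕ a))) (map f (allFin n)) ≡ f a ∷ r
drop-entry f a rewrite length-replicate (toℕ a) {tt} | map-tabulate id f = drop-tabulate f a

module _ (D : Domain) where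
  private
    table : List ⟦ Entry ⟧
    table = map (entryVal D) (allFin (nA D))
    stepD : Bool × List Bool → List ⊤ → Bool × List Bool
    stepD st a = execStep (L.drop (length a) table) st

  stepD-entry : ∀ ok (s : Subset (nF D)) a → stepD (ok , toList s) (un (toℕ a)) ≡
                (ok ∧ includes (toList (pre D a)) (toList s) , toList ((s ─ del D a) ∪ add D a))
  stepD-entry ok s a with drop-entry (entryVal D) a
  ... | r , eq rewrite eq = cong (ok ∧ includes (toList (pre D a)) (toList s) ,_) (apply-toList s (del D a) (add D a))

  execute-fails : ∀ s p → proj₁ (foldl stepD (false , toList s) (map (un ∘ toℕ) p)) ≡ false
  execute-fails s [] = refl
  execute-fails s (a ∷ p) rewrite stepD-entry false s a = execute-fails _ p

  execute-sound : ∀ s p → execute (map (un ∘ toℕ) p) (toList s) table ≡ true → Executable D s p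
  execute-sound s [] h = exec-[]
  execute-sound s (a ∷ p) h rewrite stepD-entry true s a with includes (toList (pre D a)) (toList s) in eq
  ... | true = exec-∷ (includes-sound (pre D a) s eq) (execute-sound _ p h)
  ... | false = ⊥-elim (true≢false h (execute-fails _ p))

  execute-complete : ∀ {s p} → Executable D s p → execute (map (un ∘ toℕ) p) (toList s) table ≡ true
  execute-complete exec-[] = refl
  execute-complete {s} {a ∷ p} (exec-∷ sub ex) rewrite stepD-entry true s a | includes-intro (pre D a) s sub = execute-complete ex

-- Equality of multisets of labels

private
  occ : List ⊤ → List (List ⊤) → List (List ⊤)
  occ a = filterᵇ (λ x → eqNum x a)

occ-hit : ∀ a xs → occ a (a ∷ xs) ≡ a ∷ occ a xs
occ-hit a xs rewrite eqNum-refl a = refl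

occ-∷ : ∀ a x xs → occ a (x ∷ xs) ≡ (if eqNum x a then x ∷ occ a xs else occ a xs)
occ-∷ a x xs with eqNum x a
... | true = refl
... | false = refl

occ-↭ : ∀ a {xs ys} → xs ↭ ys → occ a xs ≡ occ a ys
occ-↭ a Perm.refl = refl
occ-↭ a (Perm.prep {xs} {ys} x p) rewrite occ-∷ a x xs | occ-∷ a x ys | occ-↭ a p = refl
occ-↭ a (Perm.swap {xs} {ys} x y p)
  rewrite occ-∷ a x (y ∷ xs) | occ-∷ a y (x ∷ ys) | occ-∷ a y xs | occ-∷ a x ys | occ-↭ a p
  with eqNum x a in eqx | eqNum y a in eqy
... | true | true = cong₂ (λ u v → u ∷ v ∷ occ a ys) x≡y (sym x≡y)
  where
  x≡y : x ≡ y
  x≡y = trans (eqNum-sound eqx) (sym (eqNum-sound eqy))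
... | true | false = refl
... | false | true = refl
... | false | false = refl
occ-↭ a (Perm.trans p q) = trans (occ-↭ a p) (occ-↭ a q)

∈-occ : ∀ {a xs} → a ∈ xs → a ∈ occ a xs
∈-occ {a} a∈ = filterᵇ-∈⁺ _ a∈ (eqNum-refl a)

occ-∈ : ∀ {a b xs} → b ∈ occ a xs → a ∈ xs
occ-∈ {a} {b} {xs} b∈ with filterᵇ-∈⁻ (λ x → eqNum x a) {xs = xs} b∈
... | b∈xs , eq = subst (_∈ xs) (eqNum-sound eq) b∈xs

occ-tail : ∀ a b {xs ys} → occ a (b ∷ xs) ≡ occ a (b ∷ ys) → occ a xs ≡ occ a ys
occ-tail a b {xs} {ys} eq rewrite occ-∷ a b xs | occ-∷ a b ys with eqNum b a
... | true = cong tl eq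
... | false = eq

-- The head `x` occurs in `ys` because its count there is not empty; deleting one copy on both sides
-- keeps all counts equal.
same-occ⇒↭ : ∀ xs ys → (∀ a → occ a xs ≡ occ a ys) → xs ↭ ys
same-occ⇒↭ [] [] h = ↭-refl
same-occ⇒↭ [] (y ∷ ys) h with () ← trans (h y) (occ-hit y ys)
same-occ⇒↭ (x ∷ xs) ys h with ∈-∃++ (occ-∈ {x} {x} {ys} (subst (x ∈_) (h x) (∈-occ {x} {x ∷ xs} (here refl))))
... | hs , ts , refl = ↭-trans (prep x (same-occ⇒↭ xs (hs ++ ts) λ a →
        occ-tail a x {xs} {hs ++ ts} (trans (h a) (occ-↭ a (shift x hs ts))))) (↭-sym (shift x hs ts))

-- Counts are compared only at labels occurring in one of the lists; at any other label both are
-- empty.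
sameLabels-sound : ∀ xs ys → sameLabels xs ys ≡ true → xs ↭ ys
sameLabels-sound xs ys h = same-occ⇒↭ xs ys same
  where
  inˡ : ∀ {a} → a ∈ xs → occ a xs ≡ occ a ys
  inˡ a∈ = eqNums-sound (all-true (sameCount xs ys) xs (proj₁ (∧-true h)) a∈)
  inʳ : ∀ {a} → a ∈ ys → occ a xs ≡ occ a ys
  inʳ a∈ = eqNums-sound (all-true (sameCount xs ys) ys (proj₂ (∧-true {all (sameCount xs ys) xs} h)) a∈)
  same : ∀ a → occ a xs ≡ occ a ys
  same a with occ a xs in eqx | occ a ys in eqy
  ... | [] | [] = refl
  ... | b ∷ bs | _ = trans (sym eqx) (trans (inˡ (occ-∈ {a} {b} (subst (b ∈_) (sym eqx) (here refl)))) eqy)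
  ... | [] | b ∷ bs = trans (sym eqx) (trans (inʳ (occ-∈ {a} {b} (subst (b ∈_) (sym eqy) (here refl)))) eqy)

sameLabels-complete : ∀ {xs ys} → xs ↭ ys → sameLabels xs ys ≡ true
sameLabels-complete {xs} {ys} p = ∧-intro (all-intro _ xs λ {a} _ → same a) (all-intro _ ys λ {a} _ → same a)
  where
  same : ∀ a → sameCount xs ys a ≡ true
  same a = subst (λ z → eqNums (occ a xs) z ≡ true) (occ-↭ a p) (eqNums-refl (occ a xs))

-- Permutations, interleavings and order of occurrence in lists

zip-map : ∀ {X Y Z : Set} (f : X → Y) (g : X → Z) xs → zip (map f xs) (map g xs) ≡ map (λ x → f x , g x) xs
zip-map f g [] = refl
zip-map f g (x ∷ xs) = cong ((f x , g x) ∷_) (zip-map f g xs)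

map-≡-∈ : ∀ {X Y : Set} {f g : X → Y} {xs x} → map f xs ≡ map g xs → x ∈ xs → f x ≡ g x
map-≡-∈ eq (here refl) = ∷-injectiveˡ eq
map-≡-∈ eq (there x∈) = map-≡-∈ (∷-injectiveʳ eq) x∈

unique-↭ : ∀ {X : Set} {xs ys : List X} → xs ↭ ys → Unique xs → Unique ys
unique-↭ p = PermSetoid.Unique-resp-↭ (setoid _) (↭⇒↭ₛ p)

unique⇒↭ : ∀ {X : Set} (xs ys : List X) → Unique xs → Unique ys → (∀ {x} → x ∈ xs → x ∈ ys) → (∀ {x} → x ∈ ys → x ∈ xs) → xs ↭ ys
unique⇒↭ [] [] _ _ _ _ = ↭-refl
unique⇒↭ [] (y ∷ ys) _ _ _ g with () ← g (here refl)
unique⇒↭ (x ∷ xs) ys (x∉ ∷ ux) uy f g with ∈-∃++ (f (here refl))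
... | hs , ts , refl with unique-↭ (shift x hs ts) uy
...   | x∉′ ∷ uht = ↭-trans (prep x (unique⇒↭ xs (hs ++ ts) ux uht f′ g′)) (↭-sym (shift x hs ts))
  where
  f′ : ∀ {z} → z ∈ xs → z ∈ hs ++ ts
  f′ z∈ with ∈-resp-↭ (shift x hs ts) (f (there z∈))
  ... | here refl = ⊥-elim (All.lookup x∉ z∈ refl)
  ... | there z∈′ = z∈′
  g′ : ∀ {z} → z ∈ hs ++ ts → z ∈ xs
  g′ z∈ with g (∈-resp-↭ (↭-sym (shift x hs ts)) (there z∈))
  ... | here refl = ⊥-elim (All.lookup x∉′ z∈ refl)
  ... | there z∈′ = z∈′

↭-cancelˡ : ∀ {X : Set} (xs : List X) {ys zs} → xs ++ ys ↭ xs ++ zs → ys ↭ zs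
↭-cancelˡ [] p = p
↭-cancelˡ (x ∷ xs) p = ↭-cancelˡ xs (drop-∷ p)

-- Lifts a splitting of the plan into two label sequences to the tasks behind them; this turns a
-- matching into a linearization.
interleaving-map⁻ : ∀ {X Y : Set} (f : X → Y) l r {ys} → Interleaving (map f l) (map f r) ys →
                    Σ (List X) λ xs → Interleaving l r xs × map f xs ≡ ys
interleaving-map⁻ f [] [] [] = [] , [] , refl
interleaving-map⁻ f [] (y ∷ r) (consʳ i) with interleaving-map⁻ f [] r i
... | xs , j , refl = y ∷ xs , consʳ j , refl
interleaving-map⁻ f (x ∷ l) [] (consˡ i) with interleaving-map⁻ f l [] i
... | xs , j , refl = x ∷ xs , consˡ j , refl
interleaving-map⁻ f (x ∷ l) (y ∷ r) (consˡ i) with interleaving-map⁻ f l (y ∷ r) i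
... | xs , j , refl = x ∷ xs , consˡ j , refl
interleaving-map⁻ f (x ∷ l) (y ∷ r) (consʳ i) with interleaving-map⁻ f (x ∷ l) r i
... | xs , j , refl = y ∷ xs , consʳ j , refl

interleaving-∈ˡ : ∀ {X : Set} {l r xs : List X} {x} → Interleaving l r xs → x ∈ l → x ∈ xs
interleaving-∈ˡ (consˡ i) (here refl) = here refl
interleaving-∈ˡ (consˡ i) (there x∈) = there (interleaving-∈ˡ i x∈)
interleaving-∈ˡ (consʳ i) x∈ = there (interleaving-∈ˡ i x∈)

-- The order clause of `Linearization`, for arbitrary lists so that it admits induction.
Before : ∀ {X : Set} → X → X → List X → Set
Before t u l = Σ (Fin (length l)) λ i → Σ (Fin (length l)) λ j → (toℕ i < toℕ j) × (lookup l i ≡ t) × (lookup l j ≡ u)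

before-head : ∀ {X : Set} {t u : X} {l} → u ∈ l → Before t u (t ∷ l)
before-head u∈ = fzero , fsuc (index u∈) , z<s , refl , sym (lookup-index u∈)

before-tail : ∀ {X : Set} {t u x : X} {l} → Before t u l → Before t u (x ∷ l)
before-tail (i , j , i<j , eqi , eqj) = fsuc i , fsuc j , s≤s i<j , eqi , eqj

-- Bit vectors

module _ {n : ℕ} where

  bv : (Fin n → Bool) → List Bool
  bv P = map P (allFin n)

  bv-cong : ∀ {P Q} → (∀ t → P t ≡ Q t) → bv P ≡ bv Q
  bv-cong eq = map-cong eq (allFin n)

  bv-injective : ∀ {P Q} → bv P ≡ bv Q → ∀ t → P t ≡ Q t
  bv-injective eq t = map-≡-∈ eq (∈-allFin t)

  -- the indicator of {t}
  δ₁ : Fin n → Fin n → Bool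
  δ₁ t u = eqNum (un (toℕ u)) (un (toℕ t))

  δ₁-sound : ∀ {t u} → δ₁ t u ≡ true → u ≡ t
  δ₁-sound h = num-injective (eqNum-sound h)

  δ₁-refl : ∀ t → δ₁ t t ≡ true
  δ₁-refl t = eqNum-refl (un (toℕ t))

  δ₁-≢ : ∀ {t u} → u ≢ t → δ₁ t u ≡ false
  δ₁-≢ u≢t = ¬true (u≢t ∘ δ₁-sound)

  unionV-bv : ∀ P Q → unionV (bv P) (bv Q) ≡ bv (λ t → P t ∨ Q t)
  unionV-bv P Q = trans (cong (map _) (zip-map P Q (allFin n))) (sym (map-∘ (allFin n)))

  minusV-bv : ∀ P Q → minusV (bv P) (bv Q) ≡ bv (λ t → P t ∧ not (Q t))
  minusV-bv P Q = trans (cong (map _) (zip-map P Q (allFin n))) (sym (map-∘ (allFin n)))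

  meets-bv : ∀ P Q → meets (bv P) (bv Q) ≡ any (λ (x , y) → x ∧ y) (map (λ t → P t , Q t) (allFin n))
  meets-bv P Q = cong (any _) (zip-map P Q (allFin n))

  upFrom-iota : upFrom [] (un n) ≡ map (un ∘ toℕ) (allFin n)
  upFrom-iota = trans (go 0 n) (sym (map-tabulate id (un ∘ toℕ)))
    where
    go : ∀ k m → upFrom (un k) (un m) ≡ tabulate {n = m} (λ i → un (k + toℕ i))
    go k zero = refl
    go k (suc m) = cong₂ _∷_ (cong un (sym (+-identityʳ k))) (trans (go (suc k) m) (tabulate-cong λ i → cong un (sym (+-suc k (toℕ i)))))

  unitVectors-bv : unitVectors (un n) ≡ map (λ t → bv (δ₁ t)) (allFin n)
  unitVectors-bv rewrite upFrom-iota = trans (sym (map-∘ (allFin n))) (map-cong (λ t → sym (map-∘ (allFin n))) (allFin n))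

  zeros-bv : zeros (un n) ≡ bv (const false)
  zeros-bv = trans (go n) (sym (map-tabulate id (const false)))
    where
    go : ∀ m → zeros (un m) ≡ tabulate {n = m} (const false)
    go zero = refl
    go (suc m) = cong (false ∷_) (go m)

-- Order-preserving placement of the non-isolated tasks in the plan

module Embedding {n : ℕ} (R : Fin n → Fin n → Bool) (lab : Fin n → List ⊤)
                 (irrefl : ∀ t → ¬ (R t t ≡ true))
                 (transitive : ∀ t u v → R t u ≡ true → R u v ≡ true → R t v ≡ true)
                 (w : ℕ) where

  network : ⟦ Net ⟧
  network = map lab (allFin n) , map (λ t → bv (R t)) (allFin n) , un n

  ∅ : List Bool
  ∅ = bv {n} (const false)

  ↑ : Fin n → Fin n → Bool
  ↑ t u = δ₁ t u ∨ R t u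

  taskVal : Fin n → ⟦ Task ⟧
  taskVal t = bv (δ₁ t) , bv (R t) , lab t

  tasks-val : tasks network ≡ map taskVal (allFin n)
  tasks-val rewrite unitVectors-bv {n} | zip-map (λ t → bv (R t)) lab (allFin n) = zip-map _ _ (allFin n)

  principals : List (List Bool)
  principals = map (λ t → bv (↑ t)) (allFin n)

  upSets-val : upSets (map taskVal (allFin n)) ≡ principals
  upSets-val = trans (sym (map-∘ (allFin n))) (map-cong (λ t → unionV-bv (δ₁ t) (R t)) (allFin n))

  NonIso : Fin n → Bool
  NonIso t = any id (bv (R t)) ∨ any (λ row → meets row (bv (δ₁ t))) (map (λ t → bv (R t)) (allFin n))

  target-val : target network ≡ bv NonIso
  target-val rewrite unitVectors-bv {n} | zip-map (λ t → bv (δ₁ t)) (λ t → bv (R t)) (allFin n) = sym (map-∘ (allFin n))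

  nonIso-sound : ∀ t → NonIso t ≡ true → Σ (Fin n) λ u → R t u ≡ true ⊎ R u t ≡ true
  nonIso-sound t h with ∨-true {any id (bv (R t))} h
  ... | inj₁ h′ with any-true id (bv (R t)) h′
  ...   | b , b∈ , refl with ∈-map⁻ (R t) b∈
  ...     | u , _ , eq = u , inj₁ (sym eq)
  nonIso-sound t h | inj₂ h′ with any-true _ (map (λ t → bv (R t)) (allFin n)) h′
  ...   | row , row∈ , hm with ∈-map⁻ _ row∈
  ...     | s , _ , refl with any-true _ (map (λ u → R s u , δ₁ t u) (allFin n)) (trans (sym (meets-bv (R s) (δ₁ t))) hm)
  ...       | b , b∈ , hb with ∈-map⁻ _ b∈
  ...         | u , _ , refl with ∧-true {R s u} hb
  ...           | Rsu , δtu = s , inj₂ (subst (λ z → R s z ≡ true) (δ₁-sound δtu) Rsu)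

  nonIso-source : ∀ {t u} → R t u ≡ true → NonIso t ≡ true
  nonIso-source {t} {u} h = ∨-introˡ (any-intro id (∈-map⁺ (R t) (∈-allFin u)) h)

  nonIso-sink : ∀ {t u} → R t u ≡ true → NonIso u ≡ true
  nonIso-sink {t} {u} h = ∨-introʳ (any id (bv (R u))) (any-intro _ (∈-map⁺ (λ t → bv (R t)) (∈-allFin t))
    (trans (meets-bv (R t) (δ₁ u)) (any-intro _ (∈-map⁺ (λ v → R t v , δ₁ u v) (∈-allFin u)) (∧-intro h (δ₁-refl u)))))

  cand : List (List Bool)
  cand = candidates w principals ∅

  UpSet : (Fin n → Bool) → Set
  UpSet P = ∀ {t u} → P t ≡ true → R t u ≡ true → P u ≡ true

  IsUp : List Bool → Set
  IsUp Y = Σ (Fin n → Bool) λ P → Y ≡ bv P × UpSet P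

  ↑-up : ∀ t → UpSet (↑ t)
  ↑-up t {u} {v} h r with ∨-true {δ₁ t u} h
  ... | inj₁ e = ∨-introʳ (δ₁ t v) (subst (λ z → R z v ≡ true) (δ₁-sound e) r)
  ... | inj₂ r′ = ∨-introʳ (δ₁ t v) (transitive t u v r′ r)

  ∪-up : ∀ {P Q} → UpSet P → UpSet Q → UpSet (λ t → P t ∨ Q t)
  ∪-up {P} {Q} p q {t} {u} h r with ∨-true {P t} h
  ... | inj₁ a = ∨-introˡ (p a r)
  ... | inj₂ b = ∨-introʳ (P u) (q b r)

  -- Principal up-sets are closed by transitivity and unions preserve closure, so membership in the
  -- table already certifies an up-set.
  candidates-up : ∀ k {Y} → Y ∈ candidates k principals ∅ → IsUp Y
  candidates-up zero (here refl) = const false , refl , λ ()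
  candidates-up (suc k) {Y} Y∈ with find (∈-concatMap⁻ (λ Y → Y ∷ map (λ u → unionV u Y) principals) {xs = candidates k principals ∅} Y∈)
  ... | Z , Z∈ , here refl = candidates-up k Z∈
  ... | Z , Z∈ , there Y∈′ with ∈-map⁻ (λ u → unionV u Z) Y∈′
  ...   | U , U∈ , refl with ∈-map⁻ (λ t → bv (↑ t)) U∈ | candidates-up k Z∈
  ...     | t , _ , refl | P , refl , upP = _ , unionV-bv (↑ t) P , ∪-up (↑-up t) upP

  ⋃ : List (Fin n) → Fin n → Bool
  ⋃ [] u = false
  ⋃ (t ∷ ts) u = ↑ t u ∨ ⋃ ts u

  ⋃-candidate : ∀ k ts → length ts ≤ k → bv (⋃ ts) ∈ candidates k principals ∅
  ⋃-candidate zero [] _ = here refl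
  ⋃-candidate (suc k) [] _ = ∈-concatMap⁺ _ (lose (⋃-candidate k [] z≤n) (here refl))
  ⋃-candidate (suc k) (t ∷ ts) (s≤s le) = ∈-concatMap⁺ _ (lose (⋃-candidate k ts le)
      (there (subst (_∈ map (λ u → unionV u (bv (⋃ ts))) principals) (unionV-bv (↑ t) (⋃ ts)) (∈-map⁺ (λ u → unionV u (bv (⋃ ts))) (∈-map⁺ (λ t → bv (↑ t)) (∈-allFin t))))))

  ⋃-sound : ∀ ts {u} → ⋃ ts u ≡ true → Σ (Fin n) λ t → t ∈ ts × ↑ t u ≡ true
  ⋃-sound (t ∷ ts) {u} h with ∨-true {↑ t u} h
  ... | inj₁ a = t , here refl , a
  ... | inj₂ b with ⋃-sound ts b
  ...   | s , s∈ , h′ = s , there s∈ , h′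

  ⋃-intro : ∀ {ts t u} → t ∈ ts → ↑ t u ≡ true → ⋃ ts u ≡ true
  ⋃-intro (here refl) h = ∨-introˡ h
  ⋃-intro {s ∷ ts} {u = u} (there t∈) h = ∨-introʳ (↑ s u) (⋃-intro t∈ h)

  -- A right fold over the plan is the left fold over the reversed plan that the program performs;
  -- its recursion follows the suffixes of the plan, and so do the inductions below.
  reached : List (List ⊤) → List (List Bool)
  reached = foldr (λ a S → advance (map taskVal (allFin n)) cand S a) (∅ ∷ [])

  embeds-reached : ∀ plan → embeds w network plan ≡ member (bv NonIso) (reached plan)
  embeds-reached plan rewrite target-val | tasks-val | upSets-val | zeros-bv {n} =
    cong (member (bv NonIso)) (reverse-foldl (advance (map taskVal (allFin n)) cand) (∅ ∷ []) plan)

  infixl 6 _∖_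
  _∖_ : (Fin n → Bool) → Fin n → Fin n → Bool
  (P ∖ t) u = P u ∧ not (δ₁ t u)

  ∖-at : ∀ P t → (P ∖ t) t ≡ false
  ∖-at P t rewrite δ₁-refl t with P t
  ... | true = refl
  ... | false = refl

  ∖-≢ : ∀ P {t u} → u ≢ t → (P ∖ t) u ≡ P u
  ∖-≢ P {t} {u} u≢t rewrite δ₁-≢ u≢t with P u
  ... | true = refl
  ... | false = refl

  reached-sound : ∀ a p P → bv P ∈ reached (a ∷ p) → UpSet P × (bv P ∈ reached p ⊎ Σ (Fin n) λ t → lab t ≡ a × bv (P ∖ t) ∈ reached p)
  reached-sound a p P P∈ with filterᵇ-∈⁻ (reachable (map taskVal (allFin n)) (reached p) a) {xs = cand} P∈
  ... | c∈ , h = upP , how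
    where
    upP : UpSet P
    upP {t} {u} Pt r with candidates-up w c∈
    ... | Q , eq , upQ = trans (bv-injective eq u) (upQ (trans (sym (bv-injective eq t)) Pt) r)
    how : bv P ∈ reached p ⊎ Σ (Fin n) λ t → lab t ≡ a × bv (P ∖ t) ∈ reached p
    how with ∨-true {member (bv P) (reached p)} h
    ... | inj₁ m = inj₁ (member-sound (bv P) (reached p) m)
    ... | inj₂ m with any-true _ (map taskVal (allFin n)) m
    ...   | tv , tv∈ , h′ with ∈-map⁻ taskVal tv∈
    ...     | t , _ , refl with ∧-true {eqNum (lab t) a} h′
    ...       | l≡a , m′ = inj₂ (t , eqNum-sound l≡a , subst (_∈ reached p) (minusV-bv P (δ₁ t)) (member-sound _ (reached p) m′))

  reached-skip : ∀ a p {P : Fin n → Bool} → bv P ∈ cand → bv P ∈ reached p → bv P ∈ reached (a ∷ p)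
  reached-skip a p {P} c∈ P∈ = filterᵇ-∈⁺ _ c∈ (∨-introˡ (member-intro {bv P} P∈))

  reached-take : ∀ p t {P} → bv P ∈ cand → bv (P ∖ t) ∈ reached p → bv P ∈ reached (lab t ∷ p)
  reached-take p t {P} c∈ P∈ = filterᵇ-∈⁺ _ c∈ (∨-introʳ (member (bv P) (reached p))
    (any-intro _ (∈-map⁺ taskVal (∈-allFin t)) (∧-intro (eqNum-refl (lab t)) (member-intro (subst (_∈ reached p) (sym (minusV-bv P (δ₁ t))) P∈)))))

  -- Compatibility with the order in recursive form: every tail is closed under successors, which
  -- matches the up-sets of the dynamic program.
  Closed : List (Fin n) → Set
  Closed [] = ⊤
  Closed (t ∷ l) = (∀ u → R t u ≡ true → u ∈ l) × Closed l

  -- What a table entry certifies: the tasks of `P` occupy some positions of `p` in an admissible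
  -- order, and `others` lists the labels of the positions still free.
  record Placement (p : List (List ⊤)) (P : Fin n → Bool) : Set where
    field
      order  : List (Fin n)
      others : List (List ⊤)
      mixed  : Interleaving (map lab order) others p
      listed : ∀ {t} → P t ≡ true → t ∈ order
      sound  : ∀ {t} → t ∈ order → P t ≡ true
      unique : Unique order
      closed : Closed order

  open Placement

  placement : ∀ p P → bv P ∈ reached p → Placement p P
  placement [] P (here eq) = record
    { order = [] ; others = [] ; mixed = [] ; listed = λ {t} Pt → ⊥-elim (true≢false Pt (bv-injective eq t))
    ; sound = λ () ; unique = [] ; closed = tt }
  placement (a ∷ p) P P∈ with reached-sound a p P P∈
  ... | upP , inj₁ P∈′ = skip (placement p P P∈′)
    where
    skip : Placement p P → Placement (a ∷ p) P
    skip pl = record { order = order pl ; others = a ∷ others pl ; mixed = consʳ (mixed pl) ; listed = listed pl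
                     ; sound = sound pl ; unique = unique pl ; closed = closed pl }
  ... | upP , inj₂ (t , refl , P∈′) with P t in Pt | placement p (P ∖ t) P∈′
  -- The chosen task is not in `P`, so its removal left `P` unchanged and the position stays free.
  ...   | false | pl = record { order = order pl ; others = lab t ∷ others pl ; mixed = consʳ (mixed pl)
                     ; listed = λ {u} h → listed pl (trans (same u) h)
                     ; sound = λ {u} h → trans (sym (same u)) (sound pl h)
                     ; unique = unique pl ; closed = closed pl }
    where
    same : ∀ u → (P ∖ t) u ≡ P u
    same u with u ≟ t
    ... | yes refl = trans (∖-at P t) (sym Pt)
    ... | no u≢t = ∖-≢ P u≢t
  ...   | true | pl = record
    { order = t ∷ order pl ; others = others pl ; mixed = consˡ (mixed pl)
    ; listed = listed′ ; sound = sound′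
    ; unique = ¬Any⇒All¬ _ (λ t∈ → true≢false (sound pl t∈) (∖-at P t)) ∷ unique pl
    -- Successors of `t` lie in the up-set `P` and differ from `t` by irreflexivity, so they are
    -- among the tasks placed already.
    ; closed = (λ u r → listed pl (trans (∖-≢ P (λ { refl → irrefl t r })) (upP Pt r))) , closed pl }
    where
    listed′ : ∀ {u} → P u ≡ true → u ∈ t ∷ order pl
    listed′ {u} Pu with u ≟ t
    ... | yes refl = here refl
    ... | no u≢t = there (listed pl (trans (∖-≢ P u≢t) Pu))
    sound′ : ∀ {u} → u ∈ t ∷ order pl → P u ≡ true
    sound′ (here refl) = Pt
    sound′ (there u∈) = proj₁ (∧-true (sound pl u∈))

  closed-before : ∀ {l r L t u} → Interleaving l r L → Closed l → t ∈ l → R t u ≡ true → Before t u L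
  closed-before (consˡ i) (c , _) (here refl) r = before-head (interleaving-∈ˡ i (c _ r))
  closed-before (consˡ i) (_ , cs) (there t∈) r = before-tail (closed-before i cs t∈ r)
  closed-before (consʳ i) cs t∈ r = before-tail (closed-before i cs t∈ r)

  embeds-sound : ∀ plan → embeds w network plan ≡ true → map lab (allFin n) ↭ plan →
                 Σ (List (Fin n)) λ L → L ↭ allFin n × map lab L ≡ plan × (∀ t u → R t u ≡ true → Before t u L)
  embeds-sound plan h labels = assemble
    where
    pl : Placement plan NonIso
    pl = placement plan NonIso (member-sound (bv NonIso) (reached plan) (trans (sym (embeds-reached plan)) h))
    iso : List (Fin n)
    iso = filterᵇ (not ∘ NonIso) (allFin n)
    isolated : ∀ {t} → t ∈ iso → NonIso t ≡ false
    isolated t∈ = not-true (proj₂ (filterᵇ-∈⁻ (not ∘ NonIso) {xs = allFin n} t∈))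
      where
      not-true : ∀ {b} → not b ≡ true → b ≡ false
      not-true {false} _ = refl
    all-tasks : order pl ++ iso ↭ allFin n
    all-tasks = unique⇒↭ _ _
      (unique-++ (unique pl) (unique-filter _ (allFin⁺ n)) (λ (t∈l , t∈i) → true≢false (sound pl t∈l) (isolated t∈i)))
      (allFin⁺ n) (λ {t} _ → ∈-allFin t) cover
      where
      cover : ∀ {t} → t ∈ allFin n → t ∈ order pl ++ iso
      cover {t} t∈ with NonIso t in eq
      ... | true = ∈-++⁺ˡ (listed pl eq)
      ... | false = ∈-++⁺ʳ (order pl) (filterᵇ-∈⁺ (not ∘ NonIso) t∈ (cong not eq))
    -- The labels of the placed tasks are cancelled from both sides of the equality of multisets.
    fill : map lab iso ↭ others pl
    fill = ↭-cancelˡ (map lab (order pl)) (↭-trans (↭-reflexive (sym (map-++ lab (order pl) iso)))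
             (↭-trans (↭-map lab all-tasks) (↭-trans labels (toPermutation (mixed pl)))))
    assemble : Σ (List (Fin n)) λ L → L ↭ allFin n × map lab L ≡ plan × (∀ t u → R t u ≡ true → Before t u L)
    assemble with ↭-map-inv lab fill
    ... | iso′ , eq , iso↭ with interleaving-map⁻ lab (order pl) iso′ (subst (λ r → Interleaving (map lab (order pl)) r plan) eq (mixed pl))
    ...   | L , i , labs = L , ↭-trans (toPermutation i) (↭-trans (++⁺ˡ (order pl) (↭-sym iso↭)) all-tasks) , labs ,
                           -- Order constraints start at non-isolated tasks only, all of which are
                           -- in `order pl`.
                           λ t u r → closed-before i (closed pl) (listed pl (nonIso-source r)) r

  isStrictPartialOrder : IsStrictPartialOrder _≡_ (λ t u → R t u ≡ true)
  isStrictPartialOrder = record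
    { isEquivalence = isEquivalence
    ; irrefl = λ { refl → irrefl _ }
    ; trans = λ {t} {u} {v} → transitive t u v
    ; <-resp-≈ = (λ { refl → id }) , (λ { refl → id }) }

  module _ (width : ∀ xs → Unique xs → (∀ {t} → t ∈ xs → NonIso t ≡ true) →
                    (∀ {t u} → t ∈ xs → u ∈ xs → ¬ (R t u ≡ true)) → length xs ≤ w) where

    -- An up-set is generated by its minimal elements, which form an antichain.
    upSet-candidate : ∀ P → UpSet P → (∀ {t} → P t ≡ true → NonIso t ≡ true) → bv P ∈ cand
    upSet-candidate P upP sub = subst (_∈ cand) (bv-cong same) (⋃-candidate w mins few)
      where
      dominated : Fin n → Bool
      dominated t = any (λ s → P s ∧ R s t) (allFin n)
      mins : List (Fin n)
      mins = filterᵇ (λ t → P t ∧ not (dominated t)) (allFin n)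
      min⇒P : ∀ {t} → t ∈ mins → P t ≡ true × dominated t ≡ false
      min⇒P {t} t∈ with ∧-true {P t} (proj₂ (filterᵇ-∈⁻ (λ t → P t ∧ not (dominated t)) {xs = allFin n} t∈))
      ... | Pt , nd with dominated t
      ...   | false = Pt , refl
      few : length mins ≤ w
      few = width mins (unique-filter _ (allFin⁺ n)) (λ t∈ → sub (proj₁ (min⇒P t∈)))
        (λ {t} {u} t∈ u∈ r → true≢false (any-intro (λ s → P s ∧ R s u) (∈-allFin t) (∧-intro (proj₁ (min⇒P t∈)) r)) (proj₂ (min⇒P u∈)))
      -- Descends through predecessors inside `P`; well-foundedness of a strict order on a finite
      -- set makes this end at a minimal element.
      below : ∀ u → Acc (λ t u → R t u ≡ true) u → P u ≡ true → Σ (Fin n) λ t → t ∈ mins × ↑ t u ≡ true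
      below u (WF.acc rs) Pu with dominated u in eq
      ... | false = u , filterᵇ-∈⁺ _ (∈-allFin u) (∧-intro Pu (cong not eq)) , ∨-introˡ (δ₁-refl u)
      ... | true with any-true (λ s → P s ∧ R s u) (allFin n) eq
      ...   | s , _ , h with ∧-true {P s} h
      ...     | Ps , r with below s (rs r) Ps
      ...       | t , t∈ , h′ = t , t∈ , ↑-up t h′ r
      same : ∀ u → ⋃ mins u ≡ P u
      same u = bool-ext forth back
        where
        forth : ⋃ mins u ≡ true → P u ≡ true
        forth h with ⋃-sound mins h
        ... | t , t∈ , h′ with ∨-true {δ₁ t u} h′
        ...   | inj₁ e = subst (λ z → P z ≡ true) (sym (δ₁-sound e)) (proj₁ (min⇒P t∈))
        ...   | inj₂ r = upP (proj₁ (min⇒P t∈)) r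
        back : P u ≡ true → ⋃ mins u ≡ true
        back Pu with below u (spo-wellFounded isStrictPartialOrder u) Pu
        ... | t , t∈ , h = ⋃-intro t∈ h

    open DecMembership (_≟_ {n}) using (_∈?_)

    -- The state that the dynamic program must reach after the tail `l` of a given linearization.
    suffix : List (Fin n) → Fin n → Bool
    suffix l t = NonIso t ∧ does (t ∈? l)

    suffix-sound : ∀ l {t} → suffix l t ≡ true → NonIso t ≡ true × t ∈ l
    suffix-sound l {t} h with ∧-true {NonIso t} h
    ... | ni , d with t ∈? l
    ...   | yes t∈ = ni , t∈

    suffix-intro : ∀ l {t} → NonIso t ≡ true → t ∈ l → suffix l t ≡ true
    suffix-intro l {t} ni t∈ with t ∈? l
    ... | yes _ = ∧-intro ni refl
    ... | no t∉ = ⊥-elim (t∉ t∈)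

    closed-up : ∀ {l} → Closed l → UpSet (suffix l)
    closed-up {l} c {t} {u} h r = suffix-intro l (nonIso-sink r) (after c (proj₂ (suffix-sound l h)))
      where
      after : ∀ {l} → Closed l → t ∈ l → u ∈ l
      after (c , _) (here refl) = there (c u r)
      after (_ , cs) (there t∈) = there (after cs t∈)

    -- Follows the linearization from its end: a non-isolated head is matched with its own position,
    -- an isolated head is skipped. Each state is an up-set of non-isolated tasks, hence a candidate
    -- by the width bound.
    reached-suffix : ∀ l → Unique l → Closed l → bv (suffix l) ∈ reached (map lab l)
    reached-suffix [] _ _ = here (bv-cong λ t → ¬true λ h → nothing-in (proj₂ (suffix-sound [] h)))
      where
      nothing-in : ∀ {t : Fin n} → ¬ (t ∈ [])
      nothing-in ()
    reached-suffix (t ∷ l) (t∉ ∷ ul) c@(_ , cs) with NonIso t in ni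
    ... | true = reached-take (map lab l) t c∈ (subst (_∈ reached (map lab l)) (bv-cong (λ u → bool-ext (forth u) (back u))) (reached-suffix l ul cs))
      where
      c∈ : bv (suffix (t ∷ l)) ∈ cand
      c∈ = upSet-candidate (suffix (t ∷ l)) (closed-up c) (proj₁ ∘ suffix-sound (t ∷ l))
      forth : ∀ u → suffix l u ≡ true → (suffix (t ∷ l) ∖ t) u ≡ true
      forth u h with suffix-sound l h
      ... | nu , u∈ = trans (∖-≢ (suffix (t ∷ l)) (λ { refl → All.lookup t∉ u∈ refl })) (suffix-intro (t ∷ l) nu (there u∈))
      back : ∀ u → (suffix (t ∷ l) ∖ t) u ≡ true → suffix l u ≡ true
      back u h with ∧-true {suffix (t ∷ l) u} h
      ... | s , _ with suffix-sound (t ∷ l) s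
      ...   | nu , there u∈ = suffix-intro l nu u∈
      ...   | nu , here refl = ⊥-elim (true≢false h (∖-at (suffix (t ∷ l)) t))
    ... | false = reached-skip (lab t) (map lab l) c∈ (subst (_∈ reached (map lab l)) (bv-cong (λ u → bool-ext (forth u) (back u))) (reached-suffix l ul cs))
      where
      c∈ : bv (suffix (t ∷ l)) ∈ cand
      c∈ = upSet-candidate (suffix (t ∷ l)) (closed-up c) (proj₁ ∘ suffix-sound (t ∷ l))
      forth : ∀ u → suffix l u ≡ true → suffix (t ∷ l) u ≡ true
      forth u h with suffix-sound l h
      ... | nu , u∈ = suffix-intro (t ∷ l) nu (there u∈)
      back : ∀ u → suffix (t ∷ l) u ≡ true → suffix l u ≡ true
      back u h with suffix-sound (t ∷ l) h
      ... | nu , there u∈ = suffix-intro l nu u∈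
      ... | nu , here refl = ⊥-elim (true≢false nu ni)

    -- `Before` only asserts that some positions are in order; uniqueness makes them the only
    -- positions of the two tasks, so a successor of the head must lie in the tail.
    before-closed : ∀ L → Unique L → (∀ {t u} → t ∈ L → R t u ≡ true → Before t u L) → Closed L
    before-closed [] _ _ = tt
    before-closed (x ∷ L) (x∉ ∷ uL) h = head , before-closed L uL tail
      where
      head : ∀ u → R x u ≡ true → u ∈ L
      head u r with h (here refl) r
      ... | fzero , fsuc j , _ , _ , refl = ∈-lookup j
      ... | fsuc i , _ , _ , refl , _ = ⊥-elim (All.lookup x∉ (∈-lookup i) refl)
      tail : ∀ {t u} → t ∈ L → R t u ≡ true → Before t u L
      tail t∈ r with h (there t∈) r
      ... | fzero , _ , _ , refl , _ = ⊥-elim (All.lookup x∉ t∈ refl)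
      ... | fsuc i , fsuc j , s≤s i<j , eqi , eqj = i , j , i<j , eqi , eqj

    embeds-complete : ∀ L → L ↭ allFin n → (∀ t u → R t u ≡ true → Before t u L) → embeds w network (map lab L) ≡ true
    embeds-complete L perm before = trans (embeds-reached (map lab L))
      (member-intro (subst (_∈ reached (map lab L)) (bv-cong λ t → bool-ext (proj₁ ∘ suffix-sound L) (λ ni → suffix-intro L ni (∈-resp-↭ (↭-sym perm) (∈-allFin t))))
        (reached-suffix L unique-L (before-closed L unique-L (λ {t} {u} _ → before t u)))))
      where
      unique-L : Unique L
      unique-L = unique-↭ (↭-sym perm) (allFin⁺ n)

-- Correctness of the verification function

module _ (w : ℕ) (I : PVInstance) (wf : WellFormed I) (prims : Primitive (tn I)) where
  private
    net′ : TN (dom I)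
    net′ = tn I
    label : Fin (nT net′) → List _
    label t = labelNum (α net′ t)
    planNums = map (un ∘ toℕ) (plan I)

  open Embedding (ord net′) label (proj₁ (proj₂ wf)) (proj₂ (proj₂ wf)) w

  -- `labelNum` identifies an action with the compound task of the same index; primitivity rules the
  -- latter out.
  labels-agree : ∀ l p → map label l ≡ map (un ∘ toℕ) p → map (α net′) l ≡ map inj₁ p
  labels-agree [] [] _ = refl
  labels-agree (t ∷ l) (a ∷ p) eq = cong₂ _∷_ head (labels-agree l p (∷-injectiveʳ eq))
    where
    head : α net′ t ≡ inj₁ a
    head with α net′ t | prims t | ∷-injectiveˡ eq
    ... | _ | b , refl | e = cong inj₁ (num-injective e)

  verify-sound : verify w (instVal I) ≡ true → PVYes I
  verify-sound h =
    let executable , rest = ∧-true {execute planNums _ _} h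
        same , embedded = ∧-true {sameLabels (map label (allFin (nT net′))) planNums} rest
        l , perm , labels , before = embeds-sound planNums embedded (sameLabels-sound _ planNums same)
    in l , (perm , before) , labels-agree l (plan I) labels , execute-sound (dom I) (s₀ I) (plan I) executable

  verify-complete : GenWidth≤ w net′ → PVYes I → verify w (instVal I) ≡ true
  verify-complete width (l , (perm , before) , labels , executable) =
    ∧-intro (execute-complete (dom I) executable)
      (∧-intro (sameLabels-complete (↭-trans (↭-map label (↭-sym perm)) (↭-reflexive nums)))
        (subst (λ p → embeds w network p ≡ true) nums (embeds-complete narrow l perm before)))
    where
    nums : map label l ≡ planNums
    nums = trans (map-∘ l) (trans (cong (map labelNum) labels) (sym (map-∘ (plan I))))
    narrow : ∀ xs → Unique xs → (∀ {t} → t ∈ xs → NonIso t ≡ true) → (∀ {t u} → t ∈ xs → u ∈ xs → ¬ (ord net′ t u ≡ true)) → length xs ≤ w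
    narrow xs unique nonIso antichain = width xs (unique , (λ t t∈ isolated → comparable (nonIso t∈) isolated) ,
      λ { t u t∈ u∈ (inj₁ r) → antichain t∈ u∈ r ; t u t∈ u∈ (inj₂ r) → antichain u∈ t∈ r })
      where
      comparable : ∀ {t} → NonIso t ≡ true → ¬ Isolated net′ t
      comparable {t} ni isolated with nonIso-sound t ni
      -- Irreflexivity makes the related task different from `t`, as `Isolated` speaks of other
      -- elements only.
      ... | u , inj₁ r = isolated u (λ { refl → proj₁ (proj₂ wf) u r }) (inj₁ r)
      ... | u , inj₂ r = isolated u (λ { refl → proj₁ (proj₂ wf) u r }) (inj₂ r)

theorem5 : (w : ℕ) →
    Σ TM λ M → Σ ℕ λ k → Σ ℕ λ c →
    (I : PVInstance) → WellFormed I → Primitive (tn I) → GenWidth≤ w (tn I) →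
    DecidesWithin M (c * length (encode I) ^ k + c) (PVYes I) (encode I)
theorem5 w = conclude (decides (planVerificationF w))
  where
  conclude : (Σ TM λ M → Σ ℕ λ k → Σ ℕ λ c → ∀ bs →
                st (run (c * length bs ^ k + c) (initConfig M bs)) ≡ verdict (fun (planVerificationF w) bs)) →
             Σ TM λ M → Σ ℕ λ k → Σ ℕ λ c →
               (I : PVInstance) → WellFormed I → Primitive (tn I) → GenWidth≤ w (tn I) →
               DecidesWithin M (c * length (encode I) ^ k + c) (PVYes I) (encode I)
  conclude (M , k , c , correct) = M , k , c , λ I wf prims width →
    (λ yes → trans (outcome≡ I) (cong verdict (verify-complete w I wf prims width yes))) ,
    (λ no → trans (outcome≡ I) (cong verdict (¬true (no ∘ verify-sound w I wf prims))))
    where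
    outcome≡ : ∀ I → st (run (c * length (encode I) ^ k + c) (initConfig M (encode I))) ≡ verdict (verify w (instVal I))
    outcome≡ I = trans (correct (encode I)) (cong (verdict ∘ verify w ∘ proj₁) (parses-instance I))
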